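{- For all integers $d,k,\kappa\ge 1$ and every real $\delta>0$ there exists a constant $c=c(d,\delta,k,\kappa)>0$ such that the following holds. Let $n\ge k$, let $P$ be a sequence of $n$ points in general position in $\mathbb{R}^d$, let $\rho$ be a sequence of $k$ points in general position in $\mathbb{R}^d$, and let the entries of both sequences be colored with colors from $[\kappa]=\{1,\dots,\kappa\}$. Suppose that $\rho$ has density $\delta$ in $P$, i.e. at least $\delta\binom{n}{k}$ of the $k$-element subsequences of $P$ are copies of $\rho$. Then there exist pairwise disjoint subsequences $X_1,\dots,X_k$ of $P$, each with at least $c\cdot n$ points, such that $(X_1,\dots,X_k)$ has $\rho$-type transversals with respect to $P$; that is, for every choice of $x_1\in X_1,\dots,x_k\in X_k$, the sequence $(x_1,\dots,x_k)$ is a copy of $\rho$ and is a subsequence of $P$.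
   Context: A set (or sequence) of points in $\mathbb{R}^d$ is in general position if no $j\le d+1$ of them lie in a common $(j-2)$-flat (affine subspace of dimension $j-2$; in particular the points are distinct). The orientation of a $(d+1)$-tuple of points is $\chi(p_1,\dots,p_{d+1})=\operatorname{sgn}\det M$, where $M$ is the $(d+1)\times(d+1)$ matrix whose $i$-th row is $(1,p_i(1),\dots,p_i(d))$, with $p_i(j)$ the $j$-th coordinate of $p_i$. Sequences are indexed from $1$; $S(i)$ is the $i$-th entry of the sequence $S$. Subsequences preserve the order of the original sequence. Two sequences $\sigma,\tau$ of $k$ points in $\mathbb{R}^d$ have the same labelled order type, written $\sigma\simeq\tau$, if $\chi(\sigma(i_1),\dots,\sigma(i_{d+1}))=\chi(\tau(i_1),\dots,\tau(i_{d+1}))$ for all $1\le i_1<\cdots<i_{d+1}\le k$. Two colored sequences $\sigma,\tau$ of $k$ points are copies of one another if $\sigma\simeq\tau$ and, for every $i\in[k]$, the color of $\sigma(i)$ equals the color of $\tau(i)$. Points of subsequences of $P$ inherit the colors they have in $P$; the colors of $P$ and of $\rho$ are assigned independently (the same point of $\mathbb{R}^d$ may have different colors in $P$ and in $\rho$). -}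

module Defs where

open import Level using (0ℓ)
open import Algebra.Bundles using (RawRing)
open import Data.Fin as Fin using (Fin; zero; suc; toℕ; punchIn)
open import Data.Fin.Subset using (Subset; _∈_; _∩_; Empty)
open import Data.Integer as ℤ using ()
open import Data.List using (List; length)
open import Data.List.Relation.Unary.All using (All)
open import Data.List.Relation.Unary.Unique.Propositional using (Unique)
open import Data.Nat as ℕ using (ℕ)
import Data.Nat.Properties as ℕ
open import Data.Nat.Combinatorics using (_C_)
open import Data.Product using (Σ; ∃-syntax; _×_; _,_; proj₁; proj₂)
open import Data.Rational as ℚ using (ℚ; 0ℚ; 1ℚ; ½; 1/_)
import Data.Rational.Properties as ℚ
open import Data.Rational.Solver using (module +-*-Solver)
open import Data.Sum using (_⊎_)
open import Data.Vec as Vec using (Vec)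
open import Data.Vec.Functional as Vector using (Vector)
open import Function using (_∘_; _⇔_)
open import Relation.Binary.PropositionalEquality using (_≡_; _≢_; refl; sym; cong; subst; module ≡-Reasoning)
open import Relation.Nullary using (¬_)

------------------------------------------------------------------------
-- Cauchy sequences of rationals.  The proofs that constants, sums, products
-- and negatives are Cauchy are opaque so that they never unfold; the sequences
-- themselves compute.

IsCauchy : (ℕ → ℚ) → Set
IsCauchy x = ∀ ε → 0ℚ ℚ.< ε →
  ∃[ N ] ∀ m n → N ℕ.≤ m → N ℕ.≤ n → ℚ.∣ x m ℚ.- x n ∣ ℚ.< ε

private
  0<½* : ∀ {ε} → 0ℚ ℚ.< ε → 0ℚ ℚ.< ½ ℚ.* ε
  0<½* {ε} 0<ε = subst (ℚ._< ½ ℚ.* ε) (ℚ.*-zeroʳ ½) (ℚ.*-monoʳ-<-pos ½ 0<ε)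

  ½+½ : ∀ ε → ½ ℚ.* ε ℚ.+ ½ ℚ.* ε ≡ ε
  ½+½ = solve 1 (λ e → con ½ :* e :+ con ½ :* e := e) refl
    where open +-*-Solver

  +-diff : ∀ a b c d → (a ℚ.+ b) ℚ.- (c ℚ.+ d) ≡ (a ℚ.- c) ℚ.+ (b ℚ.- d)
  +-diff = solve 4 (λ a b c d → (a :+ b) :- (c :+ d) := (a :- c) :+ (b :- d)) refl
    where open +-*-Solver

  neg-diff : ∀ a b → (ℚ.- a) ℚ.- (ℚ.- b) ≡ ℚ.- (a ℚ.- b)
  neg-diff = solve 2 (λ a b → (:- a) :- (:- b) := :- (a :- b)) refl
    where open +-*-Solver

  *-diff : ∀ a b c d → a ℚ.* b ℚ.- c ℚ.* d ≡ a ℚ.* (b ℚ.- d) ℚ.+ d ℚ.* (a ℚ.- c)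
  *-diff = solve 4 (λ a b c d → a :* b :- c :* d := a :* (b :- d) :+ d :* (a :- c)) refl
    where open +-*-Solver

  a-b+b : ∀ a b → (a ℚ.- b) ℚ.+ b ≡ a
  a-b+b = solve 2 (λ a b → (a :- b) :+ b := a) refl
    where open +-*-Solver

opaque
  const-cauchy : ∀ q → IsCauchy (λ _ → q)
  const-cauchy q ε 0<ε = 0 , λ _ _ _ _ →
    subst (ℚ._< ε) (sym (cong ℚ.∣_∣ (ℚ.+-inverseʳ q))) 0<ε

opaque
  neg-cauchy : ∀ {x} → IsCauchy x → IsCauchy (λ n → ℚ.- x n)
  neg-cauchy {x} cx ε 0<ε with cx ε 0<ε
  ... | N , close = N , λ m n N≤m N≤n → begin-strict
    ℚ.∣ (ℚ.- x m) ℚ.- (ℚ.- x n) ∣  ≡⟨ cong ℚ.∣_∣ (neg-diff (x m) (x n)) ⟩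
    ℚ.∣ ℚ.- (x m ℚ.- x n) ∣        ≡⟨ ℚ.∣-p∣≡∣p∣ (x m ℚ.- x n) ⟩
    ℚ.∣ x m ℚ.- x n ∣              <⟨ close m n N≤m N≤n ⟩
    ε                              ∎
    where open ℚ.≤-Reasoning

opaque
  +-cauchy : ∀ {x y} → IsCauchy x → IsCauchy y → IsCauchy (λ n → x n ℚ.+ y n)
  +-cauchy {x} {y} cx cy ε 0<ε with cx (½ ℚ.* ε) (0<½* 0<ε) | cy (½ ℚ.* ε) (0<½* 0<ε)
  ... | M , closeˣ | N , closeʸ = M ℕ.⊔ N , λ m n ≤m ≤n → begin-strict
    ℚ.∣ (x m ℚ.+ y m) ℚ.- (x n ℚ.+ y n) ∣
      ≡⟨ cong ℚ.∣_∣ (+-diff (x m) (y m) (x n) (y n)) ⟩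
    ℚ.∣ (x m ℚ.- x n) ℚ.+ (y m ℚ.- y n) ∣
      ≤⟨ ℚ.∣p+q∣≤∣p∣+∣q∣ (x m ℚ.- x n) (y m ℚ.- y n) ⟩
    ℚ.∣ x m ℚ.- x n ∣ ℚ.+ ℚ.∣ y m ℚ.- y n ∣
      <⟨ ℚ.+-mono-< (closeˣ m n (ℕ.m⊔n≤o⇒m≤o M N ≤m) (ℕ.m⊔n≤o⇒m≤o M N ≤n))
                    (closeʸ m n (ℕ.m⊔n≤o⇒n≤o M N ≤m) (ℕ.m⊔n≤o⇒n≤o M N ≤n)) ⟩
    ½ ℚ.* ε ℚ.+ ½ ℚ.* ε
      ≡⟨ ½+½ ε ⟩
    ε ∎
    where open ℚ.≤-Reasoning

cauchy-bounded : ∀ {x} → IsCauchy x →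
  ∃[ B ] ℚ.Positive B × ∃[ N ] ∀ n → N ℕ.≤ n → ℚ.∣ x n ∣ ℚ.≤ B
cauchy-bounded {x} cx with cx 1ℚ (ℚ.positive⁻¹ 1ℚ)
... | N , close = 1ℚ ℚ.+ ℚ.∣ x N ∣ , ℚ.positive 0<B , N , λ n N≤n → begin
  ℚ.∣ x n ∣                          ≡⟨ cong ℚ.∣_∣ (sym (a-b+b (x n) (x N))) ⟩
  ℚ.∣ (x n ℚ.- x N) ℚ.+ x N ∣        ≤⟨ ℚ.∣p+q∣≤∣p∣+∣q∣ (x n ℚ.- x N) (x N) ⟩
  ℚ.∣ x n ℚ.- x N ∣ ℚ.+ ℚ.∣ x N ∣    ≤⟨ ℚ.+-monoˡ-≤ ℚ.∣ x N ∣ (ℚ.<⇒≤ (close n N N≤n ℕ.≤-refl)) ⟩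
  1ℚ ℚ.+ ℚ.∣ x N ∣                   ∎
  where
  open ℚ.≤-Reasoning
  0<B : 0ℚ ℚ.< 1ℚ ℚ.+ ℚ.∣ x N ∣
  0<B = ℚ.+-mono-<-≤ (ℚ.positive⁻¹ 1ℚ) (ℚ.0≤∣p∣ (x N))

private
  split-ε : ∀ A B → ℚ.Positive A → ℚ.Positive B → ∀ ε → 0ℚ ℚ.< ε →
    ∃[ η ] 0ℚ ℚ.< η × A ℚ.* η ℚ.+ B ℚ.* η ≡ ε
  split-ε A B A>0 B>0 ε 0<ε = go (A ℚ.+ B) refl (ℚ.pos+pos⇒pos A {{A>0}} B {{B>0}})
    where
    go : ∀ S → S ≡ A ℚ.+ B → ℚ.Positive S → ∃[ η ] 0ℚ ℚ.< η × A ℚ.* η ℚ.+ B ℚ.* η ≡ ε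
    go S S≡A+B S>0 = S⁻¹ ℚ.* ε , 0<η , (begin
      A ℚ.* (S⁻¹ ℚ.* ε) ℚ.+ B ℚ.* (S⁻¹ ℚ.* ε)  ≡⟨ ℚ.*-distribʳ-+ (S⁻¹ ℚ.* ε) A B ⟨
      (A ℚ.+ B) ℚ.* (S⁻¹ ℚ.* ε)                ≡⟨ cong (ℚ._* (S⁻¹ ℚ.* ε)) S≡A+B ⟨
      S ℚ.* (S⁻¹ ℚ.* ε)                        ≡⟨ ℚ.*-assoc S S⁻¹ ε ⟨
      (S ℚ.* S⁻¹) ℚ.* ε                        ≡⟨ cong (ℚ._* ε) (ℚ.*-inverseʳ S {{S≢0}}) ⟩
      1ℚ ℚ.* ε                                 ≡⟨ ℚ.*-identityˡ ε ⟩
      ε                                        ∎)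
      where
      open ≡-Reasoning
      S≢0 : ℚ.NonZero S
      S≢0 = ℚ.pos⇒nonZero S {{S>0}}
      S⁻¹ : ℚ
      S⁻¹ = (1/ S) {{S≢0}}
      0<η : 0ℚ ℚ.< S⁻¹ ℚ.* ε
      0<η = subst (ℚ._< S⁻¹ ℚ.* ε) (ℚ.*-zeroʳ S⁻¹)
        (ℚ.*-monoʳ-<-pos S⁻¹ {{ℚ.1/pos⇒pos S {{S>0}}}} 0<ε)

  ∣ab∣<Dη : ∀ {D η} a b → ℚ.Positive D → ℚ.∣ a ∣ ℚ.≤ D → ℚ.∣ b ∣ ℚ.< η →
    ℚ.∣ a ℚ.* b ∣ ℚ.< D ℚ.* η
  ∣ab∣<Dη {D} {η} a b D>0 a≤ b< = begin-strict
    ℚ.∣ a ℚ.* b ∣          ≡⟨ ℚ.∣p*q∣≡∣p∣*∣q∣ a b ⟩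
    ℚ.∣ a ∣ ℚ.* ℚ.∣ b ∣    ≤⟨ ℚ.*-monoʳ-≤-nonNeg ℚ.∣ b ∣ {{ℚ.nonNegative (ℚ.0≤∣p∣ b)}} a≤ ⟩
    D ℚ.* ℚ.∣ b ∣          <⟨ ℚ.*-monoʳ-<-pos D {{D>0}} b< ⟩
    D ℚ.* η                ∎
    where open ℚ.≤-Reasoning

  *-close : ∀ A B η {a b c d} → ℚ.Positive A → ℚ.Positive B →
    ℚ.∣ a ∣ ℚ.≤ A → ℚ.∣ d ∣ ℚ.≤ B → ℚ.∣ a ℚ.- c ∣ ℚ.< η → ℚ.∣ b ℚ.- d ∣ ℚ.< η →
    ℚ.∣ a ℚ.* b ℚ.- c ℚ.* d ∣ ℚ.< A ℚ.* η ℚ.+ B ℚ.* η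
  *-close A B η {a} {b} {c} {d} A>0 B>0 a≤ d≤ a-c< b-d< = begin-strict
    ℚ.∣ a ℚ.* b ℚ.- c ℚ.* d ∣
      ≡⟨ cong ℚ.∣_∣ (*-diff a b c d) ⟩
    ℚ.∣ a ℚ.* (b ℚ.- d) ℚ.+ d ℚ.* (a ℚ.- c) ∣
      ≤⟨ ℚ.∣p+q∣≤∣p∣+∣q∣ (a ℚ.* (b ℚ.- d)) (d ℚ.* (a ℚ.- c)) ⟩
    ℚ.∣ a ℚ.* (b ℚ.- d) ∣ ℚ.+ ℚ.∣ d ℚ.* (a ℚ.- c) ∣
      <⟨ ℚ.+-mono-< (∣ab∣<Dη a (b ℚ.- d) A>0 a≤ b-d<) (∣ab∣<Dη d (a ℚ.- c) B>0 d≤ a-c<) ⟩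
    A ℚ.* η ℚ.+ B ℚ.* η
      ∎
    where open ℚ.≤-Reasoning

  ⊔₄-≤ : ∀ a b c d {n} → (a ℕ.⊔ b) ℕ.⊔ (c ℕ.⊔ d) ℕ.≤ n →
    (a ℕ.≤ n × b ℕ.≤ n) × (c ℕ.≤ n × d ℕ.≤ n)
  ⊔₄-≤ a b c d ≤n = (ℕ.m⊔n≤o⇒m≤o a b l , ℕ.m⊔n≤o⇒n≤o a b l) ,
                    (ℕ.m⊔n≤o⇒m≤o c d r , ℕ.m⊔n≤o⇒n≤o c d r)
    where
    l = ℕ.m⊔n≤o⇒m≤o (a ℕ.⊔ b) (c ℕ.⊔ d) ≤n
    r = ℕ.m⊔n≤o⇒n≤o (a ℕ.⊔ b) (c ℕ.⊔ d) ≤n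

  *-modulus : ∀ (x y : ℕ → ℚ) {A B η ε M₁ N₁ M₂ N₂} →
    ℚ.Positive A → ℚ.Positive B → A ℚ.* η ℚ.+ B ℚ.* η ≡ ε →
    (∀ n → M₁ ℕ.≤ n → ℚ.∣ x n ∣ ℚ.≤ A) →
    (∀ n → N₁ ℕ.≤ n → ℚ.∣ y n ∣ ℚ.≤ B) →
    (∀ m n → M₂ ℕ.≤ m → M₂ ℕ.≤ n → ℚ.∣ x m ℚ.- x n ∣ ℚ.< η) →
    (∀ m n → N₂ ℕ.≤ m → N₂ ℕ.≤ n → ℚ.∣ y m ℚ.- y n ∣ ℚ.< η) →
    ∃[ K ] ∀ m n → K ℕ.≤ m → K ℕ.≤ n → ℚ.∣ x m ℚ.* y m ℚ.- x n ℚ.* y n ∣ ℚ.< ε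
  *-modulus x y {A} {B} {η} {M₁ = M₁} {N₁} {M₂} {N₂} A>0 B>0 refl bndˣ bndʸ closeˣ closeʸ =
    (M₁ ℕ.⊔ N₁) ℕ.⊔ (M₂ ℕ.⊔ N₂) , λ m n ≤m ≤n →
      close m n (⊔₄-≤ M₁ N₁ M₂ N₂ ≤m) (⊔₄-≤ M₁ N₁ M₂ N₂ ≤n)
    where
    close : ∀ m n → (M₁ ℕ.≤ m × N₁ ℕ.≤ m) × (M₂ ℕ.≤ m × N₂ ℕ.≤ m) →
      (M₁ ℕ.≤ n × N₁ ℕ.≤ n) × (M₂ ℕ.≤ n × N₂ ℕ.≤ n) →
      ℚ.∣ x m ℚ.* y m ℚ.- x n ℚ.* y n ∣ ℚ.< A ℚ.* η ℚ.+ B ℚ.* η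
    close m n ((M₁≤m , _) , (M₂≤m , N₂≤m)) ((_ , N₁≤n) , (M₂≤n , N₂≤n)) =
      *-close A B η A>0 B>0 (bndˣ m M₁≤m) (bndʸ n N₁≤n)
        (closeˣ m n M₂≤m M₂≤n) (closeʸ m n N₂≤m N₂≤n)

opaque
  *-cauchy : ∀ {x y} → IsCauchy x → IsCauchy y → IsCauchy (λ n → x n ℚ.* y n)
  *-cauchy {x} {y} cx cy ε 0<ε = bounds (cauchy-bounded {x} cx) (cauchy-bounded {y} cy)
    where
    Goal : Set
    Goal = ∃[ K ] ∀ m n → K ℕ.≤ m → K ℕ.≤ n → ℚ.∣ x m ℚ.* y m ℚ.- x n ℚ.* y n ∣ ℚ.< ε

    bounds :
      (∃[ A ] ℚ.Positive A × ∃[ N ] ∀ n → N ℕ.≤ n → ℚ.∣ x n ∣ ℚ.≤ A) →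
      (∃[ B ] ℚ.Positive B × ∃[ N ] ∀ n → N ℕ.≤ n → ℚ.∣ y n ∣ ℚ.≤ B) → Goal
    bounds (A , A>0 , _ , bndˣ) (B , B>0 , _ , bndʸ) = scale (split-ε A B A>0 B>0 ε 0<ε)
      where
      scale : (∃[ η ] 0ℚ ℚ.< η × A ℚ.* η ℚ.+ B ℚ.* η ≡ ε) → Goal
      scale (η , 0<η , Aη+Bη≡ε) =
        *-modulus x y A>0 B>0 Aη+Bη≡ε bndˣ bndʸ (proj₂ (cx η 0<η)) (proj₂ (cy η 0<η))

------------------------------------------------------------------------
-- Real numbers: rational Cauchy sequences, up to the equality _≃_

record ℝ : Set where
  constructor mkℝ
  field
    approx : ℕ → ℚ
    cauchy : IsCauchy approx

open ℝ public

fromℚ : ℚ → ℝ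
fromℚ q = mkℝ (λ _ → q) (const-cauchy q)

fromℕ : ℕ → ℝ
fromℕ n = fromℚ (ℤ.+ n ℚ./ 1)

0ℝ 1ℝ : ℝ
0ℝ = fromℚ 0ℚ
1ℝ = fromℚ 1ℚ

infix  8 -ᴿ_
infixl 7 _*ᴿ_
infixl 6 _+ᴿ_
infix  4 _≃_ _<ᴿ_ _≤ᴿ_ _#_

_+ᴿ_ _*ᴿ_ : ℝ → ℝ → ℝ
mkℝ x cx +ᴿ mkℝ y cy = mkℝ (λ n → x n ℚ.+ y n) (+-cauchy {x} {y} cx cy)
mkℝ x cx *ᴿ mkℝ y cy = mkℝ (λ n → x n ℚ.* y n) (*-cauchy {x} {y} cx cy)

-ᴿ_ : ℝ → ℝ
-ᴿ mkℝ x cx = mkℝ (λ n → ℚ.- x n) (neg-cauchy {x} cx)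

_≃_ : ℝ → ℝ → Set
x ≃ y = ∀ ε → 0ℚ ℚ.< ε →
  ∃[ N ] ∀ n → N ℕ.≤ n → ℚ.∣ approx x n ℚ.- approx y n ∣ ℚ.< ε

_<ᴿ_ : ℝ → ℝ → Set
x <ᴿ y = ∃[ ε ] 0ℚ ℚ.< ε ×
  ∃[ N ] ∀ n → N ℕ.≤ n → approx x n ℚ.+ ε ℚ.< approx y n

_≤ᴿ_ : ℝ → ℝ → Set
x ≤ᴿ y = ¬ (y <ᴿ x)

-- Apartness, the constructive form of x ≠ y.
_#_ : ℝ → ℝ → Set
x # y = x <ᴿ y ⊎ y <ᴿ x

ℝ-rawRing : RawRing 0ℓ 0ℓ
ℝ-rawRing = record
  { Carrier = ℝ ; _≈_ = _≃_ ; _+_ = _+ᴿ_ ; _*_ = _*ᴿ_ ; -_ = -ᴿ_ ; 0# = 0ℝ ; 1# = 1ℝ }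

open import Algebra.Definitions.RawMonoid (RawRing.+-rawMonoid ℝ-rawRing) public
  using () renaming (sum to sumᴿ)

-- The sign of a real is not computable, so sgn is given by its graph.
data Sgn : Set where
  neg nil pos : Sgn

HasSgn : ℝ → Sgn → Set
HasSgn x neg = x <ᴿ 0ℝ
HasSgn x nil = x ≃ 0ℝ
HasSgn x pos = 0ℝ <ᴿ x

------------------------------------------------------------------------
-- Determinants (Laplace expansion along the first row)

module Determinant {a ℓ} (R : RawRing a ℓ) where
  open RawRing R
  open import Algebra.Definitions.RawMonoid +-rawMonoid using (sum)
  open import Algebra.Definitions.RawSemiring rawSemiring using (_^_)

  det : ∀ {n} → (Fin n → Fin n → Carrier) → Carrier
  det {ℕ.zero}  M = 1#
  det {ℕ.suc n} M = sum λ j →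
    (- 1#) ^ toℕ j * (M zero j * det (λ r c → M (suc r) (punchIn j c)))

open Determinant ℝ-rawRing public using () renaming (det to detᴿ)

------------------------------------------------------------------------
-- Points, flats and general position

Point : ℕ → Set
Point d = Vector ℝ d

_#ᵛ_ : ∀ {d} → Point d → Point d → Set
x #ᵛ y = ∃[ a ] x a # y a

0ᵛ : ∀ {d} → Point d
0ᵛ _ = 0ℝ

_+ᵛ_ : ∀ {d} → Point d → Point d → Point d
(x +ᵛ y) a = x a +ᴿ y a

combination : ∀ {d m} → Vector ℝ m → Vector (Point d) m → Point d
combination t v a = sumᴿ λ l → t l *ᴿ v l a

-- Constructive form of linear independence: a nonzero coefficient vector
-- gives a nonzero combination, with nonzero meaning apart from zero.
LinearlyIndependent : ∀ {d m} → Vector (Point d) m → Set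
LinearlyIndependent v = ∀ t → t #ᵛ 0ᵛ → combination t v #ᵛ 0ᵛ

record Flat (d m : ℕ) : Set where
  field
    base        : Point d
    direction   : Vector (Point d) m
    independent : LinearlyIndependent direction

pointAt : ∀ {d m} → Flat d m → Vector ℝ m → Point d
pointAt F t = Flat.base F +ᵛ combination t (Flat.direction F)

_∉ᶠ_ : ∀ {d m} → Point d → Flat d m → Set
x ∉ᶠ F = ∀ t → x #ᵛ pointAt F t

-- Positions in a sequence of length n are the elements of Fin n; a strictly
-- increasing map Fin k → Fin n is a subsequence of length k.
StrictlyIncreasing : ∀ {k n} → (Fin k → Fin n) → Set
StrictlyIncreasing f = ∀ {i j} → i Fin.< j → f i Fin.< f j

-- No j = m + 2 ≤ d + 1 entries lie in a common (j - 2)-flat, with "not all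
-- entries lie in F" in the positive form "some entry avoids F".  For j ≤ 1
-- there is nothing to require, the only candidate flat being empty.
GeneralPosition : ∀ {d n} → Vector (Point d) n → Set
GeneralPosition {d} {n} p =
  ∀ m → m ℕ.< d → (i : Fin (2 ℕ.+ m) → Fin n) → StrictlyIncreasing i →
  (F : Flat d m) → ∃[ a ] p (i a) ∉ᶠ F

------------------------------------------------------------------------
-- Order types and copies

orientationMatrix : ∀ {d} → Vector (Point d) (ℕ.suc d) → Fin (ℕ.suc d) → Fin (ℕ.suc d) → ℝ
orientationMatrix p i = 1ℝ Vector.∷ p i

-- The graph of χ.
HasOrientation : ∀ {d} → Vector (Point d) (ℕ.suc d) → Sgn → Set
HasOrientation p s = HasSgn (detᴿ (orientationMatrix p)) s

SameOrderType : ∀ {d k} → Vector (Point d) k → Vector (Point d) k → Set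
SameOrderType {d} {k} σ τ =
  (i : Fin (ℕ.suc d) → Fin k) → StrictlyIncreasing i →
  ∀ s → HasOrientation (σ ∘ i) s ⇔ HasOrientation (τ ∘ i) s

record ColouredSeq (d κ n : ℕ) : Set where
  field
    point  : Vector (Point d) n
    colour : Vector (Fin κ) n

open ColouredSeq public

_∘ˢ_ : ∀ {d κ n k} → ColouredSeq d κ n → (Fin k → Fin n) → ColouredSeq d κ k
point  (P ∘ˢ f) = point P ∘ f
colour (P ∘ˢ f) = colour P ∘ f

IsCopy : ∀ {d κ k} → ColouredSeq d κ k → ColouredSeq d κ k → Set
IsCopy σ τ = SameOrderType (point σ) (point τ) × (∀ i → colour σ i ≡ colour τ i)

-- At least δ · C(n,k) of the k-element subsequences of P, represented by their
-- vectors of positions, are copies of ρ.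
HasDensity : ∀ {d κ n k} → ℝ → ColouredSeq d κ k → ColouredSeq d κ n → Set
HasDensity {n = n} {k} δ ρ P = Σ (List (Vec (Fin n) k)) λ copies →
  Unique copies ×
  All (λ f → StrictlyIncreasing (Vec.lookup f) × IsCopy (P ∘ˢ Vec.lookup f) ρ) copies ×
  δ *ᴿ fromℕ (n C k) ≤ᴿ fromℕ (length copies)

-- A subset of positions determines a subsequence.
PairwiseDisjoint : ∀ {n k} → (Fin k → Subset n) → Set
PairwiseDisjoint X = ∀ i j → i ≢ j → Empty (X i ∩ X j)

HasTypeTransversals : ∀ {d κ n k} →
  ColouredSeq d κ k → ColouredSeq d κ n → (Fin k → Subset n) → Set
HasTypeTransversals {n = n} {k} ρ P X =
  (x : Fin k → Fin n) → (∀ i → x i ∈ X i) →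
  IsCopy (P ∘ˢ x) ρ × StrictlyIncreasing x

{-# OPTIONS --safe #-}
module Submission where

-- General position makes every orientation determinant apart from zero: going through a
-- tuple of points from the last one backwards, some minor of the rows (1, p) stays apart
-- from zero because the next point avoids the flat of its successors.  Hence P may be
-- replaced by rational points, and "y is an increasing copy of ρ" becomes a conjunction of
-- boundedly many conditions [F(y₁,…,y_k) > 0] = b with F multilinear in encodings of the
-- vertices as vectors of bounded dimension.
--
-- For such conditions a dense set of k-tuples contains large parts: fix z = (y₂,…,y_k) and
-- regard F as a linear functional of y₁.  For any finite set of vectors and any η > 0 there
-- are boundedly many test vectors such that the signs of a functional on the tests determine
-- its signs on all but an η-fraction of the set.  So the first vertex can be eliminated, a
-- choice of signs on the tests being again a condition of the same kind on z.
--
-- The tests are found by induction on the dimension: once all vectors lie on one side of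
-- x₀ = 0 they can be scaled to the same x₀, so their differences have one dimension less and
-- almost all comparisons between two vectors are determined; testing an approximate median
-- p then settles the sign on everything known to be above p or on everything known to be below.

open import Defs
open import Algebra.Bundles using (RawRing; CommutativeRing)
open import Algebra.Definitions.RawSemiring (RawRing.rawSemiring ℝ-rawRing) using () renaming (_^_ to _^ᴿ_)
open import Data.Bool using (Bool; true; false; not; _∧_; _∨_; T)
open import Data.Empty using (⊥; ⊥-elim)
open import Data.Fin as Fin using (Fin; zero; suc; punchIn; punchOut; toℕ; inject₁; _↑ˡ_; _↑ʳ_) renaming (fromℕ to top)
import Data.Fin.Properties as Fin
open import Data.Fin.Relation.Unary.Top using (view; ‵fromℕ; ‵inject₁)
open import Data.Fin.Subset using (Subset; ∣_∣) renaming (_∈_ to _∈ˢ_)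
import Data.Fin.Subset.Properties as Subset
open import Data.Integer as ℤ using ()
import Data.Integer.Properties as ℤ
open import Data.List as List using (List; []; _∷_; _++_; length; map; filterᵇ; cartesianProduct; allFin)
import Data.List.Properties as List
open import Data.List.Membership.Propositional using (_∈_)
import Data.List.Membership.Propositional.Properties as ∈
open import Data.List.Relation.Unary.All as All using (All; []; _∷_)
open import Data.List.Relation.Unary.AllPairs using ([]; _∷_)
open import Data.List.Relation.Unary.Any using (here; there)
open import Data.List.Relation.Unary.Unique.Propositional using (Unique)
open import Data.Nat as ℕ using (ℕ; zero; suc; _+_; _*_; _^_; _≤_; _<_; z≤n; s≤s; _≤ᵇ_; >-nonZero)
open import Data.Nat.Combinatorics using (nCk+nC[k+1]≡[n+1]C[k+1]; nC1≡n; k>n⇒nCk≡0) renaming (_C_ to _choose_)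
open import Data.Nat.Coprimality using (1-coprimeTo) renaming (sym to coprime-sym)
import Data.Nat.Properties as ℕ
open import Data.Nat.Tactic.RingSolver using (solve-∀)
open import Data.Product using (Σ; ∃; ∃-syntax; _×_; _,_; proj₁; proj₂)
open import Data.Rational as ℚ using (ℚ; 0ℚ; 1ℚ; ½; 1/_; mkℚ; *<*; *≤*)
import Data.Rational.Properties as ℚ
open import Algebra.Definitions.RawSemiring (RawRing.rawSemiring ℚ.+-*-rawRing) using () renaming (_^_ to _^ℚ_)
open import Algebra.Properties.CommutativeMonoid.Sum ℚ.+-0-commutativeMonoid using (∑-distrib-+; ∑-comm; sum-cong-≗; sum-replicate-zero; sum-init-last) renaming (sum to sumℚ)
open import Algebra.Properties.Semiring.Sum (CommutativeRing.semiring ℚ.+-*-commutativeRing) using (*-distribˡ-sum)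
open import Data.Rational.Solver using (module +-*-Solver)
open import Data.Sum using (_⊎_; inj₁; inj₂; swap)
open import Data.Unit using (⊤; tt)
open import Data.Vec as Vec using (Vec; []; _∷_; head; tail; lookup; tabulate)
open import Data.Vec.Functional as Vector using (Vector)
import Data.Vec.Properties as Vec
open import Function using (_∘_; id; mk⇔; Equivalence)
open import Relation.Binary.Definitions using (Tri; tri<; tri≈; tri>)
open import Relation.Binary.PropositionalEquality using (_≡_; _≢_; _≗_; refl; sym; trans; cong; cong₂; subst; subst₂; module ≡-Reasoning)
open import Relation.Nullary using (Dec; does; yes; no; ¬_)
open import Relation.Nullary.Decidable using (dec-true; dec-false; _→-dec_)
open Determinant ℚ.+-*-rawRing using () renaming (det to detℚ)

-- Two bounds shape the proof: the number of tests must not depend on n, and one set of answers has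
-- to serve many z at once, since every z gives its own functional of y₁. So a single chain of
-- answers is followed. At each test the answer more frequent among the surviving functionals is
-- kept, and t tests cost at most a factor 2^t in the density of z.
--
-- The induction on the dimension alternates between two statements. A median yields one determined
-- cell of positive proportion, whereas finding a median one dimension higher needs all but a small
-- fraction of the pairs determined; cutting off cells repeatedly leads from the one to the other.
-- The fraction is 1/17 because the median argument needs a number above 16.
--
-- Positions and colours enter the encoding next to the coordinates, so the ground set is the full
-- product of n^k tuples, from which a vertex can be split off, and being increasing is just another
-- condition. Signs of Cauchy reals are not decidable, so determinants have to be bounded away from
-- zero by an explicit ε before rational points, taken at one common late index, can stand in for P.

-- Finite sums and counting over lists

∑ : {A : Set} → List A → (A → ℕ) → ℕ
∑ []       f = 0
∑ (x ∷ xs) f = f x + ∑ xs f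

ind : Bool → ℕ
ind true  = 1
ind false = 0

count : {A : Set} → (A → Bool) → List A → ℕ
count p xs = ∑ xs (ind ∘ p)

∑-mono : {A : Set} (xs : List A) {f g : A → ℕ} → (∀ {x} → x ∈ xs → f x ≤ g x) → ∑ xs f ≤ ∑ xs g
∑-mono []       f≤g = z≤n
∑-mono (x ∷ xs) f≤g = ℕ.+-mono-≤ (f≤g (here refl)) (∑-mono xs (f≤g ∘ there))

∑-cong : {A : Set} (xs : List A) {f g : A → ℕ} → f ≗ g → ∑ xs f ≡ ∑ xs g
∑-cong []       f≗g = refl
∑-cong (x ∷ xs) f≗g = cong₂ _+_ (f≗g x) (∑-cong xs f≗g)

private
  interchange : ∀ a b c d → (a + b) + (c + d) ≡ (a + c) + (b + d)
  interchange = solve-∀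

∑-+ : {A : Set} (xs : List A) (f g : A → ℕ) → ∑ xs (λ x → f x + g x) ≡ ∑ xs f + ∑ xs g
∑-+ []       f g = refl
∑-+ (x ∷ xs) f g = trans (cong (f x + g x +_) (∑-+ xs f g)) (interchange (f x) (g x) (∑ xs f) (∑ xs g))

∑-*ˡ : {A : Set} (xs : List A) (c : ℕ) (f : A → ℕ) → ∑ xs (λ x → c * f x) ≡ c * ∑ xs f
∑-*ˡ []       c f = sym (ℕ.*-zeroʳ c)
∑-*ˡ (x ∷ xs) c f = trans (cong (c * f x +_) (∑-*ˡ xs c f)) (sym (ℕ.*-distribˡ-+ c (f x) (∑ xs f)))

∑-const : {A : Set} (xs : List A) (c : ℕ) → ∑ xs (λ _ → c) ≡ length xs * c
∑-const []       c = refl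
∑-const (x ∷ xs) c = cong (c +_) (∑-const xs c)

∑-swap : {A B : Set} (xs : List A) (ys : List B) (f : A → B → ℕ) →
  ∑ xs (λ x → ∑ ys (f x)) ≡ ∑ ys (λ y → ∑ xs (λ x → f x y))
∑-swap []       ys f = sym (trans (∑-const ys 0) (ℕ.*-zeroʳ (length ys)))
∑-swap (x ∷ xs) ys f = trans (cong (∑ ys (f x) +_) (∑-swap xs ys f)) (sym (∑-+ ys (f x) _))

∑-++ : {A : Set} (xs ys : List A) (f : A → ℕ) → ∑ (xs ++ ys) f ≡ ∑ xs f + ∑ ys f
∑-++ []       ys f = refl
∑-++ (x ∷ xs) ys f = trans (cong (f x +_) (∑-++ xs ys f)) (sym (ℕ.+-assoc (f x) (∑ xs f) (∑ ys f)))

∑-map : {A B : Set} (g : A → B) (xs : List A) (f : B → ℕ) → ∑ (map g xs) f ≡ ∑ xs (f ∘ g)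
∑-map g []       f = refl
∑-map g (x ∷ xs) f = cong (f (g x) +_) (∑-map g xs f)

∑-cartesian : {A B : Set} (xs : List A) (ys : List B) (f : A × B → ℕ) →
  ∑ (cartesianProduct xs ys) f ≡ ∑ xs (λ x → ∑ ys (λ y → f (x , y)))
∑-cartesian []       ys f = refl
∑-cartesian (x ∷ xs) ys f = trans (∑-++ (map (x ,_) ys) (cartesianProduct xs ys) f)
  (cong₂ _+_ (∑-map (x ,_) ys f) (∑-cartesian xs ys f))

length-cartesian : {A B : Set} (xs : List A) (ys : List B) →
  length (cartesianProduct xs ys) ≡ length xs * length ys
length-cartesian xs ys = begin
  length (cartesianProduct xs ys)                 ≡⟨ ℕ.*-identityʳ _ ⟨
  length (cartesianProduct xs ys) * 1             ≡⟨ ∑-const (cartesianProduct xs ys) 1 ⟨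
  ∑ (cartesianProduct xs ys) (λ _ → 1)            ≡⟨ ∑-cartesian xs ys (λ _ → 1) ⟩
  ∑ xs (λ _ → ∑ ys (λ _ → 1))                     ≡⟨ ∑-const xs _ ⟩
  length xs * ∑ ys (λ _ → 1)                      ≡⟨ cong (length xs *_) (trans (∑-const ys 1) (ℕ.*-identityʳ _)) ⟩
  length xs * length ys                           ∎
  where open ≡-Reasoning

length-filterᵇ : {A : Set} (q : A → Bool) (xs : List A) → length (filterᵇ q xs) ≡ count q xs
length-filterᵇ q [] = refl
length-filterᵇ q (x ∷ xs) with q x
... | true  = cong suc (length-filterᵇ q xs)
... | false = length-filterᵇ q xs

count-filterᵇ : {A : Set} (p q : A → Bool) (xs : List A) → count p (filterᵇ q xs) ≡ count (λ x → q x ∧ p x) xs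
count-filterᵇ p q [] = refl
count-filterᵇ p q (x ∷ xs) with q x
... | true  = cong (ind (p x) +_) (count-filterᵇ p q xs)
... | false = count-filterᵇ p q xs

∈-filterᵇ⁻ : {A : Set} (q : A → Bool) (xs : List A) {x : A} → x ∈ filterᵇ q xs → x ∈ xs × q x ≡ true
∈-filterᵇ⁻ q (y ∷ ys) x∈ with q y in qy
∈-filterᵇ⁻ q (y ∷ ys) (here refl) | true = here refl , qy
∈-filterᵇ⁻ q (y ∷ ys) (there x∈)  | true with ∈-filterᵇ⁻ q ys x∈
... | x∈ys , qx = there x∈ys , qx
∈-filterᵇ⁻ q (y ∷ ys) x∈ | false with ∈-filterᵇ⁻ q ys x∈
... | x∈ys , qx = there x∈ys , qx

ind-mono : ∀ {p q} → (p ≡ true → q ≡ true) → ind p ≤ ind q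
ind-mono {false}         p⇒q = z≤n
ind-mono {true}  {true}  p⇒q = s≤s z≤n
ind-mono {true}  {false} p⇒q with p⇒q refl
... | ()

count-mono : {A : Set} (xs : List A) {p q : A → Bool} → (∀ x → p x ≡ true → q x ≡ true) → count p xs ≤ count q xs
count-mono xs p⇒q = ∑-mono xs (λ {x} _ → ind-mono (p⇒q x))

count-split : {A : Set} (p q : A → Bool) (xs : List A) →
  count p xs ≡ count (λ x → p x ∧ q x) xs + count (λ x → p x ∧ not (q x)) xs
count-split p q xs = trans (∑-cong xs λ x → split (p x) (q x)) (∑-+ xs _ _)
  where
  split : ∀ a b → ind a ≡ ind (a ∧ b) + ind (a ∧ not b)
  split true  true  = refl
  split true  false = refl
  split false b     = refl

count-true : {A : Set} (xs : List A) → count (λ _ → true) xs ≡ length xs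
count-true xs = trans (∑-const xs 1) (ℕ.*-identityʳ _)

count≤length : {A : Set} (p : A → Bool) (xs : List A) → count p xs ≤ length xs
count≤length p xs = subst (count p xs ≤_) (count-true xs) (count-mono xs λ _ _ → refl)

search : {A : Set} (p : A → Bool) (xs : List A) →
  (∃[ x ] x ∈ xs × p x ≡ true) ⊎ (∀ {x} → x ∈ xs → p x ≡ false)
search p [] = inj₂ λ ()
search p (x ∷ xs) with p x in px
... | true  = inj₁ (x , here refl , px)
... | false with search p xs
... | inj₁ (y , y∈ , py) = inj₁ (y , there y∈ , py)
... | inj₂ none = inj₂ λ { (here refl) → px ; (there y∈) → none y∈ }

count-witness : {A : Set} (p : A → Bool) (xs : List A) → 0 < count p xs → ∃[ x ] x ∈ xs × p x ≡ true
count-witness p xs 0<c with search p xs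
... | inj₁ found = found
... | inj₂ none  = ⊥-elim (ℕ.<-irrefl (sym zero-count) 0<c)
  where
  zero-count : count p xs ≡ 0
  zero-count = ℕ.n≤0⇒n≡0 (ℕ.≤-trans (∑-mono xs (λ x∈ → ℕ.≤-reflexive (cong ind (none x∈))))
    (ℕ.≤-reflexive (trans (∑-const xs 0) (ℕ.*-zeroʳ (length xs)))))

∧-true : ∀ {a b} → a ∧ b ≡ true → a ≡ true × b ≡ true
∧-true {true} {true} _ = refl , refl

not-true : ∀ {a} → not a ≡ true → a ≡ false
not-true {false} _ = refl

≤ᵇ-true : ∀ {m n} → (m ≤ᵇ n) ≡ true → m ≤ n
≤ᵇ-true {m} {n} eq = ℕ.≤ᵇ⇒≤ m n (subst T (sym eq) tt)

≤ᵇ-false : ∀ {m n} → (m ≤ᵇ n) ≡ false → n < m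
≤ᵇ-false {m} {n} eq = ℕ.≰⇒> λ m≤n → subst T eq (ℕ.≤⇒≤ᵇ m≤n)

-- Approximate medians of a partially known order

module _ {A : Set} (xs : List A) where
  private
    N : ℕ
    N = length xs

  known : (R : A → A → Bool) (U : A → A → Bool) → A → ℕ
  known R U p = count (λ i → R p i ∧ not (U p i)) xs

  -- Among the b² ordered pairs of β-elements at least half are in R, yet every β-row
  -- of R is short up to the exceptional pairs.
  few-short-rows : (R : A → A → Bool) → (∀ i j → R i j ∨ R j i ≡ true) →
    (U : A → A → Bool) → 17 * ∑ xs (λ p → ∑ xs λ i → ind (U p i)) ≤ N * N →
    (β : A → Bool) → (∀ {p} → p ∈ xs → β p ≡ true → 17 * known R U p ≤ N) →
    17 * (count β xs * count β xs) ≤ 4 * (N * N)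
  few-short-rows R total U U-small β short = begin
    17 * (count β xs * count β xs)                           ≡⟨ cong (17 *_) square ⟩
    17 * ∑ xs (λ p → ∑ xs λ i → e p i)                        ≤⟨ ℕ.*-monoʳ-≤ 17 double ⟩
    17 * (Q + Q)                                              ≡⟨ twice Q ⟩
    2 * (17 * Q)                                              ≤⟨ ℕ.*-monoʳ-≤ 2 Q-small ⟩
    2 * (N * N + N * N)                                       ≡⟨ four (N * N) ⟩
    4 * (N * N)                                               ∎
    where
    open ℕ.≤-Reasoning
    e : A → A → ℕ
    e p i = ind (β p) * ind (β i)
    Q : ℕ
    Q = ∑ xs λ p → ∑ xs λ i → e p i * ind (R p i)
    twice : ∀ q → 17 * (q + q) ≡ 2 * (17 * q)
    twice = solve-∀
    four : ∀ q → 2 * (q + q) ≡ 4 * q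
    four = solve-∀
    square : count β xs * count β xs ≡ ∑ xs (λ p → ∑ xs λ i → e p i)
    square = sym (trans (∑-cong xs λ p → trans (∑-*ˡ xs (ind (β p)) (ind ∘ β)) (ℕ.*-comm (ind (β p)) _))
                        (∑-*ˡ xs (count β xs) (ind ∘ β)))
    cover : ∀ a b c d → c ∨ d ≡ true → ind a * ind b ≤ ind a * ind b * ind c + ind b * ind a * ind d
    cover false b     c     d     _  = z≤n
    cover true  false c     d     _  = z≤n
    cover true  true  true  d     _  = s≤s z≤n
    cover true  true  false true  _  = s≤s z≤n
    double : ∑ xs (λ p → ∑ xs λ i → e p i) ≤ Q + Q
    double = begin
      ∑ xs (λ p → ∑ xs λ i → e p i)
        ≤⟨ ∑-mono xs (λ {p} _ → ∑-mono xs λ {i} _ → cover (β p) (β i) (R p i) (R i p) (total p i)) ⟩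
      ∑ xs (λ p → ∑ xs λ i → e p i * ind (R p i) + e i p * ind (R i p))
        ≡⟨ trans (∑-cong xs λ p → ∑-+ xs _ _) (∑-+ xs _ _) ⟩
      Q + ∑ xs (λ p → ∑ xs λ i → e i p * ind (R i p))
        ≡⟨ cong (Q +_) (∑-swap xs xs (λ p i → e i p * ind (R i p))) ⟩
      Q + Q ∎
    drop : ∀ a b c u → ind a * ind b * ind c ≤ ind a * (ind (c ∧ not u) + ind u)
    drop false b     c     u     = z≤n
    drop true  false c     u     = z≤n
    drop true  true  false u     = z≤n
    drop true  true  true  true  = s≤s z≤n
    drop true  true  true  false = s≤s z≤n
    u : A → ℕ
    u p = ∑ xs λ i → ind (U p i)
    row : ∀ {p} → p ∈ xs → 17 * ∑ xs (λ i → e p i * ind (R p i)) ≤ N + 17 * u p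
    row {p} p∈ = ℕ.≤-trans (ℕ.*-monoʳ-≤ 17 (begin
      ∑ xs (λ i → e p i * ind (R p i))
        ≤⟨ ∑-mono xs (λ {i} _ → drop (β p) (β i) (R p i) (U p i)) ⟩
      ∑ xs (λ i → ind (β p) * (ind (R p i ∧ not (U p i)) + ind (U p i)))
        ≡⟨ ∑-*ˡ xs (ind (β p)) _ ⟩
      ind (β p) * ∑ xs (λ i → ind (R p i ∧ not (U p i)) + ind (U p i))
        ≡⟨ cong (ind (β p) *_) (∑-+ xs _ _) ⟩
      ind (β p) * (known R U p + u p) ∎)) (bound (β p) refl)
      where
      bound : ∀ b → β p ≡ b → 17 * (ind b * (known R U p + u p)) ≤ N + 17 * u p
      bound false _  = z≤n
      bound true  βp = begin
        17 * (1 * (known R U p + u p))    ≡⟨ lemma (known R U p) (u p) ⟩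
        17 * known R U p + 17 * u p       ≤⟨ ℕ.+-monoˡ-≤ (17 * u p) (short p∈ βp) ⟩
        N + 17 * u p                      ∎
        where
        lemma : ∀ k v → 17 * (1 * (k + v)) ≡ 17 * k + 17 * v
        lemma = solve-∀
    Q-small : 17 * Q ≤ N * N + N * N
    Q-small = begin
      17 * Q
        ≡⟨ ∑-*ˡ xs 17 _ ⟨
      ∑ xs (λ p → 17 * ∑ xs (λ i → e p i * ind (R p i)))
        ≤⟨ ∑-mono xs row ⟩
      ∑ xs (λ p → N + 17 * u p)
        ≡⟨ ∑-+ xs _ _ ⟩
      ∑ xs (λ _ → N) + ∑ xs (λ p → 17 * u p)
        ≡⟨ cong₂ _+_ (∑-const xs N) (∑-*ˡ xs 17 u) ⟩
      N * N + 17 * ∑ xs u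
        ≤⟨ ℕ.+-monoʳ-≤ (N * N) U-small ⟩
      N * N + N * N ∎

  -- If every p were short in one of the two directions, one of the two sets of short rows would
  -- have b ≥ N/2 elements. Then N² ≤ 4b², while `few-short-rows` gives 17b² ≤ 4N², so 17N² ≤ 16N²,
  -- which is absurd for N > 0. This is the origin of 17.
  median : 0 < N → (R : A → A → Bool) → (∀ i j → R i j ∨ R j i ≡ true) →
    (U : A → A → Bool) → 17 * ∑ xs (λ p → ∑ xs λ i → ind (U p i)) ≤ N * N →
    ∃[ p ] p ∈ xs × N ≤ 17 * known R U p × N ≤ 17 * known (λ i j → R j i) (λ i j → U j i) p
  median 0<N R total U U-small = result (search (λ p → long₁ p ∧ long₂ p) xs)
    where
    Rᵒ Uᵒ : A → A → Bool
    Rᵒ i j = R j i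
    Uᵒ i j = U j i
    long₁ long₂ : A → Bool
    long₁ p = N ≤ᵇ 17 * known R U p
    long₂ p = N ≤ᵇ 17 * known Rᵒ Uᵒ p
    b₁ b₂ : ℕ
    b₁ = count (not ∘ long₁) xs
    b₂ = count (not ∘ long₂) xs
    b₁-small : 17 * (b₁ * b₁) ≤ 4 * (N * N)
    b₁-small = few-short-rows R total U U-small (not ∘ long₁)
      λ _ → ℕ.<⇒≤ ∘ ≤ᵇ-false ∘ not-true
    b₂-small : 17 * (b₂ * b₂) ≤ 4 * (N * N)
    b₂-small = few-short-rows Rᵒ (λ i j → total j i) Uᵒ
      (subst (λ s → 17 * s ≤ N * N) (∑-swap xs xs (λ p i → ind (U p i))) U-small) (not ∘ long₂)
      λ _ → ℕ.<⇒≤ ∘ ≤ᵇ-false ∘ not-true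
    absurd : ∀ b → N ≤ b + b → 17 * (b * b) ≤ 4 * (N * N) → ⊥
    absurd b N≤2b b-small = ℕ.<⇒≱ (ℕ.*-monoˡ-< (N * N) {{>-nonZero (ℕ.*-mono-< 0<N 0<N)}} (ℕ.n<1+n 16)) (begin
      17 * (N * N)               ≤⟨ ℕ.*-monoʳ-≤ 17 (ℕ.*-mono-≤ N≤2b N≤2b) ⟩
      17 * ((b + b) * (b + b))   ≡⟨ eq₁ b ⟩
      4 * (17 * (b * b))         ≤⟨ ℕ.*-monoʳ-≤ 4 b-small ⟩
      4 * (4 * (N * N))          ≡⟨ ℕ.*-assoc 4 4 (N * N) ⟨
      16 * (N * N)               ∎)
      where
      open ℕ.≤-Reasoning
      eq₁ : ∀ b → 17 * ((b + b) * (b + b)) ≡ 4 * (17 * (b * b))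
      eq₁ = solve-∀
    result : (∃[ p ] p ∈ xs × long₁ p ∧ long₂ p ≡ true) ⊎ (∀ {p} → p ∈ xs → long₁ p ∧ long₂ p ≡ false) →
      ∃[ p ] p ∈ xs × N ≤ 17 * known R U p × N ≤ 17 * known Rᵒ Uᵒ p
    result (inj₁ (p , p∈ , long)) = p , p∈ , ≤ᵇ-true (proj₁ (∧-true long)) , ≤ᵇ-true (proj₂ (∧-true {long₁ p} long))
    result (inj₂ none) = ⊥-elim (case (ℕ.≤-total b₁ b₂))
      where
      one-short : ∀ a b → a ∧ b ≡ false → 1 ≤ ind (not a) + ind (not b)
      one-short false b     _ = s≤s z≤n
      one-short true  false _ = s≤s z≤n
      N≤b₁+b₂ : N ≤ b₁ + b₂
      N≤b₁+b₂ = begin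
        N                        ≡⟨ count-true xs ⟨
        count (λ _ → true) xs    ≤⟨ ∑-mono xs (λ {p} p∈ → one-short (long₁ p) (long₂ p) (none p∈)) ⟩
        ∑ xs (λ p → ind (not (long₁ p)) + ind (not (long₂ p)))  ≡⟨ ∑-+ xs _ _ ⟩
        b₁ + b₂                  ∎
        where open ℕ.≤-Reasoning
      case : b₁ ≤ b₂ ⊎ b₂ ≤ b₁ → ⊥
      case (inj₁ b₁≤b₂) = absurd b₂ (ℕ.≤-trans N≤b₁+b₂ (ℕ.+-monoˡ-≤ b₂ b₁≤b₂)) b₂-small
      case (inj₂ b₂≤b₁) = absurd b₁ (ℕ.≤-trans N≤b₁+b₂ (ℕ.+-monoʳ-≤ b₁ b₂≤b₁)) b₁-small

-- Signs, tests, and the fraction that passes them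

opaque
  -- Zero counts as not positive. Two values suffice: general position keeps the orientation
  -- determinants off zero, and order and colour are expressed by positivity.
  bit : ℚ → Bool
  bit q = does (0ℚ ℚ.<? q)

  bit-pos : ∀ {q} → 0ℚ ℚ.< q → bit q ≡ true
  bit-pos {q} = dec-true (0ℚ ℚ.<? q)

  bit-nonpos : ∀ {q} → q ℚ.≤ 0ℚ → bit q ≡ false
  bit-nonpos {q} q≤0 = dec-false (0ℚ ℚ.<? q) λ 0<q → ℚ.<-irrefl refl (ℚ.<-≤-trans 0<q q≤0)

bit-true : ∀ {q} → bit q ≡ true → 0ℚ ℚ.< q
bit-true {q} eq with 0ℚ ℚ.<? q
... | yes 0<q = 0<q
... | no  0≮q with trans (sym eq) (bit-nonpos (ℚ.≮⇒≥ 0≮q))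
... | ()

bit-false : ∀ {q} → bit q ≡ false → q ℚ.≤ 0ℚ
bit-false {q} eq with 0ℚ ℚ.<? q
... | no  0≮q = ℚ.≮⇒≥ 0≮q
... | yes 0<q with trans (sym eq) (bit-pos 0<q)
... | ()

agree : Bool → Bool → Bool
agree x true  = x
agree x false = not x

agree-≡ : ∀ x b → agree x b ≡ true → x ≡ b
agree-≡ x     true  eq = eq
agree-≡ false false _  = refl

≡-agree : ∀ x b → x ≡ b → agree x b ≡ true
≡-agree true  .true  refl = refl
≡-agree false .false refl = refl

holds : {C A : Set} → (C → A → Bool) → List C → A → Bool
holds ev []       a = true
holds ev (c ∷ cs) a = ev c a ∧ holds ev cs a

holds-++ : {C A : Set} (ev : C → A → Bool) (cs ds : List C) (a : A) →
  holds ev (cs ++ ds) a ≡ holds ev cs a ∧ holds ev ds a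
holds-++ ev []       ds a = refl
holds-++ ev (c ∷ cs) ds a with ev c a
... | true  = holds-++ ev cs ds a
... | false = refl

holds-++⁻ : {C A : Set} (ev : C → A → Bool) (cs ds : List C) {a : A} →
  holds ev (cs ++ ds) a ≡ true → holds ev cs a ≡ true × holds ev ds a ≡ true
holds-++⁻ ev cs ds {a} h = ∧-true (trans (sym (holds-++ ev cs ds a)) h)

-- A test whose more frequent answer is kept loses at most half of `W`, so t tests lose at most a
-- factor 2^t. The same t can therefore bound the number of tests and the loss.
Retains : {C A : Set} → (C → A → Bool) → List C → ℕ → List A → Set
Retains ev cs t W = length W ≤ 2 ^ t * count (holds ev cs) W

retains-[] : {C A : Set} (ev : C → A → Bool) (t : ℕ) (W : List A) → Retains ev [] t W
retains-[] ev t W = begin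
  length W                        ≡⟨ count-true W ⟨
  count (λ _ → true) W            ≤⟨ ℕ.m≤n*m _ (2 ^ t) {{ℕ.m^n≢0 2 t}} ⟩
  2 ^ t * count (λ _ → true) W    ∎
  where open ℕ.≤-Reasoning

retains-weaken : {C A : Set} (ev : C → A → Bool) (cs : List C) {s t : ℕ} (W : List A) →
  s ≤ t → Retains ev cs s W → Retains ev cs t W
retains-weaken ev cs W s≤t r = ℕ.≤-trans r (ℕ.*-monoˡ-≤ _ (ℕ.^-monoʳ-≤ 2 s≤t))

count-holds-++ : {C A : Set} (ev : C → A → Bool) (cs ds : List C) (W : List A) →
  count (holds ev (cs ++ ds)) W ≡ count (holds ev ds) (filterᵇ (holds ev cs) W)
count-holds-++ ev cs ds W = trans (∑-cong W λ a → cong ind (holds-++ ev cs ds a))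
  (sym (count-filterᵇ (holds ev ds) (holds ev cs) W))

retains-++ : {C A : Set} (ev : C → A → Bool) (cs ds : List C) {s t : ℕ} (W : List A) →
  Retains ev cs s W → Retains ev ds t (filterᵇ (holds ev cs) W) → Retains ev (cs ++ ds) (s + t) W
retains-++ ev cs ds {s} {t} W r r′ = begin
  length W                                      ≤⟨ r ⟩
  2 ^ s * count (holds ev cs) W                 ≡⟨ cong (2 ^ s *_) (length-filterᵇ (holds ev cs) W) ⟨
  2 ^ s * length W′                             ≤⟨ ℕ.*-monoʳ-≤ (2 ^ s) r′ ⟩
  2 ^ s * (2 ^ t * count (holds ev ds) W′)      ≡⟨ ℕ.*-assoc (2 ^ s) (2 ^ t) _ ⟨
  2 ^ s * 2 ^ t * count (holds ev ds) W′        ≡⟨ cong₂ _*_ (ℕ.^-distribˡ-+-* 2 s t) (count-holds-++ ev cs ds W) ⟨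
  2 ^ (s + t) * count (holds ev (cs ++ ds)) W   ∎
  where
  open ℕ.≤-Reasoning
  W′ = filterᵇ (holds ev cs) W

retains-nonempty : {C A : Set} (ev : C → A → Bool) (cs : List C) {t : ℕ} (W : List A) →
  0 < length W → Retains ev cs t W → 0 < count (holds ev cs) W
retains-nonempty ev cs {t} W 0<W r with count (holds ev cs) W
... | zero  = ⊥-elim (ℕ.<⇒≱ 0<W (ℕ.≤-trans r (ℕ.≤-reflexive (ℕ.*-zeroʳ (2 ^ t)))))
... | suc _ = s≤s z≤n

-- Cells and partitions determined by tests

dot : ∀ {D} → Vec ℚ D → Vec ℚ D → ℚ
dot []       []       = 0ℚ
dot (a ∷ as) (x ∷ xs) = a ℚ.* x ℚ.+ dot as xs

Test : ℕ → Set
Test D = Vec ℚ D × Bool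

passes : ∀ {D} → Test D → Vec ℚ D → Bool
passes (v , b) a = agree (bit (dot a v)) b

-- The functionals range over all vectors, not only over the list `W` from which the answers were
-- chosen. This matters at the end: the tuples z taken from the later parts pass the tests but need
-- not belong to the list that was filtered.
Determines : ∀ {D} → List (Test D) → Vec ℚ D → Set
Determines cs x = ∀ a a′ → holds passes cs a ≡ true → holds passes cs a′ ≡ true →
  bit (dot a x) ≡ bit (dot a′ x)

-- The constants come before the points and the functionals, hence are uniform in both. Points are
-- indexed by an arbitrary type so that vectors may repeat and pairs of points can serve as indices
-- for their differences.
CellLemma : ℕ → Set₁
CellLemma D = ∃[ t ] ∃[ C ] ({I : Set} (x : I → Vec ℚ D) (V : List I) (W : List (Vec ℚ D)) → 0 < length W →
  ∃[ cs ] ∃[ X ] length cs ≤ t × Retains passes cs t W × length V ≤ suc C * count X V ×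
    (∀ i → X i ≡ true → Determines cs (x i)))

Partition : (D E t : ℕ) → Set₁
Partition D E t = {I : Set} (x : I → Vec ℚ D) (V : List I) (W : List (Vec ℚ D)) → 0 < length W →
  ∃[ cs ] ∃[ U ] length cs ≤ t × Retains passes cs t W × E * count U V ≤ length V ×
    (∀ i → U i ≡ false → Determines cs (x i))

-- Cells are cut off greedily from the points not yet determined. Each new cell is sought among the
-- functionals that pass all earlier tests, so the accumulated answers stay consistent and their
-- losses multiply.
partition-from-cells : ∀ {D} → CellLemma D → ∀ E → ∃ (Partition D E)
partition-from-cells {D} (t , C , cell) E = E * suc C * t , λ x V W 0<W → finish x V W (iterate x V W 0<W (E * suc C))
  where
  -- The second alternative is a potential: j rounds have removed at least j |V| / (E (C + 1))
  -- points, with denominators cleared.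
  Stage : {I : Set} (x : I → Vec ℚ D) (V : List I) (W : List (Vec ℚ D)) → ℕ → Set
  Stage x V W j = ∃[ cs ] ∃[ U ] length cs ≤ j * t × Retains passes cs (j * t) W ×
    (E * count U V ≤ length V ⊎ count U V * (E * suc C) + j * length V ≤ length V * (E * suc C)) ×
    (∀ i → U i ≡ false → Determines cs (x i))

  -- As long as E |U| > |V|, each new cell has at least |V| / (E (C + 1)) points.
  iterate : {I : Set} (x : I → Vec ℚ D) (V : List I) (W : List (Vec ℚ D)) → 0 < length W → ∀ j → Stage x V W j
  iterate x V W 0<W zero = [] , (λ _ → true) , z≤n , retains-[] passes 0 W ,
    inj₂ (ℕ.≤-reflexive (trans (ℕ.+-identityʳ _) (cong (_* (E * suc C)) (count-true V)))) , λ _ ()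
  iterate {I} x V W 0<W (suc j) with iterate x V W 0<W j
  ... | cs , U , len , ret , inj₁ small , det =
    cs , U , ℕ.m≤n⇒m≤o+n t len , retains-weaken passes cs {j * t} W (ℕ.m≤n+m (j * t) t) ret , inj₁ small , det
  ... | cs , U , len , ret , inj₂ progress , det with ℕ.≤-<-connex (E * count U V) (length V)
  ... | inj₁ small = cs , U , ℕ.m≤n⇒m≤o+n t len , retains-weaken passes cs {j * t} W (ℕ.m≤n+m (j * t) t) ret , inj₁ small , det
  ... | inj₂ large with cell x (filterᵇ U V) (filterᵇ (holds passes cs) W)
                          (subst (0 <_) (sym (length-filterᵇ _ W)) (retains-nonempty passes cs {j * t} W 0<W ret))
  ... | ds , X , len′ , ret′ , big , det′ =
    cs ++ ds , U′ ,
    subst (_≤ t + j * t) (sym (List.length-++ cs)) (subst (length cs + length ds ≤_) (ℕ.+-comm (j * t) t) (ℕ.+-mono-≤ len len′)) ,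
    subst (λ s → Retains passes (cs ++ ds) s W) (ℕ.+-comm (j * t) t) (retains-++ passes cs ds {j * t} {t} W ret ret′) ,
    inj₂ progress′ , det″
    where
    U′ : I → Bool
    U′ i = U i ∧ not (X i)
    c : ℕ
    c = count (λ i → U i ∧ X i) V
    big′ : count U V ≤ suc C * c
    big′ = subst (_≤ suc C * c) (length-filterᵇ U V)
      (subst (λ s → length (filterᵇ U V) ≤ suc C * s) (count-filterᵇ X U V) big)
    regroup : ∀ u e c m n → u * (e * c) + (m + n) ≡ m + (u * (e * c) + n)
    regroup = solve-∀
    expand : ∀ e s c n u → e * (s * c) + (u * (e * s) + n) ≡ (c + u) * (e * s) + n
    expand = solve-∀
    open ℕ.≤-Reasoning
    progress′ : count U′ V * (E * suc C) + suc j * length V ≤ length V * (E * suc C)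
    progress′ = begin
      count U′ V * (E * suc C) + (length V + j * length V)
        ≡⟨ regroup (count U′ V) E (suc C) (length V) (j * length V) ⟩
      length V + (count U′ V * (E * suc C) + j * length V)
        ≤⟨ ℕ.+-monoˡ-≤ _ (ℕ.≤-trans (ℕ.<⇒≤ large) (ℕ.*-monoʳ-≤ E big′)) ⟩
      E * (suc C * c) + (count U′ V * (E * suc C) + j * length V)
        ≡⟨ expand E (suc C) c (j * length V) (count U′ V) ⟩
      (c + count U′ V) * (E * suc C) + j * length V
        ≡⟨ cong (λ s → s * (E * suc C) + j * length V) (count-split U X V) ⟨
      count U V * (E * suc C) + j * length V
        ≤⟨ progress ⟩
      length V * (E * suc C) ∎
    det″ : ∀ i → U′ i ≡ false → Determines (cs ++ ds) (x i)
    det″ i eq a a′ h h′ with U i in Ui | X i in Xi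
    ... | false | _    = det i Ui a a′ (proj₁ (holds-++⁻ passes cs ds h)) (proj₁ (holds-++⁻ passes cs ds h′))
    ... | true  | true = det′ i Xi a a′ (proj₂ (holds-++⁻ passes cs ds {a} h)) (proj₂ (holds-++⁻ passes cs ds {a′} h′))

  finish : {I : Set} (x : I → Vec ℚ D) (V : List I) (W : List (Vec ℚ D)) → Stage x V W (E * suc C) →
    ∃[ cs ] ∃[ U ] length cs ≤ E * suc C * t × Retains passes cs (E * suc C * t) W × E * count U V ≤ length V ×
      (∀ i → U i ≡ false → Determines cs (x i))
  finish x V W (cs , U , len , ret , inj₁ small , det) = cs , U , len , ret , small , det
  finish x V W (cs , U , len , ret , inj₂ done , det) = cs , U , len , ret , small , det
    where
    open ℕ.≤-Reasoning
    -- After E (C + 1) rounds the removed amount alone exhausts the right-hand side of the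
    -- potential.
    none : count U V * (E * suc C) ≤ 0
    none = ℕ.+-cancelʳ-≤ (E * suc C * length V) _ 0
      (ℕ.≤-trans done (ℕ.≤-reflexive (ℕ.*-comm (length V) (E * suc C))))
    small : E * count U V ≤ length V
    small = begin
      E * count U V             ≡⟨ ℕ.*-comm E _ ⟩
      count U V * E             ≤⟨ ℕ.*-monoʳ-≤ (count U V) (ℕ.m≤m*n E (suc C)) ⟩
      count U V * (E * suc C)   ≤⟨ none ⟩
      0                         ≤⟨ z≤n ⟩
      length V                  ∎

-- The cell lemma by induction on the dimension

lift : ∀ {D} → Test D → Test (suc D)
lift (v , b) = 0ℚ ∷ v , b

dot-0∷ : ∀ {D} a₀ (a v : Vec ℚ D) → dot (a₀ ∷ a) (0ℚ ∷ v) ≡ dot a v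
dot-0∷ a₀ a v = trans (cong (ℚ._+ dot a v) (ℚ.*-zeroʳ a₀)) (ℚ.+-identityˡ (dot a v))

holds-lift : ∀ {D} (cs : List (Test D)) (a : Vec ℚ (suc D)) → holds passes (map lift cs) a ≡ holds passes cs (tail a)
holds-lift []             (a₀ ∷ a) = refl
holds-lift ((v , b) ∷ cs) (a₀ ∷ a) =
  cong₂ (λ q s → agree (bit q) b ∧ s) (dot-0∷ a₀ a v) (holds-lift cs (a₀ ∷ a))

retains-lift : ∀ {D t} (cs : List (Test D)) (W : List (Vec ℚ (suc D))) →
  Retains passes cs t (map tail W) → Retains passes (map lift cs) t W
retains-lift {t = t} cs W r = begin
  length W                                          ≡⟨ List.length-map tail W ⟨
  length (map tail W)                               ≤⟨ r ⟩
  2 ^ t * count (holds passes cs) (map tail W)      ≡⟨ cong (2 ^ t *_) (trans (∑-map tail W _) (∑-cong W λ a → cong ind (sym (holds-lift cs a)))) ⟩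
  2 ^ t * count (holds passes (map lift cs)) W      ∎
  where open ℕ.≤-Reasoning

combine : ∀ {D} → ℚ → Vec ℚ D → ℚ → Vec ℚ D → Vec ℚ D
combine c []       d []       = []
combine c (u ∷ us) d (v ∷ vs) = c ℚ.* u ℚ.- d ℚ.* v ∷ combine c us d vs

dot-combine : ∀ {D} (a : Vec ℚ D) c u d v → dot a (combine c u d v) ≡ c ℚ.* dot a u ℚ.- d ℚ.* dot a v
dot-combine [] c [] d [] = solve 2 (λ c d → con 0ℚ := c :* con 0ℚ :- d :* con 0ℚ) refl c d
  where open +-*-Solver
dot-combine (a ∷ as) c (u ∷ us) d (v ∷ vs) = trans
  (cong (a ℚ.* (c ℚ.* u ℚ.- d ℚ.* v) ℚ.+_) (dot-combine as c us d vs))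
  (solve 7 (λ a c u d v x y → a :* (c :* u :- d :* v) :+ (c :* x :- d :* y) :=
      c :* (a :* u :+ x) :- d :* (a :* v :+ y)) refl a c u d v (dot as us) (dot as vs))
  where open +-*-Solver

*-pos : ∀ {p q} → 0ℚ ℚ.< p → 0ℚ ℚ.< q → 0ℚ ℚ.< p ℚ.* q
*-pos {p} {q} 0<p 0<q = subst (ℚ._< p ℚ.* q) (ℚ.*-zeroʳ p) (ℚ.*-monoʳ-<-pos p {{ℚ.positive 0<p}} 0<q)

*-nonpos : ∀ {p q} → 0ℚ ℚ.< p → q ℚ.≤ 0ℚ → p ℚ.* q ℚ.≤ 0ℚ
*-nonpos {p} {q} 0<p q≤0 = subst (p ℚ.* q ℚ.≤_) (ℚ.*-zeroʳ p)
  (ℚ.*-monoˡ-≤-nonNeg p {{ℚ.pos⇒nonNeg p {{ℚ.positive 0<p}}}} q≤0)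

-- Up to the factor w, the comparison of the values at p and x is the sign of a difference.
sign-up : ∀ {w v f g} → 0ℚ ℚ.< w → 0ℚ ℚ.< v → w ℚ.* f ℚ.- v ℚ.* g ℚ.≤ 0ℚ → 0ℚ ℚ.< f → 0ℚ ℚ.< g
sign-up {w} {v} {f} {g} 0<w 0<v diff 0<f with 0ℚ ℚ.<? g
... | yes 0<g = 0<g
... | no  0≮g = ⊥-elim (ℚ.<-irrefl refl (begin-strict
  0ℚ                             <⟨ *-pos 0<w 0<f ⟩
  w ℚ.* f                        ≡⟨ solve 2 (λ a b → a := (a :- b) :+ b) refl (w ℚ.* f) (v ℚ.* g) ⟩
  (w ℚ.* f ℚ.- v ℚ.* g) ℚ.+ v ℚ.* g ≤⟨ ℚ.+-mono-≤ diff (*-nonpos 0<v (ℚ.≮⇒≥ 0≮g)) ⟩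
  0ℚ                             ∎))
  where
  open ℚ.≤-Reasoning
  open +-*-Solver

sign-down : ∀ {w v f g} → 0ℚ ℚ.< w → 0ℚ ℚ.< v → w ℚ.* g ℚ.- v ℚ.* f ℚ.≤ 0ℚ → f ℚ.≤ 0ℚ → g ℚ.≤ 0ℚ
sign-down 0<w 0<v diff f≤0 = ℚ.≮⇒≥ λ 0<g → ℚ.<-irrefl refl (ℚ.<-≤-trans (sign-up 0<w 0<v diff 0<g) f≤0)

Determines-bit : ∀ {D} (cs : List (Test D)) (x : Vec ℚ D) (b : Bool) →
  (∀ a → holds passes cs a ≡ true → bit (dot a x) ≡ b) → Determines cs x
Determines-bit cs x b const a a′ h h′ = trans (const a h) (sym (const a′ h′))

branch : {A : Set} (p : A → Bool) (W : List A) →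
  ∃[ b ] length W ≤ 2 * count (λ a → agree (p a) b) W
branch p W with ℕ.≤-total (count p W) (count (not ∘ p) W)
... | inj₁ p≤ = false , (begin
  length W                              ≡⟨ count-true W ⟨
  count (λ _ → true) W                  ≡⟨ count-split (λ _ → true) p W ⟩
  count p W + count (not ∘ p) W         ≤⟨ ℕ.+-mono-≤ p≤ (ℕ.m≤m+n _ 0) ⟩
  2 * count (not ∘ p) W                 ∎)
  where open ℕ.≤-Reasoning
... | inj₂ p≥ = true , (begin
  length W                              ≡⟨ count-true W ⟨
  count (λ _ → true) W                  ≡⟨ count-split (λ _ → true) p W ⟩
  count p W + count (not ∘ p) W         ≤⟨ ℕ.+-monoʳ-≤ (count p W) (ℕ.≤-trans p≥ (ℕ.m≤m+n _ 0)) ⟩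
  2 * count p W                         ∎)
  where open ℕ.≤-Reasoning

module _ {D t : ℕ} (part : Partition D 17 t) where

  -- All points of κ lie on one side of x₀ = 0, so after scaling by w their first
  -- coordinates agree and the differences live in dimension D.
  one-sided : {I : Set} (h : I → ℚ) (y : I → Vec ℚ D) (V : List I) (W : List (Vec ℚ (suc D))) → 0 < length W →
    (κ : I → Bool) (w : I → ℚ) → (∀ i → κ i ≡ true → 0ℚ ℚ.< w i) →
    (∀ i j → κ i ≡ true → κ j ≡ true → w j ℚ.* h i ≡ w i ℚ.* h j) → 0 < count κ V →
    ∃[ cs ] ∃[ X ] length cs ≤ t + 1 × Retains passes cs (t + 1) W × count κ V ≤ 17 * count X V ×
      (∀ i → X i ≡ true → Determines cs (h i ∷ y i))
  one-sided {I} h y V W 0<W κ w w-pos w-scale 0<κ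
    with part (λ (i , j) → combine (w j) (y i) (w i) (y j)) (cartesianProduct (filterᵇ κ V) (filterᵇ κ V)) (map tail W)
           (subst (0 <_) (sym (List.length-map tail W)) 0<W)
  ... | cs′ , U , len , ret , U-small , det
    with count-witness (holds passes (map lift cs′)) W (retains-nonempty passes (map lift cs′) {t} W 0<W (retains-lift {t = t} cs′ W ret))
  ... | a₀ , _ , a₀-holds = build (median V₁ (subst (0 <_) (sym (length-filterᵇ κ V)) 0<κ) R R-total (λ i j → U (i , j))
      (subst (17 * ∑ V₁ (λ i → ∑ V₁ λ j → ind (U (i , j))) ≤_) (length-cartesian V₁ V₁)
        (subst (λ s → 17 * s ≤ length (cartesianProduct V₁ V₁)) (∑-cartesian V₁ V₁ (ind ∘ U)) U-small)))
    where
    V₁ : List I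
    V₁ = filterᵇ κ V
    cs : List (Test (suc D))
    cs = map lift cs′
    gap : Vec ℚ (suc D) → I → I → ℚ
    gap a i j = dot (tail a) (combine (w j) (y i) (w i) (y j))
    value : Vec ℚ (suc D) → I → ℚ
    value a i = dot a (h i ∷ y i)
    -- By `w-scale` the two scaled points have the same first coordinate, so the difference of their
    -- last D coordinates already gives the difference of the full values. This is where the
    -- dimension drops.
    gap-value : ∀ a i j → κ i ≡ true → κ j ≡ true → gap a i j ≡ w j ℚ.* value a i ℚ.- w i ℚ.* value a j
    gap-value (a ∷ as) i j κi κj = begin
      dot as (combine (w j) (y i) (w i) (y j))
        ≡⟨ dot-combine as (w j) (y i) (w i) (y j) ⟩
      w j ℚ.* dot as (y i) ℚ.- w i ℚ.* dot as (y j)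
        ≡⟨ solve 5 (λ a s p q r → p :- q := (a :* s :+ p) :- (a :* s :+ q)) refl a (w j ℚ.* h i) (w j ℚ.* dot as (y i)) (w i ℚ.* dot as (y j)) 0ℚ ⟩
      (a ℚ.* (w j ℚ.* h i) ℚ.+ w j ℚ.* dot as (y i)) ℚ.- (a ℚ.* (w j ℚ.* h i) ℚ.+ w i ℚ.* dot as (y j))
        ≡⟨ cong (λ s → (a ℚ.* (w j ℚ.* h i) ℚ.+ w j ℚ.* dot as (y i)) ℚ.- (a ℚ.* s ℚ.+ w i ℚ.* dot as (y j))) (w-scale i j κi κj) ⟩
      (a ℚ.* (w j ℚ.* h i) ℚ.+ w j ℚ.* dot as (y i)) ℚ.- (a ℚ.* (w i ℚ.* h j) ℚ.+ w i ℚ.* dot as (y j))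
        ≡⟨ solve 7 (λ a wj hi wi hj p q → (a :* (wj :* hi) :+ wj :* p) :- (a :* (wi :* hj) :+ wi :* q) := wj :* (a :* hi :+ p) :- wi :* (a :* hj :+ q))
             refl a (w j) (h i) (w i) (h j) (dot as (y i)) (dot as (y j)) ⟩
      w j ℚ.* (a ℚ.* h i ℚ.+ dot as (y i)) ℚ.- w i ℚ.* (a ℚ.* h j ℚ.+ dot as (y j)) ∎
      where
      open ≡-Reasoning
      open +-*-Solver
    gap-flip : ∀ a i j → gap a j i ≡ ℚ.- gap a i j
    gap-flip a i j = trans (dot-combine (tail a) (w i) (y j) (w j) (y i))
      (trans (solve 2 (λ p q → p :- q := :- (q :- p)) refl (w i ℚ.* dot (tail a) (y j)) (w j ℚ.* dot (tail a) (y i)))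
        (cong ℚ.-_ (sym (dot-combine (tail a) (w j) (y i) (w i) (y j)))))
      where open +-*-Solver
    -- The order is read off from one functional a₀ that passes the tests; outside `U` every other
    -- passing functional agrees with it. The negated sign makes ties count in both directions, so
    -- `R` is total.
    R : I → I → Bool
    R i j = not (bit (gap a₀ i j))
    R-total : ∀ i j → R i j ∨ R j i ≡ true
    R-total i j with bit (gap a₀ i j) in eq | bit (gap a₀ j i) in eq′
    ... | false | _     = refl
    ... | true  | false = refl
    ... | true  | true  = ⊥-elim (ℚ.<-irrefl (sym (ℚ.+-inverseʳ (gap a₀ i j)))
      (ℚ.+-mono-< (bit-true eq) (subst (0ℚ ℚ.<_) (gap-flip a₀ i j) (bit-true eq′))))

    gap-nonpos : ∀ {i j a} → holds passes cs a ≡ true → R i j ∧ not (U (i , j)) ≡ true → gap a i j ℚ.≤ 0ℚ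
    gap-nonpos {i} {j} {a} a-holds r = bit-false (trans
      (det (i , j) (not-true (proj₂ (∧-true {R i j} r))) (tail a) (tail a₀)
        (trans (sym (holds-lift cs′ a)) a-holds) (trans (sym (holds-lift cs′ a₀)) a₀-holds))
      (not-true (proj₁ (∧-true r))))

    build : ∃[ p ] p ∈ V₁ × length V₁ ≤ 17 * known V₁ R (λ i j → U (i , j)) p ×
        length V₁ ≤ 17 * known V₁ (λ i j → R j i) (λ i j → U (j , i)) p →
      ∃[ cs ] ∃[ X ] length cs ≤ t + 1 × Retains passes cs (t + 1) W × count κ V ≤ 17 * count X V ×
        (∀ i → X i ≡ true → Determines cs (h i ∷ y i))
    build (p , p∈ , above , below) = pick (branch (λ a → bit (value a p)) (filterᵇ (holds passes cs) W))
      where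
      κp : κ p ≡ true
      κp = proj₂ (∈-filterᵇ⁻ κ V p∈)
      test : Bool → List (Test (suc D))
      test b = (h p ∷ y p , b) ∷ []
      len′ : ∀ b → length (cs ++ test b) ≤ t + 1
      len′ b = subst (_≤ t + 1) (sym (trans (List.length-++ cs) (cong (_+ 1) (List.length-map lift cs′)))) (ℕ.+-monoˡ-≤ 1 len)
      ret′ : ∀ b → length (filterᵇ (holds passes cs) W) ≤ 2 * count (λ a → agree (bit (value a p)) b) (filterᵇ (holds passes cs) W) →
        Retains passes (cs ++ test b) (t + 1) W
      ret′ b half = retains-++ passes cs (test b) {t} {1} W (retains-lift {t = t} cs′ W ret)
        (ℕ.≤-trans half (ℕ.≤-reflexive (cong (2 *_) (∑-cong (filterᵇ (holds passes cs) W) λ a → cong ind (sym (∧-identity (agree (bit (value a p)) b)))))))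
        where
        ∧-identity : ∀ c → c ∧ true ≡ c
        ∧-identity true  = refl
        ∧-identity false = refl
      big : ∀ (q : I → Bool) → length V₁ ≤ 17 * count q V₁ → count κ V ≤ 17 * count (λ i → κ i ∧ q i) V
      big q b = subst (_≤ 17 * count (λ i → κ i ∧ q i) V) (length-filterᵇ κ V)
        (subst (λ s → length V₁ ≤ 17 * s) (count-filterᵇ q κ V) b)
      p-bit : ∀ b {a} → holds passes (cs ++ test b) a ≡ true → bit (value a p) ≡ b
      p-bit b {a} a-holds = agree-≡ _ b (proj₁ (∧-true (proj₂ (holds-++⁻ passes cs (test b) {a} a-holds))))
      pick : ∃[ b ] length (filterᵇ (holds passes cs) W) ≤ 2 * count (λ a → agree (bit (value a p)) b) (filterᵇ (holds passes cs) W) → _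
      pick (true , half) = cs ++ test true , (λ i → κ i ∧ (R p i ∧ not (U (p , i)))) , len′ true , ret′ true half , big _ above ,
        λ i Xi → Determines-bit (cs ++ test true) _ true λ a a-holds → bit-pos (sign-up (w-pos i (proj₁ (∧-true Xi))) (w-pos p κp)
          (subst (ℚ._≤ 0ℚ) (gap-value a p i κp (proj₁ (∧-true Xi)))
            (gap-nonpos {p} {i} {a} (proj₁ (holds-++⁻ passes cs (test true) a-holds)) (proj₂ (∧-true {κ i} Xi))))
          (bit-true (p-bit true a-holds)))
      pick (false , half) = cs ++ test false , (λ i → κ i ∧ (R i p ∧ not (U (i , p)))) , len′ false , ret′ false half , big _ below ,
        λ i Xi → Determines-bit (cs ++ test false) _ false λ a a-holds → bit-nonpos (sign-down (w-pos p κp) (w-pos i (proj₁ (∧-true Xi)))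
          (subst (ℚ._≤ 0ℚ) (gap-value a i p (proj₁ (∧-true Xi)) κp)
            (gap-nonpos {i} {p} {a} (proj₁ (holds-++⁻ passes cs (test false) a-holds)) (proj₂ (∧-true {κ i} Xi))))
          (bit-false (p-bit false a-holds)))

private
  ∧-elimʳ : ∀ a {b} → a ∧ b ≡ true → b ≡ true
  ∧-elimʳ a h = proj₂ (∧-true {a} h)

  three-max : ∀ a b c → (a + b) + c ≤ 3 * (a ℕ.⊔ (b ℕ.⊔ c))
  three-max a b c = subst ((a + b) + c ≤_) (triple m)
    (ℕ.+-mono-≤ (ℕ.+-mono-≤ (ℕ.m≤m⊔n a _) (ℕ.≤-trans (ℕ.m≤m⊔n b c) (ℕ.m≤n⊔m a _))) (ℕ.≤-trans (ℕ.m≤n⊔m b c) (ℕ.m≤n⊔m a _)))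
    where
    m : ℕ
    m = a ℕ.⊔ (b ℕ.⊔ c)
    triple : ∀ m → (m + m) + m ≡ 3 * m
    triple = solve-∀

cells : ∀ D → CellLemma D
cells zero = 0 , 0 , λ x V W 0<W → [] , (λ _ → true) , z≤n , retains-[] passes 0 W ,
  ℕ.≤-reflexive (sym (trans (ℕ.*-identityˡ _) (count-true V))) , λ i _ → λ { [] [] _ _ → refl }
cells (suc D) with cells D
... | ih@(t₀ , C₀ , cell) with partition-from-cells ih 17
-- A side keeps at least 1/3 · 1/17 = 1/51 of the points and uses t₁ tests on pairs plus the test of
-- the median; the class x₀ = 0 keeps 1/(3 (C₀ + 1)) and uses t₀ tests. The sums cover both
-- outcomes.
... | t₁ , part = t₀ + (t₁ + 1) , 3 * suc C₀ + 50 , choose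
  where
  choose : {I : Set} (x : I → Vec ℚ (suc D)) (V : List I) (W : List (Vec ℚ (suc D))) → 0 < length W →
    ∃[ cs ] ∃[ X ] length cs ≤ t₀ + (t₁ + 1) × Retains passes cs (t₀ + (t₁ + 1)) W ×
      length V ≤ suc (3 * suc C₀ + 50) * count X V × (∀ i → X i ≡ true → Determines cs (x i))
  choose {I} x V W 0<W = result
    where
    h : I → ℚ
    h = head ∘ x
    y : I → Vec ℚ D
    y = tail ∘ x
    h∷y : ∀ i → h i ∷ y i ≡ x i
    h∷y i with x i
    ... | _ ∷ _ = refl
    positive negative null : I → Bool
    positive i = bit (h i)
    negative i = bit (ℚ.- h i)
    null i = not (positive i) ∧ not (negative i)

    null-zero : ∀ i → null i ≡ true → h i ≡ 0ℚ
    null-zero i n = ℚ.≤-antisym (bit-false (not-true (proj₁ (∧-true n))))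
      (ℚ.≮⇒≥ λ h<0 → ℚ.<-irrefl refl
        (ℚ.<-≤-trans (ℚ.neg-antimono-< h<0) (bit-false (not-true (∧-elimʳ (not (positive i)) n)))))

    partition : length V ≤ (count positive V + count negative V) + count null V
    partition = begin
      length V                          ≡⟨ count-true V ⟨
      count (λ _ → true) V              ≤⟨ ∑-mono V (λ {i} _ → three (positive i) (negative i)) ⟩
      ∑ V (λ i → (ind (positive i) + ind (negative i)) + ind (null i))  ≡⟨ trans (∑-+ V _ _) (cong (_+ count null V) (∑-+ V _ _)) ⟩
      (count positive V + count negative V) + count null V ∎
      where
      open ℕ.≤-Reasoning
      three : ∀ a b → 1 ≤ (ind a + ind b) + ind (not a ∧ not b)
      three true  b     = s≤s z≤n
      three false true  = s≤s z≤n
      three false false = s≤s z≤n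

    third : ∀ a b c → length V ≤ (a + b) + c → length V ≤ 3 * a ⊎ length V ≤ 3 * b ⊎ length V ≤ 3 * c
    third a b c V≤ with ℕ.⊔-sel a (b ℕ.⊔ c) | ℕ.⊔-sel b c
    ... | inj₁ max | _         = inj₁ (subst (λ m → length V ≤ 3 * m) max (ℕ.≤-trans V≤ (three-max a b c)))
    ... | inj₂ max | inj₁ max′ = inj₂ (inj₁ (subst (λ m → length V ≤ 3 * m) (trans max max′) (ℕ.≤-trans V≤ (three-max a b c))))
    ... | inj₂ max | inj₂ max′ = inj₂ (inj₂ (subst (λ m → length V ≤ 3 * m) (trans max max′) (ℕ.≤-trans V≤ (three-max a b c))))

    Result : Set
    Result = ∃[ cs ] ∃[ X ] length cs ≤ t₀ + (t₁ + 1) × Retains passes cs (t₀ + (t₁ + 1)) W ×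
      length V ≤ suc (3 * suc C₀ + 50) * count X V × (∀ i → X i ≡ true → Determines cs (x i))

    from-side : (κ : I → Bool) → length V ≤ 3 * count κ V →
      (∃[ cs ] ∃[ X ] length cs ≤ t₁ + 1 × Retains passes cs (t₁ + 1) W × count κ V ≤ 17 * count X V ×
        (∀ i → X i ≡ true → Determines cs (h i ∷ y i))) → Result
    from-side κ V≤ (cs , X , len , ret , big , det) = cs , X , ℕ.m≤n⇒m≤o+n t₀ len ,
      retains-weaken passes cs {t₁ + 1} W (ℕ.m≤n+m (t₁ + 1) t₀) ret ,
      (begin
        length V                                ≤⟨ V≤ ⟩
        3 * count κ V                           ≤⟨ ℕ.*-monoʳ-≤ 3 big ⟩
        3 * (17 * count X V)                    ≡⟨ ℕ.*-assoc 3 17 (count X V) ⟨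
        51 * count X V                          ≤⟨ ℕ.*-monoˡ-≤ (count X V) (ℕ.+-monoʳ-≤ 1 (ℕ.m≤n+m 50 (3 * suc C₀))) ⟩
        suc (3 * suc C₀ + 50) * count X V       ∎) ,
      λ i Xi → subst (Determines cs) (h∷y i) (det i Xi)
      where open ℕ.≤-Reasoning

    positive-part : ∀ {m c} → 0 < m → m ≤ 3 * c → 0 < c
    positive-part {c = zero}  0<m m≤ = ⊥-elim (ℕ.<⇒≱ 0<m m≤)
    positive-part {c = suc _} 0<m m≤ = s≤s z≤n

    from-null : length V ≤ 3 * count null V → Result
    from-null V≤ with cell y (filterᵇ null V) (map tail W) (subst (0 <_) (sym (List.length-map tail W)) 0<W)
    ... | cs , X , len , ret , big , det = map lift cs , (λ i → null i ∧ X i) ,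
      ℕ.≤-trans (ℕ.≤-reflexive (List.length-map lift cs)) (ℕ.m≤n⇒m≤n+o (t₁ + 1) len) ,
      retains-weaken passes (map lift cs) {t₀} W (ℕ.m≤m+n t₀ (t₁ + 1)) (retains-lift {t = t₀} cs W ret) ,
      (begin
        length V                                ≤⟨ V≤ ⟩
        3 * count null V                        ≡⟨ cong (3 *_) (length-filterᵇ null V) ⟨
        3 * length (filterᵇ null V)             ≤⟨ ℕ.*-monoʳ-≤ 3 big ⟩
        3 * (suc C₀ * count X (filterᵇ null V)) ≡⟨ cong (λ c → 3 * (suc C₀ * c)) (count-filterᵇ X null V) ⟩
        3 * (suc C₀ * c)                        ≡⟨ ℕ.*-assoc 3 (suc C₀) c ⟨
        3 * suc C₀ * c                          ≤⟨ ℕ.*-monoˡ-≤ c (ℕ.≤-trans (ℕ.m≤m+n (3 * suc C₀) 50) (ℕ.n≤1+n _)) ⟩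
        suc (3 * suc C₀ + 50) * c               ∎) ,
      λ i Xi → subst (Determines (map lift cs)) (h∷y i) (det′ i (proj₁ (∧-true Xi)) (∧-elimʳ (null i) Xi))
      where
      open ℕ.≤-Reasoning
      c : ℕ
      c = count (λ i → null i ∧ X i) V
      dot-null : ∀ i → null i ≡ true → ∀ (a : Vec ℚ (suc D)) → dot a (h i ∷ y i) ≡ dot (tail a) (y i)
      dot-null i n (a₀ ∷ a) = trans (cong (λ q → dot (a₀ ∷ a) (q ∷ y i)) (null-zero i n)) (dot-0∷ a₀ a (y i))
      det′ : ∀ i → null i ≡ true → X i ≡ true → Determines (map lift cs) (h i ∷ y i)
      det′ i n Xi a a′ a-holds a′-holds = trans (cong bit (dot-null i n a)) (trans
        (det i Xi (tail a) (tail a′) (trans (sym (holds-lift cs a)) a-holds) (trans (sym (holds-lift cs a′)) a′-holds))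
        (cong bit (sym (dot-null i n a′))))

    nonempty : 0 < length V → Result
    nonempty 0<V with third (count positive V) (count negative V) (count null V) partition
    ... | inj₁ V≤ = from-side positive V≤
      (one-sided part h y V W 0<W positive h (λ i → bit-true) (λ i j _ _ → ℚ.*-comm (h j) (h i)) (positive-part 0<V V≤))
    ... | inj₂ (inj₁ V≤) = from-side negative V≤
      (one-sided part h y V W 0<W negative (ℚ.-_ ∘ h) (λ i → bit-true) (λ i j _ _ → neg-swap (h j) (h i)) (positive-part 0<V V≤))
      where
      neg-swap : ∀ p q → (ℚ.- p) ℚ.* q ≡ (ℚ.- q) ℚ.* p
      neg-swap = solve 2 (λ p q → (:- p) :* q := (:- q) :* p) refl
        where open +-*-Solver
    ... | inj₂ (inj₂ V≤) = from-null V≤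

    result : Result
    result with ℕ.≤-<-connex (length V) 0
    ... | inj₁ empty = [] , (λ _ → false) , z≤n , retains-[] passes (t₀ + (t₁ + 1)) W , ℕ.≤-trans empty z≤n , λ _ ()
    ... | inj₂ 0<V   = nonempty 0<V

-- Multilinear conditions and the elimination of a vertex

-- Multilinearity in curried form: a linear functional of the encoding of the first vertex, whose
-- coefficients are multilinear in the rest. This is the shape in which vertices are eliminated one
-- by one.
Multilinear : ∀ {n D} → (Fin n → Vec ℚ D) → ∀ m → (Vec (Fin n) m → ℚ) → Set
Multilinear {n} {D} φ zero    f = ⊤
Multilinear {n} {D} φ (suc m) f = Σ (Fin D → Vec (Fin n) m → ℚ) λ g →
  (∀ j → Multilinear φ m (g j)) × (∀ y z → f (y ∷ z) ≡ dot (tabulate λ j → g j z) (φ y))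

module _ {n D : ℕ} (φ : Fin n → Vec ℚ D) where
  private
    dot-+ : ∀ {D} (g h : Fin D → ℚ) v → dot (tabulate g) v ℚ.+ dot (tabulate h) v ≡ dot (tabulate λ j → g j ℚ.+ h j) v
    dot-+ g h []      = refl
    dot-+ g h (x ∷ v) = trans
      (solve 5 (λ a b x p q → (a :* x :+ p) :+ (b :* x :+ q) := (a :+ b) :* x :+ (p :+ q)) refl (g zero) (h zero) x (dot (tabulate (g ∘ suc)) v) (dot (tabulate (h ∘ suc)) v))
      (cong ((g zero ℚ.+ h zero) ℚ.* x ℚ.+_) (dot-+ (g ∘ suc) (h ∘ suc) v))
      where open +-*-Solver

    dot-scale : ∀ {D} c (g : Fin D → ℚ) v → c ℚ.* dot (tabulate g) v ≡ dot (tabulate λ j → c ℚ.* g j) v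
    dot-scale c g []      = ℚ.*-zeroʳ c
    dot-scale c g (x ∷ v) = trans
      (solve 4 (λ c a x p → c :* (a :* x :+ p) := (c :* a) :* x :+ c :* p) refl c (g zero) x (dot (tabulate (g ∘ suc)) v))
      (cong ((c ℚ.* g zero) ℚ.* x ℚ.+_) (dot-scale c (g ∘ suc) v))
      where open +-*-Solver

    dot-zero : ∀ {D} (v : Vec ℚ D) → 0ℚ ≡ dot (tabulate λ _ → 0ℚ) v
    dot-zero []      = refl
    dot-zero (x ∷ v) = trans (dot-zero v) (sym (trans (cong (ℚ._+ _) (ℚ.*-zeroˡ x)) (ℚ.+-identityˡ _)))

    single : ∀ {D} → Fin D → ℚ → Fin D → ℚ
    single zero    c zero    = c
    single zero    c (suc j) = 0ℚ
    single (suc i) c zero    = 0ℚ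
    single (suc i) c (suc j) = single i c j

    dot-single : ∀ {D} (i : Fin D) c v → c ℚ.* lookup v i ≡ dot (tabulate (single i c)) v
    dot-single zero    c (x ∷ v) = sym (trans (cong (c ℚ.* x ℚ.+_) (sym (dot-zero v))) (ℚ.+-identityʳ _))
    dot-single (suc i) c (x ∷ v) = trans (dot-single i c v) (sym (trans (cong (ℚ._+ _) (ℚ.*-zeroˡ x)) (ℚ.+-identityˡ _)))

  ml-ext : ∀ {m f f′} → f ≗ f′ → Multilinear φ m f → Multilinear φ m f′
  ml-ext {zero}  f≗ _              = tt
  ml-ext {suc m} f≗ (g , ml , eq) = g , ml , λ y z → trans (sym (f≗ (y ∷ z))) (eq y z)

  ml-+ : ∀ {m f f′} → Multilinear φ m f → Multilinear φ m f′ → Multilinear φ m (λ y → f y ℚ.+ f′ y)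
  ml-+ {zero}  _ _ = tt
  ml-+ {suc m} (g , ml , eq) (g′ , ml′ , eq′) = (λ j z → g j z ℚ.+ g′ j z) , (λ j → ml-+ (ml j) (ml′ j)) ,
    λ y z → trans (cong₂ ℚ._+_ (eq y z) (eq′ y z)) (dot-+ (λ j → g j z) (λ j → g′ j z) (φ y))

  ml-scale : ∀ {m f} c → Multilinear φ m f → Multilinear φ m (λ y → c ℚ.* f y)
  ml-scale {zero}  c _ = tt
  ml-scale {suc m} c (g , ml , eq) = (λ j z → c ℚ.* g j z) , (λ j → ml-scale c (ml j)) ,
    λ y z → trans (cong (c ℚ.*_) (eq y z)) (dot-scale c (λ j → g j z) (φ y))

  ml-zero : ∀ m → Multilinear φ m (λ _ → 0ℚ)
  ml-zero zero    = tt
  ml-zero (suc m) = (λ _ _ → 0ℚ) , (λ _ → ml-zero m) , λ y z → dot-zero (φ y)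

  -- A fixed test vector v takes the place of the encoded first vertex. This keeps the class of
  -- conditions closed under elimination.
  ml-dot : ∀ {m D′} (g : Fin D′ → Vec (Fin n) m → ℚ) → (∀ j → Multilinear φ m (g j)) → ∀ v →
    Multilinear φ m (λ z → dot (tabulate λ j → g j z) v)
  ml-dot {m} g ml []      = ml-zero m
  ml-dot {m} g ml (x ∷ v) = ml-+ {m} (ml-ext {m} (λ z → ℚ.*-comm x (g zero z)) (ml-scale {m} x (ml zero)))
    (ml-dot {m} (g ∘ suc) (ml ∘ suc) v)

  ml-∷ : ∀ {m f h} (i : Fin D) → Multilinear φ m h → (∀ y z → f (y ∷ z) ≡ h z ℚ.* lookup (φ y) i) →
    Multilinear φ (suc m) f
  ml-∷ {m} {f} {h} i ml eq = (λ j z → single i (h z) j) , (λ j → coordinate i j) ,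
    λ y z → trans (eq y z) (dot-single i (h z) (φ y))
    where
    coordinate : ∀ {D} (i j : Fin D) → Multilinear φ m (λ z → single i (h z) j)
    coordinate zero    zero    = ml
    coordinate zero    (suc j) = ml-zero m
    coordinate (suc i) zero    = ml-zero m
    coordinate (suc i) (suc j) = coordinate i j

record Condition {n D : ℕ} (φ : Fin n → Vec ℚ D) (m : ℕ) : Set where
  constructor condition
  field
    form        : Vec (Fin n) m → ℚ
    multilinear : Multilinear φ m form
    value       : Bool

open Condition

meets : ∀ {n D m} {φ : Fin n → Vec ℚ D} → Condition φ m → Vec (Fin n) m → Bool
meets c y = agree (bit (form c y)) (value c)

tuples : ∀ n m → List (Vec (Fin n) m)
tuples n zero    = [] ∷ []
tuples n (suc m) = map (λ (y , z) → y ∷ z) (cartesianProduct (allFin n) (tuples n m))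

length-allFin : ∀ n → length (allFin n) ≡ n
length-allFin n = List.length-tabulate id

length-tuples : ∀ n m → length (tuples n m) ≡ n ^ m
length-tuples n zero    = refl
length-tuples n (suc m) = trans (List.length-map _ (cartesianProduct (allFin n) (tuples n m)))
  (trans (length-cartesian (allFin n) (tuples n m)) (cong₂ _*_ (length-allFin n) (length-tuples n m)))

count-tuples : ∀ n m (p : Vec (Fin n) (suc m) → Bool) →
  count p (tuples n (suc m)) ≡ ∑ (tuples n m) λ z → count (λ y → p (y ∷ z)) (allFin n)
count-tuples n m p = trans (∑-map _ (cartesianProduct (allFin n) (tuples n m)) (ind ∘ p))
  (trans (∑-cartesian (allFin n) (tuples n m) _) (∑-swap (allFin n) (tuples n m) _))

module _ {n D m : ℕ} (φ : Fin n → Vec ℚ D) where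

  coefficients : Condition φ (suc m) → Vec (Fin n) m → Vec ℚ D
  coefficients (condition f (g , _ , _) b) z = tabulate λ j → g j z

  form-∷ : ∀ (c : Condition φ (suc m)) y z → form c (y ∷ z) ≡ dot (coefficients c z) (φ y)
  form-∷ (condition f (g , _ , eq) b) = eq

  -- The answer that the functional belonging to z gives at v, read as a condition on z.
  pull : Condition φ (suc m) → Test D → Condition φ m
  pull c@(condition f (g , ml , _) _) (v , b) = condition (λ z → dot (coefficients c z) v) (ml-dot φ {m} g ml v) b

  holds-pull : ∀ c (es : List (Test D)) z → holds meets (map (pull c) es) z ≡ holds passes es (coefficients c z)
  holds-pull c []       z = refl
  holds-pull c (e ∷ es) z = cong (passes e (coefficients c z) ∧_) (holds-pull c es z)

  module _ {E t : ℕ} (part : Partition D E t) where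

    -- The conditions are handled one at a time. Each gives its own family of functionals, adds at
    -- most t tests, and spoils at most n/E vertices; the tests and the exceptional sets add up.
    eliminate-first : (cs : List (Condition φ (suc m))) (W : List (Vec (Fin n) m)) → 0 < length W →
      ∃[ ds ] ∃[ U ] length ds ≤ length cs * t × Retains meets ds (length cs * t) W ×
        E * count U (allFin n) ≤ length cs * n ×
        (∀ y z z′ → U y ≡ false → holds (meets {φ = φ}) ds z ≡ true → holds meets ds z′ ≡ true →
          holds meets cs (y ∷ z) ≡ holds meets cs (y ∷ z′))
    eliminate-first [] W 0<W = [] , (λ _ → false) , z≤n , retains-[] (meets {φ = φ}) 0 W ,
      ℕ.≤-reflexive (trans (cong (E *_) (trans (∑-const (allFin n) 0) (ℕ.*-zeroʳ (length (allFin n))))) (ℕ.*-zeroʳ E)) , λ _ _ _ _ _ _ → refl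
    eliminate-first (c ∷ cs) W 0<W with eliminate-first cs W 0<W
    ... | ds , U , len , ret , U-small , det
      -- The functionals are listed with multiplicity, one for each surviving z, so the retained
      -- fraction of functionals is a retained fraction of tuples.
      with part φ (allFin n) (map (coefficients c) (filterᵇ (holds meets ds) W))
        (subst (0 <_) (sym (trans (List.length-map _ (filterᵇ (holds meets ds) W)) (length-filterᵇ _ W))) (retains-nonempty meets ds {length cs * t} W 0<W ret))
    ... | es , U′ , len′ , ret′ , U′-small , det′ = ds ++ map (pull c) es , (λ y → U y ∨ U′ y) ,
      ℕ.≤-trans (ℕ.≤-reflexive (trans (List.length-++ ds) (cong (length ds +_) (List.length-map (pull c) es))))
        (ℕ.≤-trans (ℕ.+-mono-≤ len len′) (ℕ.≤-reflexive (ℕ.+-comm (length cs * t) t))) ,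
      subst (λ s → Retains meets (ds ++ map (pull c) es) s W) (ℕ.+-comm (length cs * t) t)
        (retains-++ meets ds (map (pull c) es) {length cs * t} {t} W ret ret-pull) ,
      U∨U′-small , det″
      where
      W′ = filterᵇ (holds meets ds) W
      ret-pull : Retains meets (map (pull c) es) t W′
      ret-pull = begin
        length W′                                           ≡⟨ List.length-map (coefficients c) W′ ⟨
        length (map (coefficients c) W′)                    ≤⟨ ret′ ⟩
        2 ^ t * count (holds passes es) (map (coefficients c) W′)
          ≡⟨ cong (2 ^ t *_) (trans (∑-map (coefficients c) W′ _) (∑-cong W′ λ z → cong ind (sym (holds-pull c es z)))) ⟩
        2 ^ t * count (holds meets (map (pull c) es)) W′    ∎
        where open ℕ.≤-Reasoning
      ind-∨ : ∀ a b → ind (a ∨ b) ≤ ind a + ind b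
      ind-∨ true  b = s≤s z≤n
      ind-∨ false b = ℕ.≤-refl
      U∨U′-small : E * count (λ y → U y ∨ U′ y) (allFin n) ≤ n + length cs * n
      U∨U′-small = begin
        E * count (λ y → U y ∨ U′ y) (allFin n)
          ≤⟨ ℕ.*-monoʳ-≤ E (∑-mono (allFin n) λ {y} _ → ind-∨ (U y) (U′ y)) ⟩
        E * ∑ (allFin n) (λ y → ind (U y) + ind (U′ y))
          ≡⟨ trans (cong (E *_) (∑-+ (allFin n) _ _)) (ℕ.*-distribˡ-+ E _ _) ⟩
        E * count U (allFin n) + E * count U′ (allFin n)
          ≤⟨ ℕ.+-mono-≤ U-small (ℕ.≤-trans U′-small (ℕ.≤-reflexive (length-allFin n))) ⟩
        length cs * n + n
          ≡⟨ ℕ.+-comm (length cs * n) n ⟩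
        n + length cs * n ∎
        where open ℕ.≤-Reasoning
      det″ : ∀ y z z′ → U y ∨ U′ y ≡ false → holds meets (ds ++ map (pull c) es) z ≡ true →
        holds meets (ds ++ map (pull c) es) z′ ≡ true → holds meets (c ∷ cs) (y ∷ z) ≡ holds meets (c ∷ cs) (y ∷ z′)
      det″ y z z′ eq hz hz′ with U y in Uy | U′ y in U′y
      ... | false | false = cong₂ _∧_
        (cong (λ b → agree b (value c)) (trans (cong bit (form-∷ c y z)) (trans
          (det′ y U′y (coefficients c z) (coefficients c z′)
            (trans (sym (holds-pull c es z)) (proj₂ (holds-++⁻ meets ds (map (pull c) es) {z} hz)))
            (trans (sym (holds-pull c es z′)) (proj₂ (holds-++⁻ meets ds (map (pull c) es) {z′} hz′))))
          (cong bit (sym (form-∷ c y z′))))))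
        (det y z z′ Uy (proj₁ (holds-++⁻ meets ds (map (pull c) es) hz)) (proj₁ (holds-++⁻ meets ds (map (pull c) es) hz′)))

-- Large parts from a dense set of tuples

Parts : (n m C : ℕ) → (Vec (Fin n) m → Set) → Set
Parts n m C R = Σ (Fin m → Fin n → Bool) λ X → (∀ i → n ≤ C * count (X i) (allFin n)) ×
  (∀ y → (∀ i → X i (lookup y i) ≡ true) → R y)

DenseConditions : (D m t K C : ℕ) → Set
DenseConditions D m t K C = ∀ {n} (φ : Fin n → Vec ℚ D) (cs : List (Condition φ m)) → 0 < n → length cs ≤ t →
  n ^ m ≤ K * count (holds meets cs) (tuples n m) → Parts n m C (λ y → holds meets cs y ≡ true)

-- By averaging, many z complete to a solution with at least n/(2K) vertices y. After the
-- elimination these y work, up to few exceptions, for all z passing the pulled-back tests at once,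
-- and those z are again described by boundedly many conditions and still dense.
dense-conditions : ∀ D m t K → ∃ (DenseConditions D m t K)
dense-conditions D zero t K = 0 , λ φ cs 0<n len dense → (λ ()) , (λ ()) , λ { [] _ → nonzero (holds meets cs []) dense }
  where
  nonzero : ∀ b → 1 ≤ K * (ind b + 0) → b ≡ true
  nonzero true  _ = refl
  nonzero false h = ⊥-elim (ℕ.<⇒≱ h (ℕ.≤-reflexive (ℕ.*-zeroʳ K)))
-- With at most t conditions, E = 4K (t + 1) keeps the exceptional set below n/(4K), half of the
-- n/(2K) vertices guaranteed for a good z. In the recursion at most t conditions give t′ tests
-- each, and the density of z drops to 1/(2K) for being good and by 2^(t t′) for passing.
dense-conditions D (suc m) t K with partition-from-cells (cells D) (4 * K * suc t)
... | t′ , part with dense-conditions D m (t * t′) (2 * K * 2 ^ (t * t′))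
... | C′ , recurse = 4 * K + C′ , step
  where
  step : DenseConditions D (suc m) t K (4 * K + C′)
  step {n} φ cs 0<n len dense = use (eliminate-first φ {4 * K * suc t} {t′} part cs W 0<W)
    where
    open ℕ.≤-Reasoning
    instance
      n≢0 : ℕ.NonZero n
      n≢0 = >-nonZero 0<n
    deg : Vec (Fin n) m → ℕ
    deg z = count (λ y → holds meets cs (y ∷ z)) (allFin n)
    good : Vec (Fin n) m → Bool
    good z = n ≤ᵇ 2 * K * deg z
    W : List (Vec (Fin n) m)
    W = filterᵇ good (tuples n m)
    deg-bound : ∀ z → 2 * K * deg z ≤ 2 * K * n * ind (good z) + n
    deg-bound z with good z in eq
    ... | true  = ℕ.≤-trans (ℕ.*-monoʳ-≤ (2 * K) (ℕ.≤-trans (count≤length _ (allFin n)) (ℕ.≤-reflexive (length-allFin n))))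
                    (ℕ.≤-trans (ℕ.≤-reflexive (sym (ℕ.*-identityʳ _))) (ℕ.m≤m+n _ n))
    ... | false = ℕ.≤-trans (ℕ.<⇒≤ (≤ᵇ-false eq)) (ℕ.m≤n+m n _)
    -- The bad z account for at most n · n^m of the total, which is at least 2 n · n^m after
    -- multiplication by 2K.
    many-good : n ^ m ≤ 2 * K * length W
    many-good = ℕ.*-cancelˡ-≤ n (ℕ.+-cancelʳ-≤ (n * n ^ m) _ _ (begin
      n * n ^ m + n * n ^ m                                   ≡⟨ double (n * n ^ m) ⟩
      2 * (n * n ^ m)                                         ≤⟨ ℕ.*-monoʳ-≤ 2 dense ⟩
      2 * (K * count (holds meets cs) (tuples n (suc m)))     ≡⟨ ℕ.*-assoc 2 K _ ⟨
      2 * K * count (holds meets cs) (tuples n (suc m))       ≡⟨ cong (2 * K *_) (count-tuples n m (holds meets cs)) ⟩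
      2 * K * ∑ (tuples n m) deg                              ≡⟨ ∑-*ˡ (tuples n m) (2 * K) deg ⟨
      ∑ (tuples n m) (λ z → 2 * K * deg z)                    ≤⟨ ∑-mono (tuples n m) (λ {z} _ → deg-bound z) ⟩
      ∑ (tuples n m) (λ z → 2 * K * n * ind (good z) + n)     ≡⟨ ∑-+ (tuples n m) _ _ ⟩
      ∑ (tuples n m) (λ z → 2 * K * n * ind (good z)) + ∑ (tuples n m) (λ _ → n)
        ≡⟨ cong₂ _+_ (∑-*ˡ (tuples n m) (2 * K * n) _) (trans (∑-const (tuples n m) n) (cong (_* n) (length-tuples n m))) ⟩
      2 * K * n * count good (tuples n m) + n ^ m * n         ≡⟨ cong (λ s → 2 * K * n * s + n ^ m * n) (length-filterᵇ good (tuples n m)) ⟨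
      2 * K * n * length W + n ^ m * n                        ≡⟨ reorder (2 * K) n (length W) (n ^ m) ⟩
      n * (2 * K * length W) + n * n ^ m                      ∎))
      where
      double : ∀ s → s + s ≡ 2 * s
      double = solve-∀
      reorder : ∀ k n w s → k * n * w + s * n ≡ n * (k * w) + n * s
      reorder = solve-∀
    0<W : 0 < length W
    0<W with length W in eq
    ... | suc _ = s≤s z≤n
    ... | zero  = ⊥-elim (ℕ.<⇒≱ (ℕ.m^n>0 n m) (ℕ.≤-trans many-good (ℕ.≤-reflexive (trans (cong (2 * K *_) eq) (ℕ.*-zeroʳ (2 * K))))))
    use : ∃[ ds ] ∃[ U ] length ds ≤ length cs * t′ × Retains meets ds (length cs * t′) W ×
        4 * K * suc t * count U (allFin n) ≤ length cs * n ×
        (∀ y z z′ → U y ≡ false → holds (meets {φ = φ}) ds z ≡ true → holds meets ds z′ ≡ true →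
          holds meets cs (y ∷ z) ≡ holds meets cs (y ∷ z′)) →
      Parts n (suc m) (4 * K + C′) (λ y → holds meets cs y ≡ true)
    use (ds , U , ds-len , ret , U-small , det)
      with count-witness (holds meets ds) W (retains-nonempty meets ds {length cs * t′} W 0<W ret)
         | recurse φ ds 0<n (ℕ.≤-trans ds-len (ℕ.*-monoˡ-≤ t′ len)) dense′
      where
      dense′ : n ^ m ≤ 2 * K * 2 ^ (t * t′) * count (holds meets ds) (tuples n m)
      dense′ = begin
        n ^ m                                                        ≤⟨ many-good ⟩
        2 * K * length W                                             ≤⟨ ℕ.*-monoʳ-≤ (2 * K) (retains-weaken meets ds {length cs * t′} W (ℕ.*-monoˡ-≤ t′ len) ret) ⟩
        2 * K * (2 ^ (t * t′) * count (holds meets ds) W)            ≡⟨ ℕ.*-assoc (2 * K) (2 ^ (t * t′)) _ ⟨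
        2 * K * 2 ^ (t * t′) * count (holds meets ds) W              ≡⟨ cong (2 * K * 2 ^ (t * t′) *_) (count-filterᵇ (holds meets ds) good (tuples n m)) ⟩
        2 * K * 2 ^ (t * t′) * count (λ z → good z ∧ holds meets ds z) (tuples n m)
          ≤⟨ ℕ.*-monoʳ-≤ (2 * K * 2 ^ (t * t′)) (count-mono (tuples n m) λ z h → proj₂ (∧-true {good z} h)) ⟩
        2 * K * 2 ^ (t * t′) * count (holds meets ds) (tuples n m)   ∎
    ... | z₀ , z₀∈ , z₀-holds | X′ , X′-big , X′-holds = X , X-big , X-holds
      where
      -- A single good z₀ passing the tests represents all of them: off `U`, the conditions at (y,
      -- z) and at (y, z₀) have the same truth value whenever z passes.
      X : Fin (suc m) → Fin n → Bool
      X zero    y = holds meets cs (y ∷ z₀) ∧ not (U y)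
      X (suc i) y = X′ i y
      4KU≤n : 4 * K * count U (allFin n) ≤ n
      4KU≤n = ℕ.*-cancelˡ-≤ (suc t) (begin
        suc t * (4 * K * count U (allFin n))    ≡⟨ reorder (suc t) (4 * K) (count U (allFin n)) ⟩
        4 * K * suc t * count U (allFin n)      ≤⟨ U-small ⟩
        length cs * n                           ≤⟨ ℕ.*-monoˡ-≤ n (ℕ.≤-trans len (ℕ.n≤1+n t)) ⟩
        suc t * n                               ∎)
        where
        reorder : ∀ s k u → s * (k * u) ≡ k * s * u
        reorder = solve-∀
      X₀-big : n ≤ 4 * K * count (X zero) (allFin n)
      X₀-big = ℕ.+-cancelʳ-≤ n _ _ (begin
        n + n                       ≤⟨ ℕ.+-mono-≤ z₀-good z₀-good ⟩
        2 * K * deg z₀ + 2 * K * deg z₀     ≡⟨ double K (deg z₀) ⟩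
        4 * K * deg z₀              ≡⟨ cong (4 * K *_) (count-split _ (not ∘ U) (allFin n)) ⟩
        4 * K * (count (X zero) (allFin n) + count (λ y → holds meets cs (y ∷ z₀) ∧ not (not (U y))) (allFin n))
          ≤⟨ ℕ.*-monoʳ-≤ (4 * K) (ℕ.+-monoʳ-≤ _ (count-mono (allFin n) λ y h → not-not (U y) (proj₂ (∧-true {holds meets cs (y ∷ z₀)} h)))) ⟩
        4 * K * (count (X zero) (allFin n) + count U (allFin n))
          ≡⟨ ℕ.*-distribˡ-+ (4 * K) _ _ ⟩
        4 * K * count (X zero) (allFin n) + 4 * K * count U (allFin n)
          ≤⟨ ℕ.+-monoʳ-≤ _ 4KU≤n ⟩
        4 * K * count (X zero) (allFin n) + n ∎)
        where
        z₀-good : n ≤ 2 * K * deg z₀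
        z₀-good = ≤ᵇ-true (proj₂ (∈-filterᵇ⁻ good (tuples n m) z₀∈))
        double : ∀ k d → 2 * k * d + 2 * k * d ≡ 4 * k * d
        double = solve-∀
        not-not : ∀ b → not (not b) ≡ true → b ≡ true
        not-not true _ = refl
      X-big : ∀ i → n ≤ (4 * K + C′) * count (X i) (allFin n)
      X-big zero    = ℕ.≤-trans X₀-big (ℕ.*-monoˡ-≤ _ (ℕ.m≤m+n (4 * K) C′))
      X-big (suc i) = ℕ.≤-trans (X′-big i) (ℕ.*-monoˡ-≤ _ (ℕ.m≤n+m C′ (4 * K)))
      X-holds : ∀ y → (∀ i → X i (lookup y i) ≡ true) → holds meets cs y ≡ true
      X-holds (y ∷ z) h = trans
        (det y z z₀ (not-true (proj₂ (∧-true {holds meets cs (y ∷ z₀)} (h zero)))) (X′-holds z (h ∘ suc)) z₀-holds)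
        (proj₁ (∧-true (h zero)))

-- Rational determinants under selection of rows and columns

Matrix : ℕ → Set
Matrix n = Fin n → Fin n → ℚ

sgn : ∀ {n} → Fin n → ℚ
sgn j = (ℚ.- 1ℚ) ^ℚ toℕ j

minor : ∀ {n} → Matrix (suc n) → Fin (suc n) → Fin (suc n) → Matrix n
minor M i j r c = M (punchIn i r) (punchIn j c)

det-cong : ∀ {n} {M N : Matrix n} → (∀ r c → M r c ≡ N r c) → detℚ M ≡ detℚ N
det-cong {zero}  M≗N = refl
det-cong {suc n} M≗N = sum-cong-≗ λ j → cong (sgn j ℚ.*_)
  (cong₂ ℚ._*_ (M≗N zero j) (det-cong λ r c → M≗N (suc r) (punchIn j c)))

-- The corner term is common to both expansions. Every other term involves one entry of the first
-- row and one of the first column; once the minors are expanded too, the two double sums have the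
-- same summands in exchanged order.
det-expand-column : ∀ {n} (M : Matrix (suc n)) →
  detℚ M ≡ sumℚ λ i → sgn i ℚ.* (M i zero ℚ.* detℚ (minor M i zero))
det-expand-column {zero}  M = refl
det-expand-column {suc n} M = cong (sgn {suc n} zero ℚ.* (M zero zero ℚ.* detℚ (minor M zero zero)) ℚ.+_) (begin
  sumℚ (λ j → sgn (suc j) ℚ.* (M zero (suc j) ℚ.* detℚ (minor M zero (suc j))))
    ≡⟨ sum-cong-≗ (λ j → trans
         (cong (λ s → sgn (suc j) ℚ.* (M zero (suc j) ℚ.* s)) (det-expand-column (minor M zero (suc j))))
         (push (sgn (suc j)) (M zero (suc j)) λ i → sgn i ℚ.* (M (suc i) zero ℚ.* Δ i j))) ⟩
  sumℚ (λ j → sumℚ λ i → sgn (suc j) ℚ.* (M zero (suc j) ℚ.* (sgn i ℚ.* (M (suc i) zero ℚ.* Δ i j))))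
    ≡⟨ ∑-comm (λ j i → sgn (suc j) ℚ.* (M zero (suc j) ℚ.* (sgn i ℚ.* (M (suc i) zero ℚ.* Δ i j)))) ⟩
  sumℚ (λ i → sumℚ λ j → sgn (suc j) ℚ.* (M zero (suc j) ℚ.* (sgn i ℚ.* (M (suc i) zero ℚ.* Δ i j))))
    ≡⟨ sum-cong-≗ (λ i → sum-cong-≗ λ j → reorder (sgn j) (M zero (suc j)) (sgn i) (M (suc i) zero) (Δ i j)) ⟩
  sumℚ (λ i → sumℚ λ j → sgn (suc i) ℚ.* (M (suc i) zero ℚ.* (sgn j ℚ.* (M zero (suc j) ℚ.* Δ i j))))
    ≡⟨ sum-cong-≗ (λ i → push (sgn (suc i)) (M (suc i) zero) λ j → sgn j ℚ.* (M zero (suc j) ℚ.* Δ i j)) ⟨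
  sumℚ (λ i → sgn (suc i) ℚ.* (M (suc i) zero ℚ.* detℚ (minor M (suc i) zero))) ∎)
  where
  open ≡-Reasoning
  Δ : Fin (suc n) → Fin (suc n) → ℚ
  Δ i j = detℚ λ r c → M (suc (punchIn i r)) (suc (punchIn j c))
  push : ∀ {m} a b (t : Fin m → ℚ) → a ℚ.* (b ℚ.* sumℚ t) ≡ sumℚ λ i → a ℚ.* (b ℚ.* t i)
  push a b t = trans (cong (a ℚ.*_) (*-distribˡ-sum b t)) (*-distribˡ-sum a λ i → b ℚ.* t i)
  reorder : ∀ s a r b d → ((ℚ.- 1ℚ) ℚ.* s) ℚ.* (a ℚ.* (r ℚ.* (b ℚ.* d))) ≡ ((ℚ.- 1ℚ) ℚ.* r) ℚ.* (b ℚ.* (s ℚ.* (a ℚ.* d)))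
  reorder = solve 5 (λ s a r b d → (con (ℚ.- 1ℚ) :* s) :* (a :* (r :* (b :* d))) := (con (ℚ.- 1ℚ) :* r) :* (b :* (s :* (a :* d)))) refl
    where open +-*-Solver

det-transpose : ∀ {n} (M : Matrix n) → detℚ (λ r c → M c r) ≡ detℚ M
det-transpose {zero}  M = refl
det-transpose {suc n} M = trans
  (sum-cong-≗ λ j → cong (λ s → sgn j ℚ.* (M j zero ℚ.* s)) (det-transpose (minor M j zero)))
  (sym (det-expand-column M))

private
  scale-sum : ∀ {m} σ (a b : Fin m → ℚ) → (∀ j → a j ≡ σ ℚ.* b j) → sumℚ a ≡ σ ℚ.* sumℚ b
  scale-sum σ a b eq = trans (sum-cong-≗ eq) (sym (*-distribˡ-sum σ b))

  det-scale : ∀ {m} (M N : Matrix (suc m)) σ → (∀ c → M zero c ≡ N zero c) →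
    (∀ j → detℚ (minor M zero j) ≡ σ ℚ.* detℚ (minor N zero j)) → detℚ M ≡ σ ℚ.* detℚ N
  det-scale M N σ row minors = scale-sum σ _ _ λ j → trans
    (cong₂ (λ a b → sgn j ℚ.* (a ℚ.* b)) (row j) (minors j))
    (solve 4 (λ s a σ d → s :* (a :* (σ :* d)) := σ :* (s :* (a :* d))) refl (sgn j) (N zero j) σ (detℚ (minor N zero j)))
    where open +-*-Solver

-- The double Laplace expansion along two rows x and y, with Δ(c) standing for the
-- minor of the remaining rows in the columns c; it is antisymmetric in x and y.
two-rows : ∀ {m} (x y : Fin (suc (suc m)) → ℚ) → ((Fin m → Fin (suc (suc m))) → ℚ) → ℚ
two-rows x y Δ = sumℚ λ j → sgn j ℚ.* (x j ℚ.* sumℚ λ k → sgn k ℚ.* (y (punchIn j k) ℚ.* Δ (punchIn j ∘ punchIn k)))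

-- Induction on the number of columns. The terms in which x or y uses column 0 form two blocks that
-- are exchanged up to sign; the remaining terms are the same expression without column 0, whose
-- extra signs cancel.
two-rows-antisym : ∀ {m} (x y : Fin (suc (suc m)) → ℚ) (Δ : (Fin m → Fin (suc (suc m))) → ℚ) →
  (∀ {f g} → f ≗ g → Δ f ≡ Δ g) → two-rows x y Δ ≡ ℚ.- two-rows y x Δ
two-rows-antisym {m} x y Δ ext = begin
  two-rows x y Δ
    ≡⟨ decompose x y ⟩
  x zero ℚ.* A y ℚ.+ (ℚ.- (y zero ℚ.* A x) ℚ.+ rest x y)
    ≡⟨ cong (λ r → x zero ℚ.* A y ℚ.+ (ℚ.- (y zero ℚ.* A x) ℚ.+ r)) (rest-antisym m x y Δ ext) ⟩
  x zero ℚ.* A y ℚ.+ (ℚ.- (y zero ℚ.* A x) ℚ.+ ℚ.- rest y x)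
    ≡⟨ solve 3 (λ p q r → p :+ (:- q :+ :- r) := :- (q :+ (:- p :+ r))) refl (x zero ℚ.* A y) (y zero ℚ.* A x) (rest y x) ⟩
  ℚ.- (y zero ℚ.* A x ℚ.+ (ℚ.- (x zero ℚ.* A y) ℚ.+ rest y x))
    ≡⟨ cong ℚ.-_ (decompose y x) ⟨
  ℚ.- two-rows y x Δ ∎
  where
  open ≡-Reasoning
  open +-*-Solver
  A : (Fin (suc (suc m)) → ℚ) → ℚ
  A y = sumℚ λ k → sgn k ℚ.* (y (suc k) ℚ.* Δ (suc ∘ punchIn k))
  rest′ : ∀ m (x y : Fin (suc (suc m)) → ℚ) → ((Fin m → Fin (suc (suc m))) → ℚ) → Fin (suc m) → ℚ
  rest′ m x y Δ j = sumℚ λ k → sgn (suc k) ℚ.* (y (suc (punchIn j k)) ℚ.* Δ (punchIn (suc j) ∘ punchIn (suc k)))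
  restΔ : ∀ m (x y : Fin (suc (suc m)) → ℚ) → ((Fin m → Fin (suc (suc m))) → ℚ) → ℚ
  restΔ m x y Δ = sumℚ λ j → sgn (suc j) ℚ.* (x (suc j) ℚ.* rest′ m x y Δ j)
  rest : (x y : Fin (suc (suc m)) → ℚ) → ℚ
  rest x y = restΔ m x y Δ
  decompose : ∀ x y → two-rows x y Δ ≡ x zero ℚ.* A y ℚ.+ (ℚ.- (y zero ℚ.* A x) ℚ.+ rest x y)
  decompose x y = cong₂ ℚ._+_ (ℚ.*-identityˡ (x zero ℚ.* A y)) (begin
    sumℚ (λ j → sgn (suc j) ℚ.* (x (suc j) ℚ.* (1ℚ ℚ.* (y zero ℚ.* Δ (suc ∘ punchIn j)) ℚ.+ rest′ m x y Δ j)))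
      ≡⟨ sum-cong-≗ (λ j → solve 5 (λ s x y d r → (con (ℚ.- 1ℚ) :* s) :* (x :* (con 1ℚ :* (y :* d) :+ r)) :=
           (:- y) :* (s :* (x :* d)) :+ (con (ℚ.- 1ℚ) :* s) :* (x :* r)) refl (sgn j) (x (suc j)) (y zero) (Δ (suc ∘ punchIn j)) (rest′ m x y Δ j)) ⟩
    sumℚ (λ j → (ℚ.- y zero) ℚ.* (sgn j ℚ.* (x (suc j) ℚ.* Δ (suc ∘ punchIn j))) ℚ.+ sgn (suc j) ℚ.* (x (suc j) ℚ.* rest′ m x y Δ j))
      ≡⟨ ∑-distrib-+ (λ j → (ℚ.- y zero) ℚ.* (sgn j ℚ.* (x (suc j) ℚ.* Δ (suc ∘ punchIn j)))) (λ j → sgn (suc j) ℚ.* (x (suc j) ℚ.* rest′ m x y Δ j)) ⟩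
    sumℚ (λ j → (ℚ.- y zero) ℚ.* (sgn j ℚ.* (x (suc j) ℚ.* Δ (suc ∘ punchIn j)))) ℚ.+ rest x y
      ≡⟨ cong (ℚ._+ rest x y) (trans (sym (*-distribˡ-sum (ℚ.- y zero) λ j → sgn j ℚ.* (x (suc j) ℚ.* Δ (suc ∘ punchIn j)))) (sym (ℚ.neg-distribˡ-* (y zero) (A x)))) ⟩
    ℚ.- (y zero ℚ.* A x) ℚ.+ rest x y ∎)
  shift : ∀ {m} → (Fin m → Fin (suc (suc m))) → Fin (suc m) → Fin (suc (suc (suc m)))
  shift f zero    = zero
  shift f (suc c) = suc (f c)
  rest-antisym : ∀ m (x y : Fin (suc (suc m)) → ℚ) (Δ : (Fin m → Fin (suc (suc m))) → ℚ) →
    (∀ {f g} → f ≗ g → Δ f ≡ Δ g) → restΔ m x y Δ ≡ ℚ.- restΔ m y x Δ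
  rest-antisym zero x y Δ ext = solve 4 (λ s a b z → (s :* (a :* con 0ℚ)) :+ con 0ℚ := :- ((s :* (b :* con 0ℚ)) :+ con 0ℚ)) refl
    (sgn (suc (zero {0}))) (x (suc zero)) (y (suc zero)) 0ℚ
  rest-antisym (suc m) x y Δ ext = trans (reduce x y) (trans
    (two-rows-antisym (x ∘ suc) (y ∘ suc) (Δ ∘ shift) λ f≗g → ext λ { zero → refl ; (suc c) → cong suc (f≗g c) })
    (cong ℚ.-_ (sym (reduce y x))))
    where
    reduce : ∀ x y → restΔ (suc m) x y Δ ≡ two-rows (x ∘ suc) (y ∘ suc) (Δ ∘ shift)
    reduce x y = sum-cong-≗ λ j → trans
      (cong (λ s → sgn (suc j) ℚ.* (x (suc j) ℚ.* s)) (scale-sum (ℚ.- 1ℚ) (λ k → sgn (suc k) ℚ.* (y (suc (punchIn j k)) ℚ.* Δ (punchIn (suc j) ∘ punchIn (suc k)))) (inner j) λ k →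
        trans (cong (λ d → sgn (suc k) ℚ.* (y (suc (punchIn j k)) ℚ.* d)) (ext λ { zero → refl ; (suc c) → refl }))
          (ℚ.*-assoc (ℚ.- 1ℚ) (sgn k) _)))
      (solve 3 (λ s a t → (con (ℚ.- 1ℚ) :* s) :* (a :* (con (ℚ.- 1ℚ) :* t)) := s :* (a :* t)) refl (sgn j) (x (suc j)) (sumℚ (inner j)))
      where
      inner : Fin (suc (suc m)) → Fin (suc m) → ℚ
      inner j k = sgn k ℚ.* (y (suc (punchIn j k)) ℚ.* Δ (shift (punchIn j ∘ punchIn k)))

det-swap : ∀ {m} (M N : Matrix (suc (suc m))) → (∀ c → M zero c ≡ N (suc zero) c) → (∀ c → M (suc zero) c ≡ N zero c) →
  (∀ r c → M (suc (suc r)) c ≡ N (suc (suc r)) c) → detℚ M ≡ ℚ.- detℚ N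
det-swap {m} M N eq₀ eq₁ eq₂ = trans
  (two-rows-antisym (M zero) (M (suc zero)) (λ f → detℚ λ r c → M (suc (suc r)) (f c))
    λ f≗g → det-cong λ r c → cong (M (suc (suc r))) (f≗g c))
  (cong ℚ.-_ (det-cong {M = swapped} {N = N} λ { zero → eq₁ ; (suc zero) → eq₀ ; (suc (suc r)) → eq₂ r }))
  where
  swapped : Matrix (suc (suc m))
  swapped zero          = M (suc zero)
  swapped (suc zero)    = M zero
  swapped (suc (suc r)) = M (suc (suc r))

toFront : ∀ {m} → Fin (suc m) → Fin (suc m) → Fin (suc m)
toFront a zero    = a
toFront a (suc r) = punchIn a r

toSecond : ∀ {m} → Fin m → Fin (suc m) → Fin (suc m)
toSecond {suc m} a zero    = zero
toSecond {suc m} a (suc r) = suc (toFront a r)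

mutual
  -- Row a + 1 is first moved to the second place, by moving it to the front of every minor of the
  -- first-row expansion, and then swapped with the top row. The factor σ must not depend on the
  -- matrix, so that it can be pulled out of all minors at once.
  det-toFront : ∀ {m} (a : Fin (suc m)) → ∃[ σ ] ∀ (M : Matrix (suc m)) → detℚ M ≡ σ ℚ.* detℚ (M ∘ toFront a)
  det-toFront zero = 1ℚ , λ M → trans (det-cong {M = M} {N = M ∘ toFront zero} λ { zero c → refl ; (suc r) c → refl }) (sym (ℚ.*-identityˡ (detℚ (M ∘ toFront zero))))
  det-toFront {suc m} (suc a) with det-toSecond a
  ... | σ , second = ℚ.- σ , λ M → trans (second M) (trans
    (cong (σ ℚ.*_) (det-swap (M ∘ toSecond a) (M ∘ toFront (suc a)) (λ _ → refl) (λ _ → refl) (λ _ _ → refl)))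
    (solve 2 (λ s d → s :* (:- d) := (:- s) :* d) refl σ (detℚ (M ∘ toFront (suc a)))))
    where open +-*-Solver

  det-toSecond : ∀ {m} (a : Fin m) → ∃[ σ ] ∀ (M : Matrix (suc m)) → detℚ M ≡ σ ℚ.* detℚ (M ∘ toSecond a)
  det-toSecond {suc m} a with det-toFront a
  ... | σ , front = σ , λ M → det-scale M (M ∘ toSecond a) σ (λ _ → refl) λ j → front (minor M zero j)

self-negative : ∀ q → q ≡ ℚ.- q → q ≡ 0ℚ
self-negative q eq = begin
  q                            ≡⟨ solve 1 (λ q → q := con ℚ.½ :* (q :+ q)) refl q ⟩
  ℚ.½ ℚ.* (q ℚ.+ q)            ≡⟨ cong (λ p → ℚ.½ ℚ.* (q ℚ.+ p)) eq ⟩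
  ℚ.½ ℚ.* (q ℚ.- q)            ≡⟨ solve 1 (λ q → con ℚ.½ :* (q :- q) := con 0ℚ) refl q ⟩
  0ℚ                           ∎
  where
  open ≡-Reasoning
  open +-*-Solver

det-repeat₀ : ∀ {m} (M : Matrix (suc m)) (a : Fin m) → (∀ c → M zero c ≡ M (suc a) c) → detℚ M ≡ 0ℚ
det-repeat₀ {suc m} M a eq = from (det-toSecond a)
  where
  N : Matrix (suc (suc m))
  N = M ∘ toSecond a
  N-zero : detℚ N ≡ 0ℚ
  N-zero = self-negative (detℚ N) (det-swap N N eq (sym ∘ eq) (λ _ _ → refl))
  from : (∃[ σ ] ∀ (M : Matrix (suc (suc m))) → detℚ M ≡ σ ℚ.* detℚ (M ∘ toSecond a)) → detℚ M ≡ 0ℚ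
  from (σ , second) = trans (second M) (trans (cong (σ ℚ.*_) N-zero) (ℚ.*-zeroʳ σ))

det-repeat : ∀ {m} (M : Matrix m) (a b : Fin m) → a ≢ b → (∀ c → M a c ≡ M b c) → detℚ M ≡ 0ℚ
det-repeat {suc m} M a b a≢b eq = from (det-toFront a)
  where
  from : (∃[ σ ] ∀ (M : Matrix (suc m)) → detℚ M ≡ σ ℚ.* detℚ (M ∘ toFront a)) → detℚ M ≡ 0ℚ
  from (σ , front) = trans (front M) (trans (cong (σ ℚ.*_) (det-repeat₀ (M ∘ toFront a) (punchOut a≢b)
    λ c → trans (eq c) (cong (λ r → M r c) (sym (Fin.punchIn-punchOut a≢b))))) (ℚ.*-zeroʳ σ))

SelectsWith : ∀ {m} → (Fin m → Fin m) → ℚ → Set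
SelectsWith {m} f σ = ∀ (M : Matrix m) → detℚ (M ∘ f) ≡ σ ℚ.* detℚ M

-- The factor is 0 or the sign of a permutation, but only its existence is recorded. If f misses 0,
-- the pigeonhole principle gives a repeated row; if f hits 0 twice, that row is repeated; if
-- exactly once, it is brought to the front and the minors are treated recursively.
det-select : ∀ {m} (f : Fin m → Fin m) → ∃ (SelectsWith f)
det-select {zero}  f = 1ℚ , λ M → refl
det-select {suc m} f = search-zero (Fin.any? (λ a → f a Fin.≟ zero))
  where
  repeated : ∀ a b → a ≢ b → f a ≡ f b → ∃ (SelectsWith f)
  repeated a b a≢b eq = 0ℚ , λ M → trans (det-repeat (M ∘ f) a b a≢b λ c → cong (λ r → M r c) eq)
    (sym (ℚ.*-zeroˡ (detℚ M)))

  omits-zero : (∀ a → zero ≢ f a) → ∃ (SelectsWith f)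
  omits-zero 0≢f = collide (Fin.pigeonhole (ℕ.n<1+n m) (λ a → punchOut (0≢f a)))
    where
    collide : (∃[ a ] ∃[ b ] a Fin.< b × punchOut (0≢f a) ≡ punchOut (0≢f b)) → ∃ (SelectsWith f)
    collide (a , b , a<b , eq) = repeated a b (Fin.<⇒≢ a<b) (Fin.punchOut-injective (0≢f a) (0≢f b) eq)

  one-zero : ∀ a → f a ≡ zero → (∀ b → zero ≢ f (punchIn a b)) → ∃ (SelectsWith f)
  one-zero a fa≡0 0≢f = merge (det-toFront a) (det-select g)
    where
    g : Fin m → Fin m
    g b = punchOut (0≢f b)
    merge : (∃[ σ ] ∀ (M : Matrix (suc m)) → detℚ M ≡ σ ℚ.* detℚ (M ∘ toFront a)) → ∃ (SelectsWith g) → ∃ (SelectsWith f)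
    merge (σ , front) (τ , select) = σ ℚ.* τ , λ M → trans (front (M ∘ f)) (trans
      (cong (σ ℚ.*_) (det-scale (M ∘ f ∘ toFront a) M τ (λ c → cong (λ r → M r c) fa≡0) λ j → trans
        (det-cong λ r c → cong (λ i → M i (punchIn j c)) (sym (Fin.punchIn-punchOut (0≢f r))))
        (select (minor M zero j))))
      (sym (ℚ.*-assoc σ τ (detℚ M))))

  search-again : ∀ a → f a ≡ zero → Dec (∃[ b ] f (punchIn a b) ≡ zero) → ∃ (SelectsWith f)
  search-again a fa≡0 (yes (b , fb≡0)) = repeated a (punchIn a b) (λ eq → Fin.punchInᵢ≢i a b (sym eq)) (trans fa≡0 (sym fb≡0))
  search-again a fa≡0 (no none)        = one-zero a fa≡0 λ b eq → none (b , sym eq)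

  search-zero : Dec (∃[ a ] f a ≡ zero) → ∃ (SelectsWith f)
  search-zero (yes (a , fa≡0)) = search-again a fa≡0 (Fin.any? (λ b → f (punchIn a b) Fin.≟ zero))
  search-zero (no none)        = omits-zero λ a eq → none (a , sym eq)

det-select-columns : ∀ {m} (f : Fin m → Fin m) → ∃[ σ ] ∀ (M : Matrix m) → detℚ (λ r c → M r (f c)) ≡ σ ℚ.* detℚ M
det-select-columns {m} f = from (det-select f)
  where
  from : ∃ (SelectsWith f) → ∃[ σ ] ∀ (M : Matrix m) → detℚ (λ r c → M r (f c)) ≡ σ ℚ.* detℚ M
  from (σ , select) = σ , λ M → trans (sym (det-transpose λ r c → M r (f c)))
    (trans (select λ r c → M c r) (cong (σ ℚ.*_) (det-transpose M)))

-- Reals bounded away from zero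

Eventually : (ℕ → Set) → Set
Eventually P = ∃[ N ] ∀ n → N ≤ n → P n

always : {P : ℕ → Set} → (∀ n → P n) → Eventually P
always p = 0 , λ n _ → p n

both : {P Q : ℕ → Set} → Eventually P → Eventually Q → Eventually (λ n → P n × Q n)
both (M , p) (N , q) = M ℕ.⊔ N , λ n ≤n → p n (ℕ.m⊔n≤o⇒m≤o M N ≤n) , q n (ℕ.m⊔n≤o⇒n≤o M N ≤n)

eventually-map : {P Q : ℕ → Set} → (∀ n → P n → Q n) → Eventually P → Eventually Q
eventually-map f (N , p) = N , λ n N≤n → f n (p n N≤n)

private
  ≤-cancelˡ : ∀ c {a b} → c ℚ.+ a ℚ.≤ c ℚ.+ b → a ℚ.≤ b
  ≤-cancelˡ c {a} {b} le = subst₂ ℚ._≤_ (drop a) (drop b) (ℚ.+-monoʳ-≤ (ℚ.- c) le)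
    where
    drop : ∀ a → ℚ.- c ℚ.+ (c ℚ.+ a) ≡ a
    drop a = solve 2 (λ c a → :- c :+ (c :+ a) := a) refl c a
      where open +-*-Solver

  p≤∣p∣ : ∀ p → p ℚ.≤ ℚ.∣ p ∣
  p≤∣p∣ p with ℚ.≤-total 0ℚ p
  ... | inj₁ 0≤p = ℚ.≤-reflexive (sym (ℚ.0≤p⇒∣p∣≡p 0≤p))
  ... | inj₂ p≤0 = ℚ.≤-trans p≤0 (ℚ.0≤∣p∣ p)

  ∣-∣-flip : ∀ p q → ℚ.∣ p ℚ.- q ∣ ≡ ℚ.∣ q ℚ.- p ∣
  ∣-∣-flip p q = trans (cong ℚ.∣_∣ (solve 2 (λ p q → p :- q := :- (q :- p)) refl p q)) (ℚ.∣-p∣≡∣p∣ (q ℚ.- p))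
    where open +-*-Solver

  half-pos : ∀ {ε} → 0ℚ ℚ.< ε → 0ℚ ℚ.< ½ ℚ.* ε
  half-pos = *-pos (ℚ.positive⁻¹ ½)

  half+half : ∀ ε → ½ ℚ.* ε ℚ.+ ½ ℚ.* ε ≡ ε
  half+half = solve 1 (λ e → con ½ :* e :+ con ½ :* e := e) refl
    where open +-*-Solver

  near-large : ∀ {η} a b → η ℚ.+ η ℚ.≤ ℚ.∣ a ∣ → ℚ.∣ a ℚ.- b ∣ ℚ.≤ η → η ℚ.≤ ℚ.∣ b ∣
  near-large {η} a b large near = ≤-cancelˡ η (begin
    η ℚ.+ η                        ≤⟨ large ⟩
    ℚ.∣ a ∣                        ≡⟨ cong ℚ.∣_∣ (solve 2 (λ a b → a := (a :- b) :+ b) refl a b) ⟩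
    ℚ.∣ (a ℚ.- b) ℚ.+ b ∣          ≤⟨ ℚ.∣p+q∣≤∣p∣+∣q∣ (a ℚ.- b) b ⟩
    ℚ.∣ a ℚ.- b ∣ ℚ.+ ℚ.∣ b ∣      ≤⟨ ℚ.+-monoˡ-≤ ℚ.∣ b ∣ near ⟩
    η ℚ.+ ℚ.∣ b ∣                  ∎)
    where
    open ℚ.≤-Reasoning
    open +-*-Solver

-- Apartness from zero, with no commitment to a sign.
Away : ℝ → Set
Away x = ∃[ ε ] 0ℚ ℚ.< ε × Eventually (λ n → ε ℚ.≤ ℚ.∣ approx x n ∣)

_-ᴿ_ : ℝ → ℝ → ℝ
x -ᴿ y = x +ᴿ -ᴿ y

infixl 6 _-ᴿ_

away-resp : ∀ x y → Eventually (λ n → approx x n ≡ approx y n) → Away x → Away y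
away-resp x y eq (ε , 0<ε , away) = ε , 0<ε ,
  eventually-map (λ n (e , a) → subst (λ q → ε ℚ.≤ ℚ.∣ q ∣) e a) (both eq away)

-- From some index M on, the terms stay within ε/2 of the term at M, whose absolute value is at
-- least ε. So the decidable sign of that one rational persists, with margin ε/2.
away-sign : ∀ x → Away x → 0ℝ <ᴿ x ⊎ x <ᴿ 0ℝ
away-sign x (ε , 0<ε , N , away) = choose (ℚ.≤-total 0ℚ (approx x M))
  where
  η : ℚ
  η = ½ ℚ.* ε
  0<η : 0ℚ ℚ.< η
  0<η = half-pos 0<ε
  M : ℕ
  M = N ℕ.⊔ proj₁ (cauchy x η 0<η)
  near : ∀ n → M ≤ n → ℚ.∣ approx x M ℚ.- approx x n ∣ ℚ.< η
  near n M≤n = proj₂ (cauchy x η 0<η) M n (ℕ.m≤n⊔m N _) (ℕ.m⊔n≤o⇒n≤o N _ M≤n)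
  ε≤∣x∣ : ε ℚ.≤ ℚ.∣ approx x M ∣
  ε≤∣x∣ = away M (ℕ.m≤m⊔n N _)
  stays : ∀ a b → ε ℚ.≤ a → ℚ.∣ a ℚ.- b ∣ ℚ.< η → η ℚ.< b
  stays a b ε≤a close = begin-strict
    η                            ≡⟨ solve 2 (λ h a → h := (h :+ h) :- h) refl η a ⟩
    (η ℚ.+ η) ℚ.- η              ≡⟨ cong (ℚ._- η) (half+half ε) ⟩
    ε ℚ.- η                      ≤⟨ ℚ.+-monoˡ-≤ (ℚ.- η) ε≤a ⟩
    a ℚ.- η                      <⟨ ℚ.+-monoʳ-< a (ℚ.neg-antimono-< (ℚ.≤-<-trans (p≤∣p∣ (a ℚ.- b)) close)) ⟩
    a ℚ.- (a ℚ.- b)              ≡⟨ solve 2 (λ a b → a :- (a :- b) := b) refl a b ⟩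
    b                            ∎
    where
    open ℚ.≤-Reasoning
    open +-*-Solver
  choose : 0ℚ ℚ.≤ approx x M ⊎ approx x M ℚ.≤ 0ℚ → 0ℝ <ᴿ x ⊎ x <ᴿ 0ℝ
  choose (inj₁ 0≤x) = inj₁ (η , 0<η , M , λ n M≤n → subst (ℚ._< approx x n) (sym (ℚ.+-identityˡ η))
    (stays (approx x M) (approx x n) (subst (ε ℚ.≤_) (ℚ.0≤p⇒∣p∣≡p 0≤x) ε≤∣x∣) (near n M≤n)))
  choose (inj₂ x≤0) = inj₂ (η , 0<η , M , λ n M≤n → subst₂ ℚ._<_
    (ℚ.+-comm η (approx x n)) (ℚ.+-inverseˡ (approx x n))
    (ℚ.+-monoˡ-< (approx x n) (stays (ℚ.- approx x M) (ℚ.- approx x n)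
      (subst (ε ℚ.≤_) (trans (sym (ℚ.∣-p∣≡∣p∣ (approx x M))) (ℚ.0≤p⇒∣p∣≡p (ℚ.neg-antimono-≤ x≤0))) ε≤∣x∣)
      (subst (ℚ._< η) (trans (∣-∣-flip (approx x M) (approx x n)) (cong ℚ.∣_∣ (solve 2 (λ a b → b :- a := (:- a) :- (:- b)) refl (approx x M) (approx x n)))) (near n M≤n)))))
    where open +-*-Solver

private
  gap-away : ∀ x y → x <ᴿ y → ∃[ ε ] 0ℚ ℚ.< ε × Eventually (λ n → ε ℚ.≤ ℚ.∣ approx y n ℚ.- approx x n ∣)
  gap-away x y (ε , 0<ε , N , less) = ε , 0<ε , N , λ n N≤n → begin
    ε                                       ≡⟨ solve 2 (λ e x → e := (x :+ e) :- x) refl ε (approx x n) ⟩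
    (approx x n ℚ.+ ε) ℚ.- approx x n       ≤⟨ ℚ.+-monoˡ-≤ (ℚ.- approx x n) (ℚ.<⇒≤ (less n N≤n)) ⟩
    approx y n ℚ.- approx x n               ≤⟨ p≤∣p∣ _ ⟩
    ℚ.∣ approx y n ℚ.- approx x n ∣         ∎
    where
    open ℚ.≤-Reasoning
    open +-*-Solver

#⇒away : ∀ x y → x # y → Away (x -ᴿ y)
#⇒away x y (inj₁ x<y) = flip (gap-away x y x<y)
  where
  flip : (∃[ ε ] 0ℚ ℚ.< ε × Eventually (λ n → ε ℚ.≤ ℚ.∣ approx y n ℚ.- approx x n ∣)) → Away (x -ᴿ y)
  flip (ε , 0<ε , away) = ε , 0<ε , eventually-map (λ n → subst (ε ℚ.≤_) (∣-∣-flip (approx y n) (approx x n))) away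
#⇒away x y (inj₂ y<x) = gap-away y x y<x

away⇒#0 : ∀ x → Away x → x # 0ℝ
away⇒#0 x away = swap (away-sign x away)

#0⇒away : ∀ x → x # 0ℝ → Away x
#0⇒away x x#0 = away-resp (x -ᴿ 0ℝ) x (always λ n → ℚ.+-identityʳ (approx x n)) (#⇒away x 0ℝ x#0)

0-not-away : ∀ x → Eventually (λ n → approx x n ≡ 0ℚ) → ¬ Away x
0-not-away x eq (ε , 0<ε , away) = clash (both eq away)
  where
  clash : ¬ Eventually (λ n → approx x n ≡ 0ℚ × ε ℚ.≤ ℚ.∣ approx x n ∣)
  clash (N , h) = ℚ.<-irrefl refl (ℚ.<-≤-trans 0<ε (subst (λ q → ε ℚ.≤ ℚ.∣ q ∣) (proj₁ (h N ℕ.≤-refl)) (proj₂ (h N ℕ.≤-refl))))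

-- With η = ε/4, the comparison of |x| with 2η at one late index decides. If it is larger, x later
-- stays above η; otherwise |x| stays at most 3η, which leaves η for y.
away-+ : ∀ x y → Away (x +ᴿ y) → Away x ⊎ Away y
away-+ x y (ε , 0<ε , N , away) = choose (ℚ.≤-total (η ℚ.+ η) ℚ.∣ approx x M ∣)
  where
  η : ℚ
  η = ½ ℚ.* (½ ℚ.* ε)
  0<η : 0ℚ ℚ.< η
  0<η = half-pos (half-pos 0<ε)
  M : ℕ
  M = N ℕ.⊔ proj₁ (cauchy x η 0<η)
  near : ∀ n → M ≤ n → ℚ.∣ approx x M ℚ.- approx x n ∣ ℚ.≤ η
  near n M≤n = ℚ.<⇒≤ (proj₂ (cauchy x η 0<η) M n (ℕ.m≤n⊔m N _) (ℕ.m⊔n≤o⇒n≤o N _ M≤n))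
  choose : η ℚ.+ η ℚ.≤ ℚ.∣ approx x M ∣ ⊎ ℚ.∣ approx x M ∣ ℚ.≤ η ℚ.+ η → Away x ⊎ Away y
  choose (inj₁ large) = inj₁ (η , 0<η , M , λ n M≤n → near-large (approx x M) (approx x n) large (near n M≤n))
  choose (inj₂ small) = inj₂ (η , 0<η , M , λ n M≤n → ≤-cancelˡ (η ℚ.+ (η ℚ.+ η)) (begin
    η ℚ.+ (η ℚ.+ η) ℚ.+ η
      ≡⟨ solve 1 (λ e → (con ½ :* (con ½ :* e) :+ (con ½ :* (con ½ :* e) :+ con ½ :* (con ½ :* e))) :+ con ½ :* (con ½ :* e) := e) refl ε ⟩
    ε
      ≤⟨ away n (ℕ.m⊔n≤o⇒m≤o N _ M≤n) ⟩
    ℚ.∣ approx x n ℚ.+ approx y n ∣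
      ≤⟨ ℚ.∣p+q∣≤∣p∣+∣q∣ (approx x n) (approx y n) ⟩
    ℚ.∣ approx x n ∣ ℚ.+ ℚ.∣ approx y n ∣
      ≡⟨ cong (λ q → ℚ.∣ q ∣ ℚ.+ ℚ.∣ approx y n ∣) (solve 2 (λ a b → b := (b :- a) :+ a) refl (approx x M) (approx x n)) ⟩
    ℚ.∣ (approx x n ℚ.- approx x M) ℚ.+ approx x M ∣ ℚ.+ ℚ.∣ approx y n ∣
      ≤⟨ ℚ.+-monoˡ-≤ ℚ.∣ approx y n ∣ (ℚ.∣p+q∣≤∣p∣+∣q∣ (approx x n ℚ.- approx x M) (approx x M)) ⟩
    (ℚ.∣ approx x n ℚ.- approx x M ∣ ℚ.+ ℚ.∣ approx x M ∣) ℚ.+ ℚ.∣ approx y n ∣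
      ≤⟨ ℚ.+-monoˡ-≤ ℚ.∣ approx y n ∣ (ℚ.+-mono-≤ (subst (ℚ._≤ η) (∣-∣-flip (approx x M) (approx x n)) (near n M≤n)) small) ⟩
    η ℚ.+ (η ℚ.+ η) ℚ.+ ℚ.∣ approx y n ∣ ∎))
    where
    open ℚ.≤-Reasoning
    open +-*-Solver

away-*ˡ : ∀ x y → Away (x *ᴿ y) → Away x
away-*ˡ x y (ε , 0<ε , away) = bounded (cauchy-bounded {approx y} (cauchy y))
  where
  bounded : (∃[ B ] ℚ.Positive B × ∃[ N ] ∀ n → N ≤ n → ℚ.∣ approx y n ∣ ℚ.≤ B) → Away x
  bounded (B , B>0 , bound) = ε ℚ.* B⁻¹ , *-pos 0<ε (ℚ.positive⁻¹ B⁻¹ {{ℚ.1/pos⇒pos B}}) ,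
    eventually-map (λ n (a , b) → ℚ.*-cancelʳ-≤-pos B (begin
      (ε ℚ.* B⁻¹) ℚ.* B                    ≡⟨ ℚ.*-assoc ε B⁻¹ B ⟩
      ε ℚ.* (B⁻¹ ℚ.* B)                    ≡⟨ cong (ε ℚ.*_) (ℚ.*-inverseˡ B) ⟩
      ε ℚ.* 1ℚ                             ≡⟨ ℚ.*-identityʳ ε ⟩
      ε                                    ≤⟨ a ⟩
      ℚ.∣ approx x n ℚ.* approx y n ∣      ≡⟨ ℚ.∣p*q∣≡∣p∣*∣q∣ (approx x n) (approx y n) ⟩
      ℚ.∣ approx x n ∣ ℚ.* ℚ.∣ approx y n ∣  ≤⟨ ℚ.*-monoˡ-≤-nonNeg ℚ.∣ approx x n ∣ {{ℚ.∣-∣-nonNeg (approx x n)}} b ⟩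
      ℚ.∣ approx x n ∣ ℚ.* B               ∎)) (both away bound)
    where
    open ℚ.≤-Reasoning
    instance
      B-pos : ℚ.Positive B
      B-pos = B>0
      B≢0 : ℚ.NonZero B
      B≢0 = ℚ.pos⇒nonZero B
    B⁻¹ : ℚ
    B⁻¹ = 1/ B

away-*ʳ : ∀ x y → Away (x *ᴿ y) → Away y
away-*ʳ x y away = away-*ˡ y x (away-resp (x *ᴿ y) (y *ᴿ x) (always λ n → ℚ.*-comm (approx x n) (approx y n)) away)

away-* : ∀ x y → Away x → Away y → Away (x *ᴿ y)
away-* x y (ε , 0<ε , away) (η , 0<η , away′) = ε ℚ.* η , *-pos 0<ε 0<η , eventually-map (λ n (a , b) → begin
  ε ℚ.* η                                  ≤⟨ ℚ.*-monoˡ-≤-nonNeg ε {{ℚ.nonNegative (ℚ.<⇒≤ 0<ε)}} b ⟩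
  ε ℚ.* ℚ.∣ approx y n ∣                   ≤⟨ ℚ.*-monoʳ-≤-nonNeg ℚ.∣ approx y n ∣ {{ℚ.∣-∣-nonNeg (approx y n)}} a ⟩
  ℚ.∣ approx x n ∣ ℚ.* ℚ.∣ approx y n ∣    ≡⟨ ℚ.∣p*q∣≡∣p∣*∣q∣ (approx x n) (approx y n) ⟨
  ℚ.∣ approx x n ℚ.* approx y n ∣          ∎) (both away away′)
  where open ℚ.≤-Reasoning

inverseℚ : ∀ q → Σ ℚ λ r → q ≢ 0ℚ → q ℚ.* r ≡ 1ℚ
inverseℚ q with q ℚ.≟ 0ℚ
-- The value at 0 is a default; a sequence that is bounded away from zero reaches it only at
-- finitely many indices.
... | yes q≡0 = 0ℚ , λ q≢0 → ⊥-elim (q≢0 q≡0)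
... | no  q≢0 = 1/ q , λ _ → ℚ.*-inverseʳ q
  where
  instance
    nz : ℚ.NonZero q
    nz = ℚ.≢-nonZero q≢0

-- The Cauchy property comes from |1/a - 1/b| = |a - b| / |ab|, in the form ε² |1/a - 1/b| ≤ |a -
-- b|.
inverse : ∀ x → Away x → Σ ℝ λ y → Eventually (λ n → approx x n ℚ.* approx y n ≡ 1ℚ)
inverse x (ε , 0<ε , N , away) = mkℝ inv inv-cauchy , N , spec
  where
  open ℚ.≤-Reasoning
  inv : ℕ → ℚ
  inv n = proj₁ (inverseℚ (approx x n))
  spec : ∀ n → N ≤ n → approx x n ℚ.* inv n ≡ 1ℚ
  spec n N≤n = proj₂ (inverseℚ (approx x n)) λ x≡0 →
    ℚ.<-irrefl refl (ℚ.<-≤-trans 0<ε (subst (λ q → ε ℚ.≤ ℚ.∣ q ∣) x≡0 (away n N≤n)))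
  scaled : ∀ m n → N ≤ m → N ≤ n → ε ℚ.* (ε ℚ.* ℚ.∣ inv m ℚ.- inv n ∣) ℚ.≤ ℚ.∣ approx x m ℚ.- approx x n ∣
  scaled m n N≤m N≤n = begin
    ε ℚ.* (ε ℚ.* d)
      ≤⟨ ℚ.*-monoˡ-≤-nonNeg ε {{ℚ.nonNegative (ℚ.<⇒≤ 0<ε)}} (ℚ.*-monoʳ-≤-nonNeg d {{ℚ.∣-∣-nonNeg (inv m ℚ.- inv n)}} (away n N≤n)) ⟩
    ε ℚ.* (ℚ.∣ b ∣ ℚ.* d)
      ≡⟨ cong (ε ℚ.*_) (ℚ.∣p*q∣≡∣p∣*∣q∣ b (inv m ℚ.- inv n)) ⟨
    ε ℚ.* ℚ.∣ b ℚ.* (inv m ℚ.- inv n) ∣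
      ≤⟨ ℚ.*-monoʳ-≤-nonNeg ℚ.∣ b ℚ.* (inv m ℚ.- inv n) ∣ {{ℚ.∣-∣-nonNeg (b ℚ.* (inv m ℚ.- inv n))}} (away m N≤m) ⟩
    ℚ.∣ a ∣ ℚ.* ℚ.∣ b ℚ.* (inv m ℚ.- inv n) ∣
      ≡⟨ ℚ.∣p*q∣≡∣p∣*∣q∣ a (b ℚ.* (inv m ℚ.- inv n)) ⟨
    ℚ.∣ a ℚ.* (b ℚ.* (inv m ℚ.- inv n)) ∣
      ≡⟨ cong ℚ.∣_∣ (solve 4 (λ a b p q → a :* (b :* (p :- q)) := b :* (a :* p) :- a :* (b :* q)) refl a b (inv m) (inv n)) ⟩
    ℚ.∣ b ℚ.* (a ℚ.* inv m) ℚ.- a ℚ.* (b ℚ.* inv n) ∣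
      ≡⟨ cong₂ (λ p q → ℚ.∣ b ℚ.* p ℚ.- a ℚ.* q ∣) (spec m N≤m) (spec n N≤n) ⟩
    ℚ.∣ b ℚ.* 1ℚ ℚ.- a ℚ.* 1ℚ ∣
      ≡⟨ cong₂ (λ p q → ℚ.∣ p ℚ.- q ∣) (ℚ.*-identityʳ b) (ℚ.*-identityʳ a) ⟩
    ℚ.∣ b ℚ.- a ∣
      ≡⟨ ∣-∣-flip b a ⟩
    ℚ.∣ a ℚ.- b ∣ ∎
    where
    open +-*-Solver
    a b d : ℚ
    a = approx x m
    b = approx x n
    d = ℚ.∣ inv m ℚ.- inv n ∣
  inv-cauchy : IsCauchy inv
  inv-cauchy η 0<η with cauchy x (ε ℚ.* (ε ℚ.* η)) (*-pos 0<ε (*-pos 0<ε 0<η))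
  ... | M , close = N ℕ.⊔ M , λ m n ≤m ≤n →
    ℚ.*-cancelˡ-<-nonNeg ε {{ε≥0}} (ℚ.*-cancelˡ-<-nonNeg ε {{ε≥0}} (ℚ.≤-<-trans
      (scaled m n (ℕ.m⊔n≤o⇒m≤o N M ≤m) (ℕ.m⊔n≤o⇒m≤o N M ≤n))
      (close m n (ℕ.m⊔n≤o⇒n≤o N M ≤m) (ℕ.m⊔n≤o⇒n≤o N M ≤n))))
    where
    ε≥0 : ℚ.NonNegative ε
    ε≥0 = ℚ.nonNegative (ℚ.<⇒≤ 0<ε)

-- General position makes orientation determinants nonzero

approx-sum : ∀ {m} (f : Fin m → ℝ) n → approx (sumᴿ f) n ≡ sumℚ λ i → approx (f i) n
approx-sum {zero}  f n = refl
approx-sum {suc m} f n = cong (approx (f zero) n ℚ.+_) (approx-sum (f ∘ suc) n)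

sgnᴿ : ∀ {m} → Fin m → ℝ
sgnᴿ i = (-ᴿ 1ℝ) ^ᴿ toℕ i

approx-sgn : ∀ {m} (i : Fin m) n → approx (sgnᴿ i) n ≡ sgn i
approx-sgn zero    n = refl
approx-sgn (suc i) n = cong ((ℚ.- 1ℚ) ℚ.*_) (approx-sgn i n)

approx-det : ∀ {m} (M : Fin m → Fin m → ℝ) n → approx (detᴿ M) n ≡ detℚ λ r c → approx (M r c) n
approx-det {zero}  M n = refl
approx-det {suc m} M n = trans (approx-sum (λ j → sgnᴿ j *ᴿ (M zero j *ᴿ detᴿ (λ r c → M (suc r) (punchIn j c)))) n)
  (sum-cong-≗ λ j → cong₂ (λ s d → s ℚ.* (approx (M zero j) n ℚ.* d)) (approx-sgn j n)
    (approx-det (λ r c → M (suc r) (punchIn j c)) n))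

row : ∀ {d} → Point d → Vector ℝ (suc d)
row x = 1ℝ Vector.∷ x

-- The base is the last point, so prepending a point merely prepends a direction and leaves the old
-- ones unchanged.
directions : ∀ {d r} → Vector (Point d) (suc r) → Vector (Point d) r
directions {r = r} q l a = q (inject₁ l) a -ᴿ q (top r) a

Independent : ∀ {d m} → Vector (Point d) m → Set
Independent v = ∀ t → (∃[ l ] Away (t l)) → ∃[ a ] Away (combination t v a)

Avoids : ∀ {d m} → Point d → Point d → Vector (Point d) m → Set
Avoids x b v = ∀ t → ∃[ a ] Away (x a -ᴿ (b a +ᴿ combination t v a))

-- The invariant of the induction. Independence turns the points into a `Flat`, to which general
-- position applies; the minor is what finally becomes the orientation determinant. No injectivity
-- of the column selection `J` is recorded.
Frame : ∀ {d r} → Vector (Point d) (suc r) → Set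
Frame {d} {r} q = (Σ (Fin (suc r) → Fin (suc d)) λ J → Away (detᴿ λ a b → row (q a) (J b))) × Independent (directions q)

flat : ∀ {d r} (q : Vector (Point d) (suc r)) → Independent (directions q) → Flat d r
flat {r = r} q ind = record
  { base = q (top r) ; direction = directions q
  ; independent = λ t (l , t#0) → let (a , away) = ind t (l , #0⇒away (t l) t#0) in
      a , away⇒#0 (combination t (directions q) a) away }

unit : ∀ {m} → Fin m → Vector ℝ m
unit zero    zero    = 1ℝ
unit zero    (suc j) = 0ℝ
unit (suc i) zero    = 0ℝ
unit (suc i) (suc j) = unit i j

approx-combination : ∀ {d m} (t : Vector ℝ m) (v : Vector (Point d) m) a n →
  approx (combination t v a) n ≡ sumℚ λ l → approx (t l) n ℚ.* approx (v l a) n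
approx-combination t v a n = approx-sum (λ l → t l *ᴿ v l a) n

sum-zero : ∀ {m} (f : Fin m → ℚ) → (∀ i → f i ≡ 0ℚ) → sumℚ f ≡ 0ℚ
sum-zero {m} f f≡0 = trans (sum-cong-≗ f≡0) (sum-replicate-zero m)

sum-unit : ∀ {m} (i : Fin m) (f : Fin m → ℚ) n → sumℚ (λ l → approx (unit i l) n ℚ.* f l) ≡ f i
sum-unit zero    f n = trans (cong₂ ℚ._+_ (ℚ.*-identityˡ (f zero)) (sum-zero _ λ l → ℚ.*-zeroˡ (f (suc l)))) (ℚ.+-identityʳ (f zero))
sum-unit (suc i) f n = trans (cong₂ ℚ._+_ (ℚ.*-zeroˡ (f zero)) (sum-unit i (f ∘ suc) n)) (ℚ.+-identityˡ (f (suc i)))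

-- General position says only that some entry avoids the flat. The entries that span it lie on it,
-- with coefficients 0 for the base and a unit vector otherwise, so the entry must be the new one.
member-not-avoiding : ∀ {d r} (q : Vector (Point d) (suc r)) c → ¬ Avoids (q c) (q (top r)) (directions q)
member-not-avoiding {r = r} q c avoids with view c
... | ‵fromℕ = from (avoids λ _ → 0ℝ)
  where
  from : ¬ (∃[ a ] Away (q (top r) a -ᴿ (q (top r) a +ᴿ combination (λ _ → 0ℝ) (directions q) a)))
  from (a , away) = 0-not-away (q (top r) a -ᴿ (q (top r) a +ᴿ combination (λ _ → 0ℝ) (directions q) a)) (always λ n → trans
    (cong (λ s → approx (q (top r) a) n ℚ.- (approx (q (top r) a) n ℚ.+ s))
      (trans (approx-combination (λ _ → 0ℝ) (directions q) a n) (sum-zero _ λ l → ℚ.*-zeroˡ (approx (directions q l a) n))))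
    (solve 1 (λ b → b :- (b :+ con 0ℚ) := con 0ℚ) refl (approx (q (top r) a) n))) away
    where open +-*-Solver
... | ‵inject₁ l = from (avoids (unit l))
  where
  from : ¬ (∃[ a ] Away (q (inject₁ l) a -ᴿ (q (top r) a +ᴿ combination (unit l) (directions q) a)))
  from (a , away) = 0-not-away (q (inject₁ l) a -ᴿ (q (top r) a +ᴿ combination (unit l) (directions q) a)) (always λ n → trans
    (cong (λ s → approx (q (inject₁ l) a) n ℚ.- (approx (q (top r) a) n ℚ.+ s))
      (trans (approx-combination (unit l) (directions q) a n) (sum-unit l (λ l → approx (directions q l a) n) n)))
    (solve 2 (λ x b → x :- (b :+ (x :- b)) := con 0ℚ) refl (approx (q (inject₁ l) a) n) (approx (q (top r) a) n))) away
    where open +-*-Solver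

module _ {d r : ℕ} (q : Vector (Point d) (suc (suc r))) (avoids : Avoids (q zero) (q (top (suc r))) (directions (q ∘ suc))) where
  private
    x b : Point d
    x = q zero
    b = q (top (suc r))
    v : Vector (Point d) r
    v = directions (q ∘ suc)

  -- If the new coefficient is apart from zero, divide by it.
  extend-independent₀ : ∀ t → Away (t zero) → ∃[ a ] Away (combination t (directions q) a)
  extend-independent₀ t away₀ = from (inverse (t zero) away₀)
    where
    from : (Σ ℝ λ ν → Eventually (λ n → approx (t zero) n ℚ.* approx ν n ≡ 1ℚ)) → ∃[ a ] Away (combination t (directions q) a)
    from (ν , inv) = use (avoids s)
      where
      s : Vector ℝ r
      s l = -ᴿ (t (suc l) *ᴿ ν)
      use : (∃[ a ] Away (x a -ᴿ (b a +ᴿ combination s v a))) → ∃[ a ] Away (combination t (directions q) a)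
      use (a , away) = a , away-resp (t zero *ᴿ (x a -ᴿ (b a +ᴿ combination s v a))) (combination t (directions q) a)
        (eventually-map (λ n → scaled n) inv) (away-* (t zero) (x a -ᴿ (b a +ᴿ combination s v a)) away₀ away)
        where
        open ≡-Reasoning
        open +-*-Solver
        scaled : ∀ n → approx (t zero) n ℚ.* approx ν n ≡ 1ℚ →
          approx (t zero) n ℚ.* (approx (x a) n ℚ.- (approx (b a) n ℚ.+ approx (combination s v a) n)) ≡ approx (combination t (directions q) a) n
        scaled n eq = begin
          τ ℚ.* (X ℚ.- (B ℚ.+ approx (combination s v a) n))
            ≡⟨ solve 4 (λ t x b c → t :* (x :- (b :+ c)) := t :* (x :- b) :+ (:- t) :* c) refl τ X B (approx (combination s v a) n) ⟩
          τ ℚ.* (X ℚ.- B) ℚ.+ (ℚ.- τ) ℚ.* approx (combination s v a) n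
            ≡⟨ cong (λ c → τ ℚ.* (X ℚ.- B) ℚ.+ (ℚ.- τ) ℚ.* c) (approx-combination s v a n) ⟩
          τ ℚ.* (X ℚ.- B) ℚ.+ (ℚ.- τ) ℚ.* sumℚ (λ l → (ℚ.- (approx (t (suc l)) n ℚ.* approx ν n)) ℚ.* approx (v l a) n)
            ≡⟨ cong (τ ℚ.* (X ℚ.- B) ℚ.+_) (*-distribˡ-sum (ℚ.- τ) λ l → (ℚ.- (approx (t (suc l)) n ℚ.* approx ν n)) ℚ.* approx (v l a) n) ⟩
          τ ℚ.* (X ℚ.- B) ℚ.+ sumℚ (λ l → (ℚ.- τ) ℚ.* ((ℚ.- (approx (t (suc l)) n ℚ.* approx ν n)) ℚ.* approx (v l a) n))
            ≡⟨ cong (τ ℚ.* (X ℚ.- B) ℚ.+_) (sum-cong-≗ λ l → trans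
                 (solve 4 (λ t s ν v → (:- t) :* ((:- (s :* ν)) :* v) := (t :* ν) :* (s :* v)) refl τ (approx (t (suc l)) n) (approx ν n) (approx (v l a) n))
                 (trans (cong (ℚ._* (approx (t (suc l)) n ℚ.* approx (v l a) n)) eq) (ℚ.*-identityˡ (approx (t (suc l)) n ℚ.* approx (v l a) n)))) ⟩
          τ ℚ.* (X ℚ.- B) ℚ.+ sumℚ (λ l → approx (t (suc l)) n ℚ.* approx (v l a) n)
            ≡⟨ approx-combination t (directions q) a n ⟨
          approx (combination t (directions q) a) n ∎
          where
          τ X B : ℚ
          τ = approx (t zero) n
          X = approx (x a) n
          B = approx (b a) n

  -- If an old coefficient is away from zero, so is the old combination. It differs from the new one
  -- by the contribution of the new direction; by `away-+`, either the new combination is away from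
  -- zero or the new coefficient is, and then it can be divided by.
  extend-independent : Independent v → Independent (directions q)
  extend-independent ind t (zero  , away₀) = extend-independent₀ t away₀
  extend-independent ind t (suc l , awayₗ) = from (ind (t ∘ suc) (l , awayₗ))
    where
    from : (∃[ a ] Away (combination (t ∘ suc) v a)) → ∃[ a ] Away (combination t (directions q) a)
    from (a , away) = choose (away-+ whole first (away-resp (combination (t ∘ suc) v a) (whole +ᴿ first) (always split) away))
      where
      whole first : ℝ
      whole = combination t (directions q) a
      first = t zero *ᴿ -ᴿ (x a -ᴿ b a)
      split : ∀ n → approx (combination (t ∘ suc) v a) n ≡ approx (whole +ᴿ first) n
      split n = solve 3 (λ t y c → c := (t :* y :+ c) :+ t :* (:- y)) refl (approx (t zero) n) (approx (x a) n ℚ.- approx (b a) n) (approx (combination (t ∘ suc) v a) n)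
        where open +-*-Solver
      choose : Away whole ⊎ Away first → ∃[ a ] Away (combination t (directions q) a)
      choose (inj₁ away-whole) = a , away-whole
      choose (inj₂ away-first) = extend-independent₀ t (away-*ˡ (t zero) (-ᴿ (x a -ᴿ b a)) away-first)

  module _ (J : Fin (suc r) → Fin (suc d)) where
    private
      μ : ℝ
      μ = detᴿ λ a c → row (q (suc a)) (J c)
      S : Fin (suc r) → ℝ
      S c = sgnᴿ (suc c) *ᴿ detᴿ λ a e → row (q (punchIn (suc c) a)) (J e)
      extended : Fin (suc d) → ℝ
      extended α = detᴿ λ a c → row (q a) ((α Vector.∷ J) c)

      -- Expansion along the column α: the coefficients μ and S do not depend on α.
      expand : ∀ α n → approx (extended α) n ≡
        approx (row x α) n ℚ.* approx μ n ℚ.+ sumℚ λ c → approx (S c) n ℚ.* approx (row (q (suc c)) α) n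
      expand α n = trans (approx-det (λ a c → row (q a) ((α Vector.∷ J) c)) n) (trans
        (det-expand-column λ a c → approx (row (q a) ((α Vector.∷ J) c)) n)
        (cong₂ ℚ._+_
          (trans (ℚ.*-identityˡ _) (cong (approx (row x α) n ℚ.*_) (sym (approx-det (λ a c → row (q (suc a)) (J c)) n))))
          (sum-cong-≗ λ c → trans
            (cong₂ (λ s m → s ℚ.* (approx (row (q (suc c)) α) n ℚ.* m)) (sym (approx-sgn (suc c) n))
              (sym (approx-det (λ a e → row (q (punchIn (suc c) a)) (J e)) n)))
            (solve 3 (λ s y m → s :* (y :* m) := (s :* m) :* y) refl (approx (sgnᴿ (suc c)) n) (approx (row (q (suc c)) α) n)
              (approx (detᴿ λ a e → row (q (punchIn (suc c) a)) (J e)) n)))))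
        where open +-*-Solver

      affine-part : ∀ x μ b (S y : Fin (suc r) → ℚ) → y (top r) ≡ b →
        (x ℚ.* μ ℚ.+ sumℚ (λ c → S c ℚ.* y c)) ℚ.- b ℚ.* (1ℚ ℚ.* μ ℚ.+ sumℚ (λ c → S c ℚ.* 1ℚ)) ≡
        (x ℚ.- b) ℚ.* μ ℚ.+ sumℚ λ l → S (inject₁ l) ℚ.* (y (inject₁ l) ℚ.- b)
      affine-part x μ b S y y≡b = begin
        (x ℚ.* μ ℚ.+ sumℚ (λ c → S c ℚ.* y c)) ℚ.- b ℚ.* (1ℚ ℚ.* μ ℚ.+ sumℚ (λ c → S c ℚ.* 1ℚ))
          ≡⟨ solve 5 (λ x μ b p q → (x :* μ :+ p) :- b :* (con 1ℚ :* μ :+ q) := (x :- b) :* μ :+ (p :+ (:- b) :* q)) refl x μ b (sumℚ λ c → S c ℚ.* y c) (sumℚ λ c → S c ℚ.* 1ℚ) ⟩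
        (x ℚ.- b) ℚ.* μ ℚ.+ (sumℚ (λ c → S c ℚ.* y c) ℚ.+ (ℚ.- b) ℚ.* sumℚ (λ c → S c ℚ.* 1ℚ))
          ≡⟨ cong (λ s → (x ℚ.- b) ℚ.* μ ℚ.+ (sumℚ (λ c → S c ℚ.* y c) ℚ.+ s)) (*-distribˡ-sum (ℚ.- b) λ c → S c ℚ.* 1ℚ) ⟩
        (x ℚ.- b) ℚ.* μ ℚ.+ (sumℚ (λ c → S c ℚ.* y c) ℚ.+ sumℚ (λ c → (ℚ.- b) ℚ.* (S c ℚ.* 1ℚ)))
          ≡⟨ cong ((x ℚ.- b) ℚ.* μ ℚ.+_) (∑-distrib-+ (λ c → S c ℚ.* y c) (λ c → (ℚ.- b) ℚ.* (S c ℚ.* 1ℚ))) ⟨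
        (x ℚ.- b) ℚ.* μ ℚ.+ sumℚ (λ c → S c ℚ.* y c ℚ.+ (ℚ.- b) ℚ.* (S c ℚ.* 1ℚ))
          ≡⟨ cong ((x ℚ.- b) ℚ.* μ ℚ.+_) (sum-cong-≗ λ c →
               solve 3 (λ s y b → s :* y :+ (:- b) :* (s :* con 1ℚ) := s :* (y :- b)) refl (S c) (y c) b) ⟩
        (x ℚ.- b) ℚ.* μ ℚ.+ sumℚ (λ c → S c ℚ.* (y c ℚ.- b))
          ≡⟨ cong ((x ℚ.- b) ℚ.* μ ℚ.+_) (sum-init-last λ c → S c ℚ.* (y c ℚ.- b)) ⟩
        (x ℚ.- b) ℚ.* μ ℚ.+ (sumℚ (λ l → S (inject₁ l) ℚ.* (y (inject₁ l) ℚ.- b)) ℚ.+ S (top r) ℚ.* (y (top r) ℚ.- b))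
          ≡⟨ cong (λ z → (x ℚ.- b) ℚ.* μ ℚ.+ (sumℚ (λ l → S (inject₁ l) ℚ.* (y (inject₁ l) ℚ.- b)) ℚ.+ S (top r) ℚ.* (z ℚ.- b))) y≡b ⟩
        (x ℚ.- b) ℚ.* μ ℚ.+ (sumℚ (λ l → S (inject₁ l) ℚ.* (y (inject₁ l) ℚ.- b)) ℚ.+ S (top r) ℚ.* (b ℚ.- b))
          ≡⟨ solve 4 (λ p q s b → p :+ (q :+ s :* (b :- b)) := p :+ q) refl ((x ℚ.- b) ℚ.* μ) (sumℚ λ l → S (inject₁ l) ℚ.* (y (inject₁ l) ℚ.- b)) (S (top r)) b ⟩
        (x ℚ.- b) ℚ.* μ ℚ.+ sumℚ (λ l → S (inject₁ l) ℚ.* (y (inject₁ l) ℚ.- b)) ∎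
        where
        open ≡-Reasoning
        open +-*-Solver

    -- A constructive Cramer rule. The minor extended by coordinate column a, minus b a times the
    -- one extended by the column of ones, equals μ times the deviation of x from a certain point of
    -- the flat. The deviation is away from zero for some a, so one of the two extended minors is.
    extend-minor : Away μ → Σ (Fin (suc (suc r)) → Fin (suc d)) λ J′ → Away (detᴿ λ a c → row (q a) (J′ c))
    extend-minor awayμ = from (inverse μ awayμ)
      where
      Goal : Set
      Goal = Σ (Fin (suc (suc r)) → Fin (suc d)) λ J′ → Away (detᴿ λ a c → row (q a) (J′ c))
      from : (Σ ℝ λ ν → Eventually (λ n → approx μ n ℚ.* approx ν n ≡ 1ℚ)) → Goal
      from (ν , inv) = use (avoids t)
        where
        t : Vector ℝ r
        -- If all extended minors vanished, x would be the point of the flat with exactly these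
        -- coefficients.
        t l = -ᴿ (S (inject₁ l) *ᴿ ν)
        use : (∃[ a ] Away (x a -ᴿ (b a +ᴿ combination t v a))) → Goal
        use (a , away) = choose (away-+ (extended (suc a)) (b a *ᴿ -ᴿ extended zero)
            (away-resp (μ *ᴿ gap) (extended (suc a) +ᴿ b a *ᴿ -ᴿ extended zero) (eventually-map (λ n → scaled n) inv) (away-* μ gap awayμ away)))
          where
          gap : ℝ
          gap = x a -ᴿ (b a +ᴿ combination t v a)
          scaled : ∀ n → approx μ n ℚ.* approx ν n ≡ 1ℚ →
            approx μ n ℚ.* approx gap n ≡ approx (extended (suc a)) n ℚ.+ approx (b a) n ℚ.* (ℚ.- approx (extended zero) n)
          scaled n eq = begin
            M ℚ.* (X ℚ.- (B ℚ.+ approx (combination t v a) n))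
              ≡⟨ solve 4 (λ m x b c → m :* (x :- (b :+ c)) := (x :- b) :* m :+ (:- m) :* c) refl M X B (approx (combination t v a) n) ⟩
            (X ℚ.- B) ℚ.* M ℚ.+ (ℚ.- M) ℚ.* approx (combination t v a) n
              ≡⟨ cong (λ c → (X ℚ.- B) ℚ.* M ℚ.+ (ℚ.- M) ℚ.* c) (approx-combination t v a n) ⟩
            (X ℚ.- B) ℚ.* M ℚ.+ (ℚ.- M) ℚ.* sumℚ (λ l → (ℚ.- (s l ℚ.* V)) ℚ.* (y (inject₁ l) ℚ.- B))
              ≡⟨ cong ((X ℚ.- B) ℚ.* M ℚ.+_) (*-distribˡ-sum (ℚ.- M) λ l → (ℚ.- (s l ℚ.* V)) ℚ.* (y (inject₁ l) ℚ.- B)) ⟩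
            (X ℚ.- B) ℚ.* M ℚ.+ sumℚ (λ l → (ℚ.- M) ℚ.* ((ℚ.- (s l ℚ.* V)) ℚ.* (y (inject₁ l) ℚ.- B)))
              ≡⟨ cong ((X ℚ.- B) ℚ.* M ℚ.+_) (sum-cong-≗ λ l → trans
                   (solve 4 (λ m s ν y → (:- m) :* ((:- (s :* ν)) :* y) := (m :* ν) :* (s :* y)) refl M (s l) V (y (inject₁ l) ℚ.- B))
                   (trans (cong (ℚ._* (s l ℚ.* (y (inject₁ l) ℚ.- B))) eq) (ℚ.*-identityˡ (s l ℚ.* (y (inject₁ l) ℚ.- B))))) ⟩
            (X ℚ.- B) ℚ.* M ℚ.+ sumℚ (λ l → s l ℚ.* (y (inject₁ l) ℚ.- B))
              ≡⟨ affine-part X M B (λ c → approx (S c) n) y refl ⟨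
            (X ℚ.* M ℚ.+ sumℚ (λ c → approx (S c) n ℚ.* y c)) ℚ.- B ℚ.* (1ℚ ℚ.* M ℚ.+ sumℚ (λ c → approx (S c) n ℚ.* 1ℚ))
              ≡⟨ cong₂ (λ p q → p ℚ.- B ℚ.* q) (expand (suc a) n) (expand zero n) ⟨
            approx (extended (suc a)) n ℚ.- B ℚ.* approx (extended zero) n
              ≡⟨ cong (approx (extended (suc a)) n ℚ.+_) (ℚ.neg-distribʳ-* B (approx (extended zero) n)) ⟩
            approx (extended (suc a)) n ℚ.+ B ℚ.* (ℚ.- approx (extended zero) n) ∎
            where
            open ≡-Reasoning
            open +-*-Solver
            M X B V : ℚ
            M = approx μ n
            X = approx (x a) n
            B = approx (b a) n
            V = approx ν n
            s : Fin r → ℚ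
            s l = approx (S (inject₁ l)) n
            y : Fin (suc r) → ℚ
            y c = approx (q (suc c) a) n
          choose : Away (extended (suc a)) ⊎ Away (b a *ᴿ -ᴿ extended zero) → Goal
          choose (inj₁ away-a) = (suc a Vector.∷ J) , away-a
          choose (inj₂ away-0) = (zero Vector.∷ J) , away-resp (-ᴿ extended zero *ᴿ -ᴿ 1ℝ) (extended zero)
            (always λ n → solve 1 (λ e → (:- e) :* (:- (con 1ℚ)) := e) refl (approx (extended zero) n))
            (away-* (-ᴿ extended zero) (-ᴿ 1ℝ) (away-*ʳ (b a) (-ᴿ extended zero) away-0)
              (1ℚ , ℚ.positive⁻¹ 1ℚ , always λ _ → ℚ.≤-refl))
            where open +-*-Solver

frame : ∀ {d n} (p : Vector (Point d) n) → GeneralPosition p → ∀ r → r ≤ d →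
  (i : Fin (suc r) → Fin n) → StrictlyIncreasing i → Frame (p ∘ i)
-- For a single point the column of ones gives the minor 1, and there are no directions.
frame {d} p gp zero r≤d i inc = ((λ _ → zero) , 1ℚ , ℚ.positive⁻¹ 1ℚ , always λ n →
  ℚ.≤-reflexive (cong ℚ.∣_∣ (sym (approx-det {1} (λ a b → row (p (i a)) zero) n)))) , λ t ()
frame {d} p gp (suc r) r<d i inc = from (frame p gp r (ℕ.<⇒≤ r<d) (i ∘ suc) (λ lt → inc (s≤s lt)))
  where
  from : Frame (p ∘ i ∘ suc) → Frame (p ∘ i)
  from ((J , away) , ind) = locate (gp r r<d i inc F)
    where
    F : Flat d r
    F = flat (p ∘ i ∘ suc) ind
    avoids : ∀ x → x ∉ᶠ F → Avoids x (p (i (top (suc r)))) (directions (p ∘ i ∘ suc))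
    avoids x x∉F t = let (a , x#) = x∉F t in a , #⇒away (x a) (pointAt F t a) x#
    locate : (∃[ a ] p (i a) ∉ᶠ F) → Frame (p ∘ i)
    locate (zero  , ∉F) = extend-minor (p ∘ i) (avoids (p (i zero)) ∉F) J away , extend-independent (p ∘ i) (avoids (p (i zero)) ∉F) ind
    locate (suc c , ∉F) = ⊥-elim (member-not-avoiding (p ∘ i ∘ suc) c (avoids (p (i (suc c))) ∉F))

-- For d + 1 points the minor selects as many columns as there are, so it is a constant multiple of
-- the orientation determinant. A factor of a product away from zero is itself away from zero,
-- whatever the constant.
orientation-away : ∀ {d n} (p : Vector (Point d) n) → GeneralPosition p →
  (i : Fin (suc d) → Fin n) → StrictlyIncreasing i → Away (detᴿ (orientationMatrix (p ∘ i)))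
orientation-away {d} p gp i inc = from (proj₁ (frame p gp d ℕ.≤-refl i inc))
  where
  from : (Σ (Fin (suc d) → Fin (suc d)) λ J → Away (detᴿ λ a b → row (p (i a)) (J b))) → Away (detᴿ (orientationMatrix (p ∘ i)))
  from (J , away) = select (det-select-columns J)
    where
    select : (∃[ σ ] ∀ (M : Matrix (suc d)) → detℚ (λ r c → M r (J c)) ≡ σ ℚ.* detℚ M) → Away (detᴿ (orientationMatrix (p ∘ i)))
    select (σ , eq) = away-*ʳ (fromℚ σ) (detᴿ (orientationMatrix (p ∘ i)))
      (away-resp (detᴿ λ a b → row (p (i a)) (J b)) (fromℚ σ *ᴿ detᴿ (orientationMatrix (p ∘ i))) (always λ n → trans
        (approx-det (λ a b → row (p (i a)) (J b)) n) (trans (eq λ a b → approx (row (p (i a)) b) n)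
          (cong (σ ℚ.*_) (sym (approx-det (orientationMatrix (p ∘ i)) n))))) away)

-- Rational points with the orientations of P

eventually-Fin : ∀ {n} {P : Fin n → ℕ → Set} → (∀ i → Eventually (P i)) → Eventually (λ N → ∀ i → P i N)
eventually-Fin {zero}  ev = always λ _ ()
eventually-Fin {suc n} ev = eventually-map (λ N (p₀ , p) → λ { zero → p₀ ; (suc i) → p i })
  (both (ev zero) (eventually-Fin (ev ∘ suc)))

eventually-Vec : ∀ {n} m {P : Vec (Fin n) m → ℕ → Set} → (∀ v → Eventually (P v)) → Eventually (λ N → ∀ v → P v N)
eventually-Vec zero    ev = eventually-map (λ N p → λ { [] → p }) (ev [])
eventually-Vec (suc m) ev = eventually-map (λ N p → λ { (x ∷ v) → p x v })
  (eventually-Fin λ x → eventually-Vec m λ v → ev (x ∷ v))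

Increasing : ∀ {k n} → (Fin k → Fin n) → Set
Increasing f = ∀ i j → i Fin.< j → f i Fin.< f j

increasing? : ∀ {k n} (f : Fin k → Fin n) → Dec (Increasing f)
increasing? f = Fin.all? λ i → Fin.all? λ j → (i Fin.<? j) →-dec (f i Fin.<? f j)

orientationℚ : ∀ {d} → (Fin (suc d) → Fin d → ℚ) → Matrix (suc d)
orientationℚ q i = 1ℚ Vector.∷ q i

Signed : ∀ {d} → Vector (Point d) (suc d) → (Fin (suc d) → Fin d → ℚ) → Set
Signed p q = (0ℚ ℚ.< detℚ (orientationℚ q) × HasOrientation p pos) ⊎ (detℚ (orientationℚ q) ℚ.< 0ℚ × HasOrientation p neg)

<ᴿ-resp : ∀ x y x′ y′ → (∀ n → approx x n ≡ approx x′ n) → (∀ n → approx y n ≡ approx y′ n) → x <ᴿ y → x′ <ᴿ y′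
<ᴿ-resp x y x′ y′ x≗ y≗ (ε , 0<ε , N , less) = ε , 0<ε , N , λ n N≤n → subst₂ (λ a b → a ℚ.+ ε ℚ.< b) (x≗ n) (y≗ n) (less n N≤n)

signed-resp : ∀ {d} (p p′ : Vector (Point d) (suc d)) q q′ → (∀ a → p a ≡ p′ a) → (∀ a → q a ≡ q′ a) → Signed p q → Signed p′ q′
signed-resp {d} p p′ q q′ p≗ q≗ = λ
  { (inj₁ (0<det , positive)) → inj₁ (subst (0ℚ ℚ.<_) det≡ 0<det , <ᴿ-resp 0ℝ (detᴿ (orientationMatrix p)) 0ℝ (detᴿ (orientationMatrix p′)) (λ _ → refl) detᴿ≡ positive)
  ; (inj₂ (det<0 , negative)) → inj₂ (subst (ℚ._< 0ℚ) det≡ det<0 , <ᴿ-resp (detᴿ (orientationMatrix p)) 0ℝ (detᴿ (orientationMatrix p′)) 0ℝ detᴿ≡ (λ _ → refl) negative) }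
  where
  det≡ : detℚ (orientationℚ q) ≡ detℚ (orientationℚ q′)
  det≡ = det-cong λ a b → cong (λ s → (1ℚ Vector.∷ s) b) (q≗ a)
  detᴿ≡ : ∀ n → approx (detᴿ (orientationMatrix p)) n ≡ approx (detᴿ (orientationMatrix p′)) n
  detᴿ≡ n = trans (approx-det (orientationMatrix p) n) (trans
    (det-cong λ a b → cong (λ s → approx ((1ℝ Vector.∷ s) b) n) (p≗ a))
    (sym (approx-det (orientationMatrix p′) n)))

-- There are finitely many tuples, and each determinant keeps its strict sign from some index on;
-- one common late index serves all. Tuples are enumerated as vectors, hence the passage through
-- `tabulate`.
rational-points : ∀ {d n} (p : Vector (Point d) n) → GeneralPosition p →
  Σ (Fin n → Fin d → ℚ) λ q → ∀ (i : Fin (suc d) → Fin n) → StrictlyIncreasing i → Signed (p ∘ i) (q ∘ i)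
rational-points {d} {n} p gp = from (eventually-Vec (suc d) {P = P} λ v → decided v (increasing? (lookup v)))
  where
  at : ℕ → Fin n → Fin d → ℚ
  at N x a = approx (p x a) N
  P : Vec (Fin n) (suc d) → ℕ → Set
  P v N = Increasing (lookup v) → Signed (p ∘ lookup v) (at N ∘ lookup v)
  approximate : ∀ (i : Fin (suc d) → Fin n) N → approx (detᴿ (orientationMatrix (p ∘ i))) N ≡ detℚ (orientationℚ (at N ∘ i))
  approximate i N = trans (approx-det (orientationMatrix (p ∘ i)) N) (det-cong {M = λ a b → approx (orientationMatrix (p ∘ i) a b) N} {N = orientationℚ (at N ∘ i)} λ { a zero → refl ; a (suc b) → refl })
  decided : ∀ v → Dec (Increasing (lookup v)) → Eventually (P v)
  decided v (no  ¬inc) = always λ N inc → ⊥-elim (¬inc inc)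
  decided v (yes inc) = signed (away-sign (detᴿ (orientationMatrix (p ∘ lookup v))) (orientation-away p gp (lookup v) (inc _ _)))
    where
    signed : 0ℝ <ᴿ detᴿ (orientationMatrix (p ∘ lookup v)) ⊎ detᴿ (orientationMatrix (p ∘ lookup v)) <ᴿ 0ℝ → Eventually (P v)
    signed (inj₁ positive@(ε , 0<ε , ev)) = eventually-map (λ N less _ → inj₁
      (subst (0ℚ ℚ.<_) (approximate (lookup v) N) (ℚ.<-trans (subst (0ℚ ℚ.<_) (sym (ℚ.+-identityˡ ε)) 0<ε) less) , positive)) ev
    signed (inj₂ negative@(ε , 0<ε , ev)) = eventually-map (λ N less _ → inj₂
      (subst (ℚ._< 0ℚ) (approximate (lookup v) N) (ℚ.≤-<-trans (subst₂ ℚ._≤_ (ℚ.+-identityʳ _) refl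
        (ℚ.+-monoʳ-≤ (approx (detᴿ (orientationMatrix (p ∘ lookup v))) N) (ℚ.<⇒≤ 0<ε))) less) , negative)) ev
  from : Eventually (λ N → ∀ v → P v N) → Σ (Fin n → Fin d → ℚ) λ q → ∀ i → StrictlyIncreasing i → Signed (p ∘ i) (q ∘ i)
  from (N , all) = at N , λ i (inc : StrictlyIncreasing i) →
    signed-resp (p ∘ lookup (tabulate i)) (p ∘ i) (at N ∘ lookup (tabulate i)) (at N ∘ i)
      (λ a → cong p (Vec.lookup∘tabulate i a)) (λ a → cong (at N) (Vec.lookup∘tabulate i a))
      (all N ℕ.≤-refl (tabulate i) λ a b a<b → subst₂ Fin._<_ (sym (Vec.lookup∘tabulate i a)) (sym (Vec.lookup∘tabulate i b)) (inc a<b))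

-- Binomial coefficients and numbers of tuples

absorption : ∀ n k → suc k * (suc n choose suc k) ≡ suc n * (n choose k)
absorption zero    zero    = refl
absorption zero    (suc k) = trans (cong (suc (suc k) *_) (k>n⇒nCk≡0 {1} {suc (suc k)} (s≤s (s≤s z≤n))))
  (trans (ℕ.*-zeroʳ (suc (suc k))) (sym (trans (ℕ.*-identityˡ _) (k>n⇒nCk≡0 {0} {suc k} (s≤s z≤n)))))
absorption (suc n) zero    = trans (ℕ.*-identityˡ _) (trans (nC1≡n (suc (suc n))) (sym (ℕ.*-identityʳ (suc (suc n)))))
absorption (suc n) (suc k) = begin
  suc (suc k) * (suc (suc n) choose suc (suc k))
    ≡⟨ cong (suc (suc k) *_) (nCk+nC[k+1]≡[n+1]C[k+1] (suc n) (suc k)) ⟨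
  suc (suc k) * (a + (suc n choose suc (suc k)))
    ≡⟨ expand k a (suc n choose suc (suc k)) ⟩
  a + (suc k * a + suc (suc k) * (suc n choose suc (suc k)))
    ≡⟨ cong (a +_) (cong₂ _+_ (absorption n k) (absorption n (suc k))) ⟩
  a + (suc n * (n choose k) + suc n * (n choose suc k))
    ≡⟨ cong (a +_) (trans (sym (ℕ.*-distribˡ-+ (suc n) (n choose k) (n choose suc k))) (cong (suc n *_) (nCk+nC[k+1]≡[n+1]C[k+1] n k))) ⟩
  suc (suc n) * a ∎
  where
  open ≡-Reasoning
  a = suc n choose suc k
  expand : ∀ k a b → suc (suc k) * (a + b) ≡ a + (suc k * a + suc (suc k) * b)
  expand = solve-∀

-- Turns density among the k-element subsequences into density among all k-tuples. Induction on k by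
-- `absorption`, with a factor 2^k for passing from n + 1 to n.
power≤binomial : ∀ k → ∃[ K ] ∀ n → k ≤ n → n ^ k ≤ K * (n choose k)
power≤binomial zero = 1 , λ n _ → ℕ.≤-refl
power≤binomial (suc k) with power≤binomial k
... | K , bound = 2 ^ k * K * suc k , λ { (suc n) (s≤s k≤n) → begin
  suc n * suc n ^ k                               ≤⟨ ℕ.*-monoʳ-≤ (suc n) (double n k k≤n) ⟩
  suc n * (2 ^ k * n ^ k)                         ≤⟨ ℕ.*-monoʳ-≤ (suc n) (ℕ.*-monoʳ-≤ (2 ^ k) (bound n k≤n)) ⟩
  suc n * (2 ^ k * (K * (n choose k)))                 ≡⟨ reorder (suc n) (2 ^ k) K (n choose k) ⟩
  2 ^ k * K * (suc n * (n choose k))                   ≡⟨ cong (2 ^ k * K *_) (absorption n k) ⟨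
  2 ^ k * K * (suc k * (suc n choose suc k))           ≡⟨ ℕ.*-assoc (2 ^ k * K) (suc k) _ ⟨
  2 ^ k * K * suc k * (suc n choose suc k)             ∎ }
  where
  open ℕ.≤-Reasoning
  reorder : ∀ a b c d → a * (b * (c * d)) ≡ b * c * (a * d)
  reorder = solve-∀
  -- Each factor uses n + 1 ≤ 2n, which needs n ≥ 1; this follows from k ≤ n as soon as there is a
  -- factor at all.
  double : ∀ n k → k ≤ n → suc n ^ k ≤ 2 ^ k * n ^ k
  double n zero    _   = ℕ.≤-refl
  double n (suc k) k<n = begin
    suc n * suc n ^ k                ≤⟨ ℕ.*-mono-≤ (ℕ.+-monoˡ-≤ n (ℕ.≤-trans (s≤s z≤n) k<n)) (double n k (ℕ.<⇒≤ k<n)) ⟩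
    (n + n) * (2 ^ k * n ^ k)        ≡⟨ regroup n (2 ^ k) (n ^ k) ⟩
    2 * 2 ^ k * (n * n ^ k)          ∎
    where
    regroup : ∀ n a b → (n + n) * (a * b) ≡ 2 * a * (n * b)
    regroup = solve-∀

∈-tuples : ∀ {n m} (v : Vec (Fin n) m) → v ∈ tuples n m
∈-tuples []      = here refl
∈-tuples (x ∷ v) = ∈.∈-map⁺ (λ (y , z) → y ∷ z) (∈.∈-cartesianProduct⁺ (∈.∈-allFin x) (∈-tuples v))

-- Double counting of the equal pairs: every x of the list occurs among all tuples, and a tuple
-- equals at most one entry of a list without repetitions.
unique-length≤count : ∀ {n m} (p : Vec (Fin n) m → Bool) (xs : List (Vec (Fin n) m)) → Unique xs →
  All (λ x → p x ≡ true) xs → length xs ≤ count p (tuples n m)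
unique-length≤count {n} {m} p xs unique all = begin
  length xs                                             ≡⟨ count-true xs ⟨
  ∑ xs (λ _ → 1)                                        ≤⟨ ∑-mono xs (λ {x} _ → appears (tuples n m) x (∈-tuples x)) ⟩
  ∑ xs (λ x → count (same x) (tuples n m))              ≡⟨ ∑-swap xs (tuples n m) _ ⟩
  ∑ (tuples n m) (λ y → ∑ xs λ x → ind (same x y))      ≤⟨ ∑-mono (tuples n m) (λ {y} _ → at-most-once xs unique all y) ⟩
  count p (tuples n m)                                  ∎
  where
  open ℕ.≤-Reasoning
  same : Vec (Fin n) m → Vec (Fin n) m → Bool
  same x y = does (Vec.≡-dec Fin._≟_ x y)
  appears : ∀ ys x → x ∈ ys → 1 ≤ count (same x) ys
  appears (y ∷ ys) x (here refl) = ℕ.≤-trans (ℕ.≤-reflexive (cong ind (sym (dec-true (Vec.≡-dec Fin._≟_ x x) refl)))) (ℕ.m≤m+n _ _)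
  appears (y ∷ ys) x (there x∈)  = ℕ.m≤n⇒m≤o+n (ind (same x y)) (appears ys x x∈)
  absent : ∀ ys y → All (y ≢_) ys → ∑ ys (λ x → ind (same x y)) ≤ 0
  absent []       y []         = z≤n
  absent (x ∷ ys) y (y≢x ∷ y∉) = ℕ.+-mono-≤ (ℕ.≤-reflexive (cong ind (dec-false (Vec.≡-dec Fin._≟_ x y) (y≢x ∘ sym)))) (absent ys y y∉)
  at-most-once : ∀ ys → Unique ys → All (λ x → p x ≡ true) ys → ∀ y → ∑ ys (λ x → ind (same x y)) ≤ ind (p y)
  at-most-once []       _         _          y = z≤n
  at-most-once (x ∷ ys) (x∉ ∷ uniq) (px ∷ pys) y with Vec.≡-dec Fin._≟_ x y
  ... | yes refl = ℕ.≤-trans (s≤s (absent ys y x∉)) (ℕ.≤-reflexive (cong ind (sym px)))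
  ... | no  _    = at-most-once ys uniq pys y

-- Natural numbers and unit fractions among the rationals

fromℕ≡ : ∀ n → ℤ.+ n ℚ./ 1 ≡ mkℚ (ℤ.+ n) 0 (coprime-sym (1-coprimeTo n))
fromℕ≡ n = ℚ.↥p/↧p≡p (mkℚ (ℤ.+ n) 0 (coprime-sym (1-coprimeTo n)))

/1-mono-< : ∀ {m n} → m < n → ℤ.+ m ℚ./ 1 ℚ.< ℤ.+ n ℚ./ 1
/1-mono-< {m} {n} m<n = subst₂ ℚ._<_ (sym (fromℕ≡ m)) (sym (fromℕ≡ n)) (*<* (ℤ.*-monoʳ-<-pos (ℤ.+ 1) (ℤ.+<+ m<n)))

/1-mono-≤ : ∀ {m n} → m ≤ n → ℤ.+ m ℚ./ 1 ℚ.≤ ℤ.+ n ℚ./ 1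
/1-mono-≤ {m} {n} m≤n = subst₂ ℚ._≤_ (sym (fromℕ≡ m)) (sym (fromℕ≡ n)) (*≤* (ℤ.*-monoʳ-≤-nonNeg (ℤ.+ 1) (ℤ.+≤+ m≤n)))

/1-cancel-< : ∀ {m n} → ℤ.+ m ℚ./ 1 ℚ.< ℤ.+ n ℚ./ 1 → m < n
/1-cancel-< lt = ℕ.≰⇒> λ n≤m → ℚ.<-irrefl refl (ℚ.<-≤-trans lt (/1-mono-≤ n≤m))

/1-* : ∀ m n → ℤ.+ (m * n) ℚ./ 1 ≡ (ℤ.+ m ℚ./ 1) ℚ.* (ℤ.+ n ℚ./ 1)
/1-* m n = sym (trans (cong₂ ℚ._*_ (fromℕ≡ m) (fromℕ≡ n)) (cong (ℚ._/ 1) (sym (ℤ.pos-* m n))))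

unit-fraction : ℕ → ℚ
unit-fraction b = mkℚ (ℤ.+ 1) b (1-coprimeTo (suc b))

unit-fraction-inverse : ∀ b → unit-fraction b ℚ.* (ℤ.+ suc b ℚ./ 1) ≡ 1ℚ
unit-fraction-inverse b = trans (cong (unit-fraction b ℚ.*_) (fromℕ≡ (suc b))) (ℚ.*-inverseʳ (unit-fraction b))

-- A positive fraction is at least one over its own denominator.
unit-fraction-below : ∀ {ε} → 0ℚ ℚ.< ε → ∃[ b ] unit-fraction b ℚ.≤ ε
unit-fraction-below {mkℚ (ℤ.+ suc a) b _} _ = b , *≤* (ℤ.*-monoʳ-≤-nonNeg (ℤ.+ suc b) (ℤ.+≤+ (s≤s (z≤n {a}))))
unit-fraction-below {mkℚ (ℤ.+ zero) b _} (*<* lt) = ⊥-elim (ℤ.<-irrefl (sym (ℤ.*-zeroˡ (ℤ.+ suc b))) (subst (ℤ._< ℤ.+ zero ℤ.* ℤ.+ 1) (ℤ.*-zeroˡ (ℤ.+ suc b)) lt))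
unit-fraction-below {mkℚ ℤ.-[1+ a ] b _} (*<* ())

-- Minors as multilinear forms

module _ {n D : ℕ} (φ : Fin n → Vec ℚ (suc D)) (one : ∀ y → lookup (φ y) zero ≡ 1ℚ) where

  -- The constant coordinate 1 makes a form linear even in a vertex on which it does not depend. It
  -- is the same coordinate that supplies the column of ones in the orientation matrix.
  ml-pad : ∀ {m f h} → Multilinear φ m h → (∀ y z → f (y ∷ z) ≡ h z) → Multilinear φ (suc m) f
  ml-pad {m} {f} {h} ml eq = ml-∷ φ {m} {f} {h} zero ml λ y z →
    trans (eq y z) (trans (sym (ℚ.*-identityʳ (h z))) (cong (h z ℚ.*_) (sym (one y))))

  ml-const : ∀ m c → Multilinear φ m (λ _ → c)
  ml-const zero    c = tt
  ml-const (suc m) c = ml-pad {m} {λ _ → c} {λ _ → c} (ml-const m c) λ _ _ → refl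

  ml-coordinate : ∀ {m} (j : Fin m) e → Multilinear φ m (λ y → lookup (φ (lookup y j)) e)
  ml-coordinate {suc m} zero    e = ml-∷ φ {m} {λ y → lookup (φ (lookup y zero)) e} {λ _ → 1ℚ} e (ml-const m 1ℚ) λ y z → sym (ℚ.*-identityˡ (lookup (φ y) e))
  ml-coordinate {suc m} (suc j) e = ml-pad {m} {λ y → lookup (φ (lookup y (suc j))) e} {λ z → lookup (φ (lookup z j)) e} (ml-coordinate j e) λ { _ _ → refl }

  ml-sum : ∀ {m r} (f : Fin r → Vec (Fin n) m → ℚ) → (∀ j → Multilinear φ m (f j)) → Multilinear φ m (λ y → sumℚ λ j → f j y)
  ml-sum {m} {zero}  f ml = ml-zero φ m
  ml-sum {m} {suc r} f ml = ml-+ φ {m} (ml zero) (ml-sum (f ∘ suc) (ml ∘ suc))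

  minorOf : ∀ {m r} → (Fin r → Fin m) → (Fin r → Fin (suc D)) → Vec (Fin n) m → Matrix r
  minorOf i c y a b = lookup (φ (lookup y (i a))) (c b)

  private
    lower : ∀ {m} (x : Fin (suc m)) → zero {0} Fin.< x → ∃[ x′ ] x ≡ suc x′
    lower (suc x) _ = x , refl

  -- The rows of the minor come in the order of the variables, so that expanding along
  -- the first row removes the first variable.
  ml-det : ∀ m {r} (i : Fin r → Fin m) → Increasing i → (c : Fin r → Fin (suc D)) →
    Multilinear φ m (λ y → detℚ (minorOf i c y))
  ml-det zero    i inc c = tt
  ml-det (suc m) {zero}  i inc c = ml-const (suc m) 1ℚ
  ml-det (suc m) {suc r} i inc c = by-first (i zero) refl
    where
    below : ∀ {r} (i′ : Fin r → Fin (suc m)) → (∀ a → zero {0} Fin.< i′ a) → Fin r → Fin m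
    below i′ above a = proj₁ (lower (i′ a) (above a))
    below-suc : ∀ {r} (i′ : Fin r → Fin (suc m)) above a → i′ a ≡ suc (below i′ above a)
    below-suc i′ above a = proj₂ (lower (i′ a) (above a))
    below-inc : ∀ {r} (i′ : Fin r → Fin (suc m)) above → Increasing i′ → Increasing (below i′ above)
    below-inc i′ above inc a b a<b = ℕ.≤-pred (subst₂ Fin._<_ (below-suc i′ above a) (below-suc i′ above b) (inc a b a<b))
    shifted : ∀ {r} (i′ : Fin r → Fin (suc m)) above (c′ : Fin r → Fin (suc D)) y z →
      detℚ (minorOf i′ c′ (y ∷ z)) ≡ detℚ (minorOf (below i′ above) c′ z)
    shifted i′ above c′ y z = det-cong λ a b → cong (λ x → lookup (φ (lookup (y ∷ z) x)) (c′ b)) (below-suc i′ above a)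
    tail-pos : ∀ a → zero {0} Fin.< i (suc a)
    tail-pos a = ℕ.≤-<-trans z≤n (inc zero (suc a) (s≤s z≤n))
    i′ : Fin r → Fin m
    i′ = below (i ∘ suc) tail-pos
    h : Fin (suc r) → Vec (Fin n) m → ℚ
    h j z = sgn j ℚ.* detℚ (minorOf i′ (c ∘ punchIn j) z)
    term : Fin (suc r) → Vec (Fin n) (suc m) → ℚ
    term j y = sgn j ℚ.* (minorOf i c y zero j ℚ.* detℚ (minor (minorOf i c y) zero j))
    by-first : ∀ x → i zero ≡ x → Multilinear φ (suc m) (λ y → detℚ (minorOf i c y))
    by-first zero i₀≡0 = ml-sum {suc m} term λ j → ml-∷ φ {m} {term j} {h j} (c j)
      (ml-scale φ {m} (sgn j) (ml-det m i′ (below-inc (i ∘ suc) tail-pos λ a b a<b → inc (suc a) (suc b) (s≤s a<b)) (c ∘ punchIn j)))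
      λ y z → begin
        sgn j ℚ.* (lookup (φ (lookup (y ∷ z) (i zero))) (c j) ℚ.* detℚ (minor (minorOf i c (y ∷ z)) zero j))
          ≡⟨ cong₂ (λ x s → sgn j ℚ.* (lookup (φ (lookup (y ∷ z) x)) (c j) ℚ.* s)) i₀≡0 (shifted (i ∘ suc) tail-pos (c ∘ punchIn j) y z) ⟩
        sgn j ℚ.* (lookup (φ y) (c j) ℚ.* detℚ (minorOf i′ (c ∘ punchIn j) z))
          ≡⟨ solve 3 (λ s x d → s :* (x :* d) := (s :* d) :* x) refl (sgn j) (lookup (φ y) (c j)) (detℚ (minorOf i′ (c ∘ punchIn j) z)) ⟩
        (sgn j ℚ.* detℚ (minorOf i′ (c ∘ punchIn j) z)) ℚ.* lookup (φ y) (c j) ∎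
      where
      open ≡-Reasoning
      open +-*-Solver
    -- The row indices increase, so if the first one is not 0, no row uses the first variable.
    by-first (suc x) i₀≡ = ml-pad {m} {λ y → detℚ (minorOf i c y)} {λ z → detℚ (minorOf (below i all-pos) c z)}
      (ml-det m (below i all-pos) (below-inc i all-pos inc) c) (shifted i all-pos c)
      where
      all-pos : ∀ a → zero {0} Fin.< i a
      all-pos zero    = subst (zero {0} Fin.<_) (sym i₀≡) (s≤s z≤n)
      all-pos (suc a) = tail-pos a

-- Copies described by conditions

holds-map⁺ : {X C A : Set} (ev : C → A → Bool) (c : X → C) (xs : List X) (a : A) → (∀ x → ev (c x) a ≡ true) → holds ev (map c xs) a ≡ true
holds-map⁺ ev c []       a h = refl
holds-map⁺ ev c (x ∷ xs) a h = cong₂ _∧_ (h x) (holds-map⁺ ev c xs a h)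

holds-map⁻ : {X C A : Set} (ev : C → A → Bool) (c : X → C) (xs : List X) (a : A) → holds ev (map c xs) a ≡ true → ∀ {x} → x ∈ xs → ev (c x) a ≡ true
holds-map⁻ ev c (x ∷ xs) a h (here refl) = proj₁ (∧-true h)
holds-map⁻ ev c (x ∷ xs) a h (there x∈)  = holds-map⁻ ev c xs a (proj₂ (∧-true {ev (c x) a} h)) x∈

holds-++⁺ : {C A : Set} (ev : C → A → Bool) (cs ds : List C) {a : A} → holds ev cs a ≡ true → holds ev ds a ≡ true → holds ev (cs ++ ds) a ≡ true
holds-++⁺ ev cs ds {a} h h′ = trans (holds-++ ev cs ds a) (cong₂ _∧_ h h′)

-- `HasSgn` is a relation, so uniqueness of the sign has to be proved; two different signs clash at
-- a late common index.
pos-unique : ∀ x s → HasSgn x pos → HasSgn x s → s ≡ pos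
pos-unique x pos _ _ = refl
pos-unique x neg (ε , 0<ε , 0<x) (η , 0<η , x<0) = ⊥-elim (clash (both 0<x x<0))
  where
  clash : ¬ Eventually (λ n → 0ℚ ℚ.+ ε ℚ.< approx x n × approx x n ℚ.+ η ℚ.< 0ℚ)
  clash (N , h) = ℚ.<-asym (ℚ.<-trans (subst (0ℚ ℚ.<_) (sym (ℚ.+-identityˡ ε)) 0<ε) (proj₁ (h N ℕ.≤-refl)))
    (ℚ.≤-<-trans (subst₂ ℚ._≤_ (ℚ.+-identityʳ (approx x N)) refl (ℚ.+-monoʳ-≤ (approx x N) (ℚ.<⇒≤ 0<η))) (proj₂ (h N ℕ.≤-refl)))
pos-unique x nil (ε , 0<ε , 0<x) x≃0 = ⊥-elim (clash (both 0<x (x≃0 ε 0<ε)))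
  where
  clash : ¬ Eventually (λ n → 0ℚ ℚ.+ ε ℚ.< approx x n × ℚ.∣ approx x n ℚ.- 0ℚ ∣ ℚ.< ε)
  clash (N , h) = ℚ.<-irrefl refl (begin-strict
    ε                             ≡⟨ ℚ.+-identityˡ ε ⟨
    0ℚ ℚ.+ ε                      <⟨ proj₁ (h N ℕ.≤-refl) ⟩
    approx x N                    ≡⟨ ℚ.+-identityʳ (approx x N) ⟨
    approx x N ℚ.- 0ℚ             ≡⟨ ℚ.0≤p⇒∣p∣≡p (subst (0ℚ ℚ.≤_) (sym (ℚ.+-identityʳ (approx x N)))
                                       (ℚ.<⇒≤ (ℚ.<-trans (subst (0ℚ ℚ.<_) (sym (ℚ.+-identityˡ ε)) 0<ε) (proj₁ (h N ℕ.≤-refl))))) ⟨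
    ℚ.∣ approx x N ℚ.- 0ℚ ∣       <⟨ proj₂ (h N ℕ.≤-refl) ⟩
    ε                             ∎)
    where open ℚ.≤-Reasoning

neg-unique : ∀ x s → HasSgn x neg → HasSgn x s → s ≡ neg
neg-unique x neg _ _ = refl
neg-unique x pos x<0 0<x with pos-unique x neg 0<x x<0
... | ()
neg-unique x nil (η , 0<η , x<0) x≃0 = ⊥-elim (clash (both x<0 (x≃0 η 0<η)))
  where
  clash : ¬ Eventually (λ n → approx x n ℚ.+ η ℚ.< 0ℚ × ℚ.∣ approx x n ℚ.- 0ℚ ∣ ℚ.< η)
  clash (N , h) = ℚ.<-irrefl refl (begin-strict
    η                             ≡⟨ solve 2 (λ e x → e := (x :+ e) :+ (:- x)) refl η (approx x N) ⟩
    (approx x N ℚ.+ η) ℚ.- approx x N  <⟨ ℚ.+-monoˡ-< (ℚ.- approx x N) (proj₁ (h N ℕ.≤-refl)) ⟩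
    0ℚ ℚ.- approx x N             ≡⟨ ℚ.+-identityˡ (ℚ.- approx x N) ⟩
    ℚ.- approx x N                ≡⟨ ℚ.0≤p⇒∣p∣≡p (ℚ.neg-antimono-≤ (ℚ.<⇒≤ x<0′)) ⟨
    ℚ.∣ ℚ.- approx x N ∣          ≡⟨ ℚ.∣-p∣≡∣p∣ (approx x N) ⟩
    ℚ.∣ approx x N ∣              ≡⟨ cong ℚ.∣_∣ (ℚ.+-identityʳ (approx x N)) ⟨
    ℚ.∣ approx x N ℚ.- 0ℚ ∣       <⟨ proj₂ (h N ℕ.≤-refl) ⟩
    η                             ∎)
    where
    open ℚ.≤-Reasoning
    open +-*-Solver
    x<0′ : approx x N ℚ.< 0ℚ
    x<0′ = ℚ.≤-<-trans (subst₂ ℚ._≤_ (ℚ.+-identityʳ (approx x N)) refl (ℚ.+-monoʳ-≤ (approx x N) (ℚ.<⇒≤ 0<η))) (proj₁ (h N ℕ.≤-refl))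

orientation-bit : ∀ {d} → (Fin (suc d) → Fin d → ℚ) → Bool
orientation-bit q = bit (detℚ (orientationℚ q))

-- Both orientations are strict, so carrying the sign over in one direction pins it down.
same-bit : ∀ {d} (p p′ : Vector (Point d) (suc d)) q q′ → Signed p q → Signed p′ q′ →
  (∀ s → HasOrientation p s → HasOrientation p′ s) → orientation-bit q ≡ orientation-bit q′
same-bit p p′ q q′ (inj₁ (0<d , positive)) (inj₁ (0<d′ , _)) same = trans (bit-pos 0<d) (sym (bit-pos 0<d′))
same-bit p p′ q q′ (inj₂ (d<0 , negative)) (inj₂ (d′<0 , _)) same = trans (bit-nonpos (ℚ.<⇒≤ d<0)) (sym (bit-nonpos (ℚ.<⇒≤ d′<0)))
same-bit p p′ q q′ (inj₁ (0<d , positive)) (inj₂ (_ , negative)) same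
  with pos-unique (detᴿ (orientationMatrix p′)) neg (same pos positive) negative
... | ()
same-bit p p′ q q′ (inj₂ (d<0 , negative)) (inj₁ (_ , positive)) same
  with pos-unique (detᴿ (orientationMatrix p′)) neg positive (same neg negative)
... | ()

same-orientation : ∀ {d} (p p′ : Vector (Point d) (suc d)) q q′ → Signed p q → Signed p′ q′ →
  orientation-bit q ≡ orientation-bit q′ → ∀ s → HasOrientation p s → HasOrientation p′ s
same-orientation p p′ q q′ (inj₁ (0<d , positive)) (inj₁ (_ , positive′)) eq s has =
  subst (HasOrientation p′) (sym (pos-unique (detᴿ (orientationMatrix p)) s positive has)) positive′
same-orientation p p′ q q′ (inj₂ (d<0 , negative)) (inj₂ (_ , negative′)) eq s has =
  subst (HasOrientation p′) (sym (neg-unique (detᴿ (orientationMatrix p)) s negative has)) negative′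
same-orientation p p′ q q′ (inj₁ (0<d , _)) (inj₂ (d′<0 , _)) eq s has
  with trans (sym (bit-pos 0<d)) (trans eq (bit-nonpos (ℚ.<⇒≤ d′<0)))
... | ()
same-orientation p p′ q q′ (inj₂ (d<0 , _)) (inj₁ (0<d′ , _)) eq s has
  with trans (sym (bit-nonpos (ℚ.<⇒≤ d<0))) (trans eq (bit-pos 0<d′))
... | ()

-- The vertex v is encoded by (1, p(v)), its position, and the indicator of its colour.
module Encoding {d κ n : ℕ} (q : Fin n → Fin d → ℚ) (colour : Fin n → Fin κ) where

  dim : ℕ
  dim = d + suc κ

  φ : Fin n → Vec ℚ (suc dim)
  φ v = (1ℚ ∷ tabulate (q v)) Vec.++ ((ℤ.+ toℕ v ℚ./ 1) ∷ tabulate λ c → ℤ.+ ind (does (colour v Fin.≟ c)) ℚ./ 1)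

  φ-one : ∀ v → lookup (φ v) zero ≡ 1ℚ
  φ-one v = refl

  pointAxis : Fin (suc d) → Fin (suc dim)
  pointAxis b = b ↑ˡ suc κ

  positionAxis : Fin (suc dim)
  positionAxis = suc d ↑ʳ zero

  colourAxis : Fin κ → Fin (suc dim)
  colourAxis c = suc d ↑ʳ suc c

  φ-point : ∀ v b → lookup (φ v) (pointAxis b) ≡ (1ℚ Vector.∷ q v) b
  φ-point v b = trans (Vec.lookup-++ˡ (1ℚ ∷ tabulate (q v)) _ b) (head-or-tail b)
    where
    head-or-tail : ∀ b → lookup (1ℚ ∷ tabulate (q v)) b ≡ (1ℚ Vector.∷ q v) b
    head-or-tail zero    = refl
    head-or-tail (suc b) = Vec.lookup∘tabulate (q v) b

  φ-position : ∀ v → lookup (φ v) positionAxis ≡ ℤ.+ toℕ v ℚ./ 1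
  φ-position v = Vec.lookup-++ʳ (1ℚ ∷ tabulate (q v)) _ zero

  φ-colour : ∀ v c → lookup (φ v) (colourAxis c) ≡ ℤ.+ ind (does (colour v Fin.≟ c)) ℚ./ 1
  φ-colour v c = trans (Vec.lookup-++ʳ (1ℚ ∷ tabulate (q v)) _ (suc c)) (Vec.lookup∘tabulate _ c)

  -- A filler that always holds, used for index tuples that impose nothing. It makes the number of
  -- conditions depend on k and d only.
  trivial : ∀ {k} → Condition φ k
  trivial {k} = condition (λ _ → 1ℚ) (ml-const φ φ-one k 1ℚ) true

  module _ {k : ℕ} where

    orientationForm : Vec (Fin k) (suc d) → Vec (Fin n) k → ℚ
    orientationForm i y = detℚ (minorOf φ φ-one (lookup i) pointAxis y)

    orientationForm-bit : ∀ i (y : Vec (Fin n) k) → bit (orientationForm i y) ≡ orientation-bit (q ∘ lookup y ∘ lookup i)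
    orientationForm-bit i y = cong bit (det-cong {M = minorOf φ φ-one (lookup i) pointAxis y} {N = orientationℚ (q ∘ lookup y ∘ lookup i)}
      λ a b → φ-point (lookup y (lookup i a)) b)

    orientationCondition : (Vec (Fin k) (suc d) → Bool) → (i : Vec (Fin k) (suc d)) → Dec (Increasing (lookup i)) → Condition φ k
    orientationCondition σ i (yes inc) = condition (orientationForm i) (ml-det φ φ-one k (lookup i) inc pointAxis) (σ i)
    orientationCondition σ i (no _)    = trivial

    orderForm : Fin k → Fin k → Vec (Fin n) k → ℚ
    orderForm a b y = lookup (φ (lookup y b)) positionAxis ℚ.+ (ℚ.- 1ℚ) ℚ.* lookup (φ (lookup y a)) positionAxis

    orderForm-value : ∀ a b y → orderForm a b y ≡ (ℤ.+ toℕ (lookup y b) ℚ./ 1) ℚ.- (ℤ.+ toℕ (lookup y a) ℚ./ 1)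
    orderForm-value a b y = trans
      (cong₂ (λ s t → s ℚ.+ (ℚ.- 1ℚ) ℚ.* t) (φ-position (lookup y b)) (φ-position (lookup y a)))
      (solve 2 (λ s t → s :+ con (ℚ.- 1ℚ) :* t := s :- t) refl (ℤ.+ toℕ (lookup y b) ℚ./ 1) (ℤ.+ toℕ (lookup y a) ℚ./ 1))
      where open +-*-Solver

    orderCondition : (a b : Fin k) → Dec (a Fin.< b) → Condition φ k
    orderCondition a b (yes _) = condition (orderForm a b)
      (ml-+ φ {k} (ml-coordinate φ φ-one b positionAxis) (ml-scale φ {k} (ℚ.- 1ℚ) (ml-coordinate φ φ-one a positionAxis))) true
    orderCondition a b (no _)  = trivial

    colourCondition : (Fin k → Fin κ) → Fin k → Condition φ k
    colourCondition γ a = condition (λ y → lookup (φ (lookup y a)) (colourAxis (γ a))) (ml-coordinate φ φ-one a (colourAxis (γ a))) true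

    conditions : (Vec (Fin k) (suc d) → Bool) → (Fin k → Fin κ) → List (Condition φ k)
    conditions σ γ = map (λ i → orientationCondition σ i (increasing? (lookup i))) (tuples k (suc d)) ++
      (map (λ (a , b) → orderCondition a b (a Fin.<? b)) (cartesianProduct (allFin k) (allFin k)) ++
       map (colourCondition γ) (allFin k))

    length-conditions : ∀ σ γ → length (conditions σ γ) ≡ k ^ suc d + (k * k + k)
    length-conditions σ γ = trans (List.length-++ (map _ (tuples k (suc d)))) (cong₂ _+_
      (trans (List.length-map _ (tuples k (suc d))) (length-tuples k (suc d)))
      (trans (List.length-++ (map _ (cartesianProduct (allFin k) (allFin k)))) (cong₂ _+_
        (trans (List.length-map _ (cartesianProduct (allFin k) (allFin k)))
          (trans (length-cartesian (allFin k) (allFin k)) (cong₂ _*_ (length-allFin k) (length-allFin k))))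
        (trans (List.length-map (colourCondition γ) (allFin k)) (length-allFin k)))))

    Pattern : (Vec (Fin k) (suc d) → Bool) → (Fin k → Fin κ) → Vec (Fin n) k → Set
    Pattern σ γ y = (∀ i → Increasing (lookup i) → orientation-bit (q ∘ lookup y ∘ lookup i) ≡ σ i) ×
      Increasing (lookup y) × (∀ a → colour (lookup y a) ≡ γ a)

    conditions-hold : ∀ σ γ y → Pattern σ γ y → holds meets (conditions σ γ) y ≡ true
    conditions-hold σ γ y (orient , inc , col) =
      holds-++⁺ meets (map _ (tuples k (suc d))) _ (holds-map⁺ meets _ (tuples k (suc d)) y λ i → orient-holds i (increasing? (lookup i)))
        (holds-++⁺ meets (map _ (cartesianProduct (allFin k) (allFin k))) _
          (holds-map⁺ meets _ (cartesianProduct (allFin k) (allFin k)) y λ (a , b) → order-holds a b (a Fin.<? b))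
          (holds-map⁺ meets (colourCondition γ) (allFin k) y colour-holds))
      where
      orient-holds : ∀ i dec → meets (orientationCondition σ i dec) y ≡ true
      orient-holds i (yes inc′) = ≡-agree _ (σ i) (trans (orientationForm-bit i y) (orient i inc′))
      orient-holds i (no _)     = bit-pos (ℚ.positive⁻¹ 1ℚ)
      difference : ∀ s t → s ℚ.< t → 0ℚ ℚ.< t ℚ.- s
      difference s t s<t = subst (ℚ._< t ℚ.- s) (ℚ.+-inverseʳ s) (ℚ.+-monoˡ-< (ℚ.- s) s<t)
      order-holds : ∀ a b dec → meets (orderCondition a b dec) y ≡ true
      order-holds a b (yes a<b) = bit-pos (subst (0ℚ ℚ.<_) (sym (orderForm-value a b y))
        (difference (ℤ.+ toℕ (lookup y a) ℚ./ 1) (ℤ.+ toℕ (lookup y b) ℚ./ 1) (/1-mono-< (inc a b a<b))))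
      order-holds a b (no _)    = bit-pos (ℚ.positive⁻¹ 1ℚ)
      colour-holds : ∀ a → meets (colourCondition γ a) y ≡ true
      colour-holds a = bit-pos (subst (0ℚ ℚ.<_) (sym (trans (φ-colour (lookup y a) (γ a))
        (cong (λ b → ℤ.+ ind b ℚ./ 1) (dec-true (colour (lookup y a) Fin.≟ γ a) (col a))))) (ℚ.positive⁻¹ 1ℚ))

    pattern-holds : ∀ σ γ y → holds meets (conditions σ γ) y ≡ true → Pattern σ γ y
    pattern-holds σ γ y h = orient , inc , col
      where
      split : holds meets (map (λ i → orientationCondition σ i (increasing? (lookup i))) (tuples k (suc d))) y ≡ true × _
      split = holds-++⁻ meets (map (λ i → orientationCondition σ i (increasing? (lookup i))) (tuples k (suc d))) _ {y} h
      split′ : holds meets (map (λ (a , b) → orderCondition a b (a Fin.<? b)) (cartesianProduct (allFin k) (allFin k))) y ≡ true × _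
      split′ = holds-++⁻ meets (map (λ (a , b) → orderCondition a b (a Fin.<? b)) (cartesianProduct (allFin k) (allFin k))) _ {y} (proj₂ split)
      from-orient : ∀ i dec → Increasing (lookup i) → meets (orientationCondition σ i dec) y ≡ true →
        orientation-bit (q ∘ lookup y ∘ lookup i) ≡ σ i
      from-orient i (yes _)   inc′ m = trans (sym (orientationForm-bit i y)) (agree-≡ _ (σ i) m)
      from-orient i (no ¬inc) inc′ m = ⊥-elim (¬inc inc′)
      orient : ∀ i → Increasing (lookup i) → orientation-bit (q ∘ lookup y ∘ lookup i) ≡ σ i
      orient i inc′ = from-orient i (increasing? (lookup i)) inc′ (holds-map⁻ meets _ (tuples k (suc d)) y (proj₁ split) (∈-tuples i))
      from-order : ∀ a b dec → a Fin.< b → meets (orderCondition a b dec) y ≡ true → lookup y a Fin.< lookup y b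
      from-order a b (no a≮b)  a<b m = ⊥-elim (a≮b a<b)
      from-order a b (yes _) a<b m = /1-cancel-< (begin-strict
        s                  ≡⟨ ℚ.+-identityˡ s ⟨
        0ℚ ℚ.+ s           <⟨ ℚ.+-monoˡ-< s (subst (0ℚ ℚ.<_) (orderForm-value a b y) (bit-true m)) ⟩
        (t ℚ.- s) ℚ.+ s    ≡⟨ solve 2 (λ t s → (t :- s) :+ s := t) refl t s ⟩
        t                  ∎)
        where
        open ℚ.≤-Reasoning
        open +-*-Solver
        s t : ℚ
        s = ℤ.+ toℕ (lookup y a) ℚ./ 1
        t = ℤ.+ toℕ (lookup y b) ℚ./ 1
      inc : Increasing (lookup y)
      inc a b a<b = from-order a b (a Fin.<? b) a<b (holds-map⁻ meets (λ (a , b) → orderCondition a b (a Fin.<? b))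
        (cartesianProduct (allFin k) (allFin k)) y (proj₁ split′) (∈.∈-cartesianProduct⁺ (∈.∈-allFin a) (∈.∈-allFin b)))
      from-colour : ∀ a (dec : Dec (colour (lookup y a) ≡ γ a)) → 0ℚ ℚ.< ℤ.+ ind (does dec) ℚ./ 1 → colour (lookup y a) ≡ γ a
      from-colour a (yes eq) _   = eq
      from-colour a (no _)   0<0 = ⊥-elim (ℚ.<-irrefl refl 0<0)
      col : ∀ a → colour (lookup y a) ≡ γ a
      col a = from-colour a (colour (lookup y a) Fin.≟ γ a) (subst (0ℚ ℚ.<_) (φ-colour (lookup y a) (γ a))
        (bit-true (holds-map⁻ meets (colourCondition γ) (allFin k) y (proj₂ split′) (∈.∈-allFin a))))

module _ {d κ n k : ℕ} (P : ColouredSeq d κ n) (gp : GeneralPosition (point P)) (ρ : ColouredSeq d κ k) where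
  private
    q : Fin n → Fin d → ℚ
    q = proj₁ (rational-points (point P) gp)
    signed : ∀ (i : Fin (suc d) → Fin n) → StrictlyIncreasing i → Signed (point P ∘ i) (q ∘ i)
    signed = proj₂ (rational-points (point P) gp)
  open Encoding q (colour P)

  module _ (f : Vec (Fin n) k) (f-inc : StrictlyIncreasing (lookup f)) (f-copy : IsCopy (P ∘ˢ lookup f) ρ) where
    private
      σ : Vec (Fin k) (suc d) → Bool
      -- The rational points belong to P, so the sign pattern of ρ is read off from one copy of it;
      -- all copies share this pattern.
      σ i = orientation-bit (q ∘ lookup f ∘ lookup i)

    copyConditions : List (Condition φ k)
    copyConditions = conditions σ (colour ρ)

    copy-meets : ∀ g → StrictlyIncreasing (lookup g) × IsCopy (P ∘ˢ lookup g) ρ → holds meets copyConditions g ≡ true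
    copy-meets g (g-inc , g-copy) = conditions-hold σ (colour ρ) g (orient , (λ a b → g-inc) , proj₂ g-copy)
      where
      orient : ∀ i → Increasing (lookup i) → orientation-bit (q ∘ lookup g ∘ lookup i) ≡ σ i
      orient i inc = same-bit (point P ∘ lookup g ∘ lookup i) (point P ∘ lookup f ∘ lookup i) (q ∘ lookup g ∘ lookup i) (q ∘ lookup f ∘ lookup i)
        (signed (lookup g ∘ lookup i) (λ {a} {b} a<b → g-inc (inc a b a<b)))
        (signed (lookup f ∘ lookup i) (λ {a} {b} a<b → f-inc (inc a b a<b)))
        λ s has → Equivalence.from (proj₁ f-copy (lookup i) (λ {a} {b} → inc a b) s) (Equivalence.to (proj₁ g-copy (lookup i) (λ {a} {b} → inc a b) s) has)

    meets-copy : ∀ x → holds meets copyConditions (tabulate x) ≡ true → IsCopy (P ∘ˢ x) ρ × StrictlyIncreasing x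
    meets-copy x h = from (pattern-holds σ (colour ρ) (tabulate x) h)
      where
      from : Pattern σ (colour ρ) (tabulate x) → IsCopy (P ∘ˢ x) ρ × StrictlyIncreasing x
      from (orient , inc , col) = (order-type , λ a → trans (cong (colour P) (sym (Vec.lookup∘tabulate x a))) (col a)) , x-inc
        where
        x-inc : StrictlyIncreasing x
        x-inc {a} {b} a<b = subst₂ Fin._<_ (Vec.lookup∘tabulate x a) (Vec.lookup∘tabulate x b) (inc a b a<b)
        order-type : SameOrderType (point (P ∘ˢ x)) (point ρ)
        order-type i i-inc s = mk⇔ (λ has → Equivalence.to (proj₁ f-copy i i-inc s) (same-orientation px pf qx qf sx sf bits s has))
          (λ has → same-orientation pf px qf qx sf sx (sym bits) s (Equivalence.from (proj₁ f-copy i i-inc s) has))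
          where
          px pf : Vector (Point d) (suc d)
          px = point P ∘ x ∘ i
          pf = point P ∘ lookup f ∘ i
          qx qf : Fin (suc d) → Fin d → ℚ
          qx = q ∘ x ∘ i
          qf = q ∘ lookup f ∘ i
          sx : Signed px qx
          sx = signed (x ∘ i) (λ {a} {b} a<b → x-inc (i-inc a<b))
          sf : Signed pf qf
          sf = signed (lookup f ∘ i) (λ {a} {b} a<b → f-inc (i-inc a<b))
          v : Vec (Fin k) (suc d)
          v = tabulate i
          v-inc : Increasing (lookup v)
          v-inc a b a<b = subst₂ Fin._<_ (sym (Vec.lookup∘tabulate i a)) (sym (Vec.lookup∘tabulate i b)) (i-inc a<b)
          bit-cong : ∀ (r s : Fin (suc d) → Fin d → ℚ) → (∀ a → r a ≡ s a) → orientation-bit r ≡ orientation-bit s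
          bit-cong r s r≗s = cong bit (det-cong {M = orientationℚ r} {N = orientationℚ s} λ a b → cong (λ t → (1ℚ Vector.∷ t) b) (r≗s a))
          bits : orientation-bit qx ≡ orientation-bit qf
          bits = trans
            (bit-cong qx (q ∘ lookup (tabulate x) ∘ lookup v) λ a → cong q (sym (trans (Vec.lookup∘tabulate x (lookup v a)) (cong x (Vec.lookup∘tabulate i a)))))
            (trans (orient v v-inc) (bit-cong (q ∘ lookup f ∘ lookup v) qf λ a → cong (q ∘ lookup f) (Vec.lookup∘tabulate i a)))

-- From parts to subsets, and the constants

∑-tabulate : {A : Set} {n : ℕ} (g : Fin n → A) (f : A → ℕ) → ∑ (List.tabulate g) f ≡ ∑ (allFin n) (f ∘ g)
∑-tabulate {n = zero}  g f = refl
∑-tabulate {n = suc n} g f = cong (f (g zero) +_) (trans (∑-tabulate (g ∘ suc) f) (sym (∑-tabulate suc (f ∘ g))))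

∣tabulate∣ : ∀ {n} (X : Fin n → Bool) → ∣ tabulate X ∣ ≡ count X (allFin n)
∣tabulate∣ {zero}  X = refl
∣tabulate∣ {suc n} X = trans (head-or-not (X zero)) (cong (ind (X zero) +_) (trans (∣tabulate∣ (X ∘ suc)) (sym (∑-tabulate suc (ind ∘ X)))))
  where
  head-or-not : ∀ b → ∣ b ∷ tabulate (X ∘ suc) ∣ ≡ ind b + ∣ tabulate (X ∘ suc) ∣
  head-or-not true  = refl
  head-or-not false = refl

∈-tabulate⁻ : ∀ {n} (X : Fin n → Bool) {v} → v ∈ˢ tabulate X → X v ≡ true
∈-tabulate⁻ X {v} v∈ = trans (sym (Vec.lookup∘tabulate X v)) (Vec.[]=⇒lookup v∈)

-- Replacing the entries i and j of a transversal by a common element of X i and X j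
-- would give a transversal that is not increasing.
increasing⇒disjoint : ∀ {n k} (X : Fin k → Fin n → Bool) → (∀ l → ∃[ v ] X l v ≡ true) →
  (∀ x → (∀ l → X l (x l) ≡ true) → StrictlyIncreasing x) → PairwiseDisjoint (λ l → tabulate (X l))
increasing⇒disjoint {n} {k} X inhabited inc i j i≢j (v , v∈) = clash (Fin.<-cmp i j)
  where
  Xi : X i v ≡ true
  Xi = ∈-tabulate⁻ (X i) (proj₁ (Subset.x∈p∩q⁻ (tabulate (X i)) (tabulate (X j)) v∈))
  Xj : X j v ≡ true
  Xj = ∈-tabulate⁻ (X j) (proj₂ (Subset.x∈p∩q⁻ (tabulate (X i)) (tabulate (X j)) v∈))
  pick : ∀ l → Dec (l ≡ i) → Dec (l ≡ j) → ∃[ u ] X l u ≡ true × (l ≡ i ⊎ l ≡ j → u ≡ v)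
  pick l (yes refl) _          = v , Xi , λ _ → refl
  pick l (no _)     (yes refl) = v , Xj , λ _ → refl
  pick l (no l≢i)   (no l≢j)   = proj₁ (inhabited l) , proj₂ (inhabited l) ,
    λ { (inj₁ l≡i) → ⊥-elim (l≢i l≡i) ; (inj₂ l≡j) → ⊥-elim (l≢j l≡j) }
  picked : ∀ l → ∃[ u ] X l u ≡ true × (l ≡ i ⊎ l ≡ j → u ≡ v)
  picked l = pick l (l Fin.≟ i) (l Fin.≟ j)
  x : Fin k → Fin n
  x l = proj₁ (picked l)
  x-inc : StrictlyIncreasing x
  x-inc = inc x λ l → proj₁ (proj₂ (picked l))
  xi≡xj : x i ≡ x j
  xi≡xj = trans (proj₂ (proj₂ (picked i)) (inj₁ refl)) (sym (proj₂ (proj₂ (picked j)) (inj₂ refl)))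
  clash : Tri (i Fin.< j) (i ≡ j) (j Fin.< i) → ⊥
  clash (tri< i<j _ _) = Fin.<⇒≢ (x-inc i<j) xi≡xj
  clash (tri≈ _ i≡j _) = i≢j i≡j
  clash (tri> _ _ j<i) = Fin.<⇒≢ (x-inc j<i) (sym xi≡xj)

-- An inequality of reals is the negation of a strict one, and the conclusion concerns natural
-- numbers, so it may be proved by contradiction. If it failed, u c - l with u = 1/(b + 1) would be
-- a positive margin witnessing that the density bound is violated.
real-density : ∀ b δ {c l} → Eventually (λ n → unit-fraction b ℚ.< approx δ n) →
  δ *ᴿ fromℕ c ≤ᴿ fromℕ l → c ≤ suc b * l
real-density b δ {c} {l} δ-large dense = ℕ.≮⇒≥ λ few → dense (less few)
  where
  u ι ιl : ℚ
  u = unit-fraction b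
  ι = ℤ.+ c ℚ./ 1
  ιl = ℤ.+ l ℚ./ 1
  less : suc b * l < c → fromℕ l <ᴿ δ *ᴿ fromℕ c
  less few = u ℚ.* ι ℚ.- ιl , gap-pos , eventually-map (λ n large → begin-strict
      ιl ℚ.+ (u ℚ.* ι ℚ.- ιl)        ≡⟨ solve 2 (λ s t → s :+ (t :- s) := t) refl ιl (u ℚ.* ι) ⟩
      u ℚ.* ι                        <⟨ ℚ.*-monoˡ-<-pos ι {{ℚ.positive ι-pos}} large ⟩
      approx δ n ℚ.* ι               ∎) δ-large
    where
    open ℚ.≤-Reasoning
    open +-*-Solver
    ι-pos : 0ℚ ℚ.< ι
    ι-pos = /1-mono-< (ℕ.≤-<-trans z≤n few)
    l-small : ιl ℚ.< u ℚ.* ι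
    l-small = begin-strict
      ιl                             ≡⟨ ℚ.*-identityˡ ιl ⟨
      1ℚ ℚ.* ιl                      ≡⟨ cong (ℚ._* ιl) (unit-fraction-inverse b) ⟨
      (u ℚ.* (ℤ.+ suc b ℚ./ 1)) ℚ.* ιl   ≡⟨ ℚ.*-assoc u (ℤ.+ suc b ℚ./ 1) ιl ⟩
      u ℚ.* ((ℤ.+ suc b ℚ./ 1) ℚ.* ιl)   ≡⟨ cong (u ℚ.*_) (/1-* (suc b) l) ⟨
      u ℚ.* (ℤ.+ (suc b * l) ℚ./ 1)  <⟨ ℚ.*-monoʳ-<-pos u (/1-mono-< few) ⟩
      u ℚ.* ι                        ∎
    gap-pos : 0ℚ ℚ.< u ℚ.* ι ℚ.- ιl
    gap-pos = subst (ℚ._< u ℚ.* ι ℚ.- ιl) (ℚ.+-inverseʳ ιl) (ℚ.+-monoˡ-< (ℚ.- ιl) l-small)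

fraction≤ : ∀ C {n s} → n ≤ suc C * s → fromℚ (unit-fraction C) *ᴿ fromℕ n ≤ᴿ fromℕ s
fraction≤ C {n} {s} n≤ (ε , 0<ε , N , less) = ℚ.<-irrefl refl (begin-strict
  ιs                                   ≡⟨ ℚ.+-identityʳ ιs ⟨
  ιs ℚ.+ 0ℚ                            <⟨ ℚ.+-monoʳ-< ιs 0<ε ⟩
  ιs ℚ.+ ε                             <⟨ less N ℕ.≤-refl ⟩
  u ℚ.* (ℤ.+ n ℚ./ 1)                  ≤⟨ ℚ.*-monoˡ-≤-nonNeg u (/1-mono-≤ n≤) ⟩
  u ℚ.* (ℤ.+ (suc C * s) ℚ./ 1)        ≡⟨ cong (u ℚ.*_) (/1-* (suc C) s) ⟩
  u ℚ.* ((ℤ.+ suc C ℚ./ 1) ℚ.* ιs)     ≡⟨ ℚ.*-assoc u (ℤ.+ suc C ℚ./ 1) ιs ⟨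
  (u ℚ.* (ℤ.+ suc C ℚ./ 1)) ℚ.* ιs     ≡⟨ cong (ℚ._* ιs) (unit-fraction-inverse C) ⟩
  1ℚ ℚ.* ιs                            ≡⟨ ℚ.*-identityˡ ιs ⟩
  ιs                                   ∎)
  where
  open ℚ.≤-Reasoning
  u ιs : ℚ
  u = unit-fraction C
  ιs = ℤ.+ s ℚ./ 1

fromℚ-pos : ∀ q → 0ℚ ℚ.< q → 0ℝ <ᴿ fromℚ q
fromℚ-pos q 0<q = ½ ℚ.* q , half-pos 0<q , 0 , λ n _ →
  subst (0ℚ ℚ.+ ½ ℚ.* q ℚ.<_) (half+half q) (ℚ.+-monoˡ-< (½ ℚ.* q) (half-pos 0<q))

CopyParts : ∀ {d κ n k} → ℕ → ColouredSeq d κ n → ColouredSeq d κ k → Set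
CopyParts {n = n} {k} C P ρ = Σ (Fin k → Fin n → Bool) λ X → (∀ i → n ≤ suc C * count (X i) (allFin n)) ×
  (∀ x → (∀ i → X i (x i) ≡ true) → IsCopy (P ∘ˢ x) ρ × StrictlyIncreasing x)

DenseCopies : (d k κ K C : ℕ) → Set
DenseCopies d k κ K C = ∀ {n} → 0 < n → (P : ColouredSeq d κ n) → GeneralPosition (point P) → (ρ : ColouredSeq d κ k) →
  (copies : List (Vec (Fin n) k)) → Unique copies →
  All (λ f → StrictlyIncreasing (lookup f) × IsCopy (P ∘ˢ lookup f) ρ) copies → n ^ k ≤ K * length copies →
  CopyParts C P ρ

dense-copies : ∀ d k κ K → ∃ (DenseCopies d k κ K)
dense-copies d k κ K = from (dense-conditions (suc (d + suc κ)) k (k ^ suc d + (k * k + k)) K)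
  where
  from : ∃ (DenseConditions (suc (d + suc κ)) k (k ^ suc d + (k * k + k)) K) → ∃ (DenseCopies d k κ K)
  from (C , dense) = C , step
    where
    step : DenseCopies d k κ K C
    -- Some copy must exist to prescribe the signs; an empty list contradicts n^k > 0.
    step {n} 0<n P gp ρ [] unique all many = ⊥-elim (ℕ.<⇒≱ (ℕ.m^n>0 n {{>-nonZero 0<n}} k)
      (ℕ.≤-trans many (ℕ.≤-reflexive (ℕ.*-zeroʳ K))))
    step {n} 0<n P gp ρ copies@(f ∷ _) unique all@((f-inc , f-copy) ∷ _) many = found (dense φ cs 0<n
        (ℕ.≤-reflexive (length-conditions _ (colour ρ)))
        (ℕ.≤-trans many (ℕ.*-monoʳ-≤ K (unique-length≤count (holds meets cs) copies unique
          (All.map (λ {g} → copy-meets P gp ρ f f-inc f-copy g) all)))))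
      where
      open Encoding (proj₁ (rational-points (point P) gp)) (colour P)
      cs : List (Condition φ k)
      cs = copyConditions P gp ρ f f-inc f-copy
      found : Parts n k C (λ y → holds meets cs y ≡ true) → CopyParts C P ρ
      -- Passing from C to C + 1 keeps the bound and guarantees a reciprocal.
      found (X , big , transversal) = X , (λ i → ℕ.≤-trans (big i) (ℕ.m≤n+m _ (count (X i) (allFin n)))) ,
        λ x x∈ → meets-copy P gp ρ f f-inc f-copy x (transversal (tabulate x)
          λ i → trans (cong (X i) (Vec.lookup∘tabulate x i)) (x∈ i))

theorem1 : (d k κ : ℕ) → 1 ≤ d → 1 ≤ k → 1 ≤ κ →
    (δ : ℝ) → 0ℝ <ᴿ δ →
    Σ ℝ λ c → (0ℝ <ᴿ c) ×
    ((n : ℕ) → k ≤ n →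
    (P : ColouredSeq d κ n) → GeneralPosition (point P) →
    (ρ : ColouredSeq d κ k) → GeneralPosition (point ρ) →
    HasDensity δ ρ P →
    Σ (Fin k → Subset n) λ X →
    PairwiseDisjoint X ×
    ((i : Fin k) → c *ᴿ fromℕ n ≤ᴿ fromℕ ∣ X i ∣) ×
    HasTypeTransversals ρ P X)
theorem1 d k κ 1≤d 1≤k 1≤κ δ (ε , 0<ε , δ>ε) = from-density (unit-fraction-below 0<ε) (power≤binomial k)
  where
  Solution : ℝ → Set
  Solution c = (n : ℕ) → k ≤ n →
    (P : ColouredSeq d κ n) → GeneralPosition (point P) → (ρ : ColouredSeq d κ k) → GeneralPosition (point ρ) →
    HasDensity δ ρ P → Σ (Fin k → Subset n) λ X →
    PairwiseDisjoint X × ((i : Fin k) → c *ᴿ fromℕ n ≤ᴿ fromℕ ∣ X i ∣) × HasTypeTransversals ρ P X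

  subsets : ∀ C {n} → 0 < n → (P : ColouredSeq d κ n) (ρ : ColouredSeq d κ k) → CopyParts C P ρ → Σ (Fin k → Subset n) λ X →
    PairwiseDisjoint X × ((i : Fin k) → fromℚ (unit-fraction C) *ᴿ fromℕ n ≤ᴿ fromℕ ∣ X i ∣) × HasTypeTransversals ρ P X
  subsets C {n} 0<n P ρ (X , big , transversal) = (λ i → tabulate (X i)) ,
    increasing⇒disjoint X inhabited (λ x x∈ → proj₂ (transversal x x∈)) ,
    (λ i → fraction≤ C (subst (λ s → n ≤ suc C * s) (sym (∣tabulate∣ (X i))) (big i))) ,
    λ x x∈ → transversal x λ i → ∈-tabulate⁻ (X i) (x∈ i)
    where
    nonempty : ∀ i → 0 < count (X i) (allFin n)
    nonempty i = ℕ.n≢0⇒n>0 λ eq → ℕ.<⇒≱ 0<n (ℕ.≤-trans (big i) (ℕ.≤-reflexive (trans (cong (suc C *_) eq) (ℕ.*-zeroʳ (suc C)))))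
    inhabited : ∀ i → ∃[ v ] X i v ≡ true
    inhabited i = let (v , _ , Xv) = count-witness (X i) (allFin n) (nonempty i) in v , Xv

  from-density : (∃[ b ] unit-fraction b ℚ.≤ ε) → (∃[ K ] ∀ n → k ≤ n → n ^ k ≤ K * (n choose k)) →
    Σ ℝ λ c → (0ℝ <ᴿ c) × Solution c
  -- `K` compares n^k with the binomial coefficient and 1/(b + 1) bounds δ from below, so the copies
  -- fill at least a 1/(K (b + 1)) fraction of all k-tuples.
  from-density (b , u≤ε) (K , n^k≤) = from-copies (dense-copies d k κ (K * suc b))
    where
    δ-large : Eventually (λ n → unit-fraction b ℚ.< approx δ n)
    δ-large = eventually-map (λ n less → ℚ.≤-<-trans u≤ε (subst (ℚ._< approx δ n) (ℚ.+-identityˡ ε) less)) δ>ε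
    from-copies : ∃ (DenseCopies d k κ (K * suc b)) → Σ ℝ λ c → (0ℝ <ᴿ c) × Solution c
    from-copies (C , dense) = fromℚ (unit-fraction C) , fromℚ-pos (unit-fraction C) (ℚ.positive⁻¹ (unit-fraction C)) ,
      λ n k≤n P gp ρ _ (copies , unique , all , many) →
        subsets C (ℕ.≤-trans 1≤k k≤n) P ρ (dense (ℕ.≤-trans 1≤k k≤n) P gp ρ copies unique all (begin
          n ^ k                            ≤⟨ n^k≤ n k≤n ⟩
          K * (n choose k)                      ≤⟨ ℕ.*-monoʳ-≤ K (real-density b δ δ-large many) ⟩
          K * (suc b * length copies)      ≡⟨ ℕ.*-assoc K (suc b) (length copies) ⟨
          K * suc b * length copies        ∎))
      where open ℕ.≤-Reasoning
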